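{- Let $k\ge3$ be odd and $n\ge0$ an integer. For every prime power $q\equiv 2k+1\pmod{4k}$ with $q>8k^5n$, there exists an $(\mathbb F_q^\Box,k;n)$ Heffter difference packing $\{B_1,\dots,B_n\}$ in which every $B_i$ admits an ordering $(b_0,\dots,b_{k-1})$ whose partial sums $b_0, b_0+b_1,\dots,b_0+\dots+b_{k-1}$ are pairwise distinct.
   Context: Here $v=\frac{q-1}{2}$ (odd, since $q\equiv3\pmod4$). $\mathbb F_q^\Box$ denotes the multiplicative group of nonzero squares of $\mathbb F_q$. Fix a group isomorphism $\phi:\mathbb F_q^\Box\to\mathbb Z_v$. An $(\mathbb F_q^\Box,k;n)$ Heffter difference packing is a family of $n$ $k$-subsets $B_1,\dots,B_n$ of $\mathbb F_q^\Box$ such that: the multiset of all differences $a-b$, with $(a,b)$ an ordered pair of distinct elements of a common $\phi(B_i)$, over all $i$, has no repeated element of $\mathbb Z_v$; $k$ divides $v$ and the elements of each $\phi(B_i)$ are pairwise distinct modulo $k$; each $B_i$ sums to $0$ in $\mathbb F_q$. For $n=0$ the empty family counts. -}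

module Defs where

open import Algebra.Bundles using (AbelianGroup; CommutativeRing)
import Algebra.Properties.CommutativeMonoid.Sum as Sum
import Algebra.Properties.CommutativeSemigroup as CommutativeSemigroupProperties
open import Algebra.Morphism.Structures using (module GroupMorphisms)
open import Data.Fin.Base using (Fin; zero; suc)
open import Data.Fin.Permutation using (Permutation′; _⟨$⟩ʳ_)
open import Data.Integer.Base as ℤ using (ℤ; +_; 0ℤ)
import Data.Integer.Divisibility.Signed as ℤ
import Data.Integer.Properties as ℤ
open import Data.Integer.Tactic.RingSolver using (solve-∀)
open import Data.Nat.Base as ℕ using (ℕ)
import Data.Nat.Divisibility as ℕ
import Data.Nat.DivMod as ℕ
open import Data.Nat.Primality using (Prime)
open import Data.Product.Base using (Σ; ∃; ∃₂; _×_; _,_; proj₁; proj₂)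
open import Data.Vec.Functional using (Vector; tail)
open import Function.Base using (_∘_)
open import Function.Bundles using (Inverse)
open import Function.Definitions using (Injective)
open import Level using (_⊔_) renaming (suc to lsuc; zero to lzero)
open import Relation.Binary.Bundles using (Setoid)
open import Relation.Binary.PropositionalEquality as ≡ using (_≡_; _≢_)
open import Relation.Nullary.Negation using (¬_)

PrimePower : ℕ → Set
PrimePower q = ∃₂ λ p m → Prime p × 1 ℕ.≤ m × q ≡ p ℕ.^ m

infix 4 _≡_[mod_]

_≡_[mod_] : ℤ → ℤ → ℕ → Set
x ≡ y [mod n ] = + n ℤ.∣ x ℤ.- y

-- The cyclic group ℤ/n, presented as ℤ with congruence modulo n as its
-- equality, so that reduction to a divisor of n needs no map.
ℤ/ : ℕ → AbelianGroup lzero lzero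
ℤ/ n = record
  { Carrier = ℤ
  ; _≈_ = λ x y → x ≡ y [mod n ]
  ; _∙_ = ℤ._+_
  ; ε = 0ℤ
  ; _⁻¹ = ℤ.-_
  ; isAbelianGroup = record
    { isGroup = record
      { isMonoid = record
        { isSemigroup = record
          { isMagma = record
            { isEquivalence = record
              { refl = λ {x} → ≈-reflexive {x} ≡.refl
              ; sym = λ {x} {y} p →
                  by (neg-sub x y) (ℤ.∣m⇒∣-m p)
              ; trans = λ {x} {y} {z} p r →
                  by (telescope x y z) (ℤ.∣m∣n⇒∣m+n p r)
              }
            ; ∙-cong = λ {x} {y} {u} {w} p r →
                by (add-sub x y u w) (ℤ.∣m∣n⇒∣m+n p r)
            }
          ; assoc = λ x y z → ≈-reflexive (ℤ.+-assoc x y z)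
          }
        ; identity = (λ x → ≈-reflexive (ℤ.+-identityˡ x))
                   , (λ x → ≈-reflexive (ℤ.+-identityʳ x))
        }
      ; inverse = (λ x → ≈-reflexive (ℤ.+-inverseˡ x))
                , (λ x → ≈-reflexive (ℤ.+-inverseʳ x))
      ; ⁻¹-cong = λ {x} {y} p → by (neg-cong x y) (ℤ.∣m⇒∣-m p)
      }
    ; comm = λ x y → ≈-reflexive (ℤ.+-comm x y)
    }
  }
  where
  by : ∀ {x y} → x ≡ y → + n ℤ.∣ x → + n ℤ.∣ y
  by = ≡.subst (+ n ℤ.∣_)

  ≈-reflexive : ∀ {x y} → x ≡ y → x ≡ y [mod n ]
  ≈-reflexive {x} ≡.refl = by (≡.sym (ℤ.+-inverseʳ x)) (ℤ.divides 0ℤ (≡.sym (ℤ.*-zeroˡ (+ n))))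

  neg-sub : ∀ x y → ℤ.- (x ℤ.- y) ≡ y ℤ.- x
  neg-sub = solve-∀

  telescope : ∀ x y z → (x ℤ.- y) ℤ.+ (y ℤ.- z) ≡ x ℤ.- z
  telescope = solve-∀

  add-sub : ∀ x y u w →
            (x ℤ.- y) ℤ.+ (u ℤ.- w) ≡ (x ℤ.+ u) ℤ.- (y ℤ.+ w)
  add-sub = solve-∀

  neg-cong : ∀ x y → ℤ.- (x ℤ.- y) ≡ (ℤ.- x) ℤ.- (ℤ.- y)
  neg-cong = solve-∀

-- The field with q elements: any commutative ring with q elements in which
-- 1 ≉ 0 and every nonzero element is invertible.
record FiniteField c ℓ (q : ℕ) : Set (lsuc (c ⊔ ℓ)) where
  field
    commutativeRing : CommutativeRing c ℓ

  open CommutativeRing commutativeRing public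

  field
    1≉0         : ¬ 1# ≈ 0#
    inverse     : ∀ x → ¬ x ≈ 0# → ∃ λ y → x * y ≈ 1#
    enumeration : Inverse setoid (≡.setoid (Fin q))

record FiniteSubset {c ℓ} (S : Setoid c ℓ) (k : ℕ) : Set (c ⊔ ℓ) where
  open Setoid S
  -- The listing order is auxiliary: every property stated below is
  -- invariant under permuting it.
  field
    element  : Vector Carrier k
    distinct : Injective _≡_ _≈_ element

half : ℕ → ℕ
half q = (q ℕ.∸ 1) ℕ./ 2

module _ {c ℓ} {q : ℕ} (F : FiniteField c ℓ q) where
  open FiniteField F hiding (zero)
  open Sum +-commutativeMonoid using (sum)

  NonzeroSquare : Carrier → Set (c ⊔ ℓ)
  NonzeroSquare x = ¬ x ≈ 0# × ∃ λ y → x ≈ y * y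

  Squares : AbelianGroup (c ⊔ ℓ) ℓ
  Squares = record
    { Carrier = Σ Carrier NonzeroSquare
    ; _≈_ = λ x y → proj₁ x ≈ proj₁ y
    ; _∙_ = λ (x , x≉0 , s , x≈ss) (y , y≉0 , t , y≈tt) →
        x * y , *-nonzero x≉0 y≉0 , s * t
        , trans (*-cong x≈ss y≈tt) (interchange s s t t)
    ; ε = 1# , 1≉0 , 1# , sym (*-identityˡ 1#)
    ; _⁻¹ = inv
    ; isAbelianGroup = record
      { isGroup = record
        { isMonoid = record
          { isSemigroup = record
            { isMagma = record
              { isEquivalence = record { refl = refl ; sym = sym ; trans = trans }
              ; ∙-cong = *-cong
              }
            ; assoc = λ (x , _) (y , _) (z , _) → *-assoc x y z
            }
          ; identity = (λ (x , _) → *-identityˡ x)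
                     , (λ (x , _) → *-identityʳ x)
          }
        ; inverse = (λ (x , x≉0 , _) →
                       trans (*-comm _ x) (proj₂ (inverse x x≉0)))
                  , (λ (x , x≉0 , _) → proj₂ (inverse x x≉0))
        ; ⁻¹-cong = λ {(x , x≉0 , _)} {(y , y≉0 , _)} x≈y →
            inverse-unique (proj₂ (inverse x x≉0))
              (trans (*-congʳ x≈y) (proj₂ (inverse y y≉0)))
        }
      ; comm = λ (x , _) (y , _) → *-comm x y
      }
    }
    where
    open CommutativeSemigroupProperties *-commutativeSemigroup using (interchange)
    open import Relation.Binary.Reasoning.Setoid setoid

    *-nonzero : ∀ {x y} → ¬ x ≈ 0# → ¬ y ≈ 0# → ¬ x * y ≈ 0#
    *-nonzero {x} {y} x≉0 y≉0 xy≈0 = y≉0 (begin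
      y             ≈⟨ *-identityˡ y ⟨
      1# * y        ≈⟨ *-congʳ (proj₂ (inverse x x≉0)) ⟨
      (x * x⁻¹) * y ≈⟨ *-congʳ (*-comm x x⁻¹) ⟩
      (x⁻¹ * x) * y ≈⟨ *-assoc x⁻¹ x y ⟩
      x⁻¹ * (x * y) ≈⟨ *-congˡ xy≈0 ⟩
      x⁻¹ * 0#      ≈⟨ zeroʳ x⁻¹ ⟩
      0#            ∎)
      where x⁻¹ = proj₁ (inverse x x≉0)

    inverse-unique : ∀ {x y z} → x * y ≈ 1# → x * z ≈ 1# → y ≈ z
    inverse-unique {x} {y} {z} xy≈1 xz≈1 = begin
      y           ≈⟨ *-identityʳ y ⟨
      y * 1#      ≈⟨ *-congˡ xz≈1 ⟨
      y * (x * z) ≈⟨ *-assoc y x z ⟨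
      (y * x) * z ≈⟨ *-congʳ (*-comm y x) ⟩
      (x * y) * z ≈⟨ *-congʳ xy≈1 ⟩
      1# * z      ≈⟨ *-identityˡ z ⟩
      z           ∎

    inv : Σ Carrier NonzeroSquare → Σ Carrier NonzeroSquare
    inv (x , x≉0 , s , x≈ss) = x⁻¹ , x⁻¹≉0 , s * x⁻¹ , sym (begin
      (s * x⁻¹) * (s * x⁻¹) ≈⟨ interchange s x⁻¹ s x⁻¹ ⟩
      (s * s) * (x⁻¹ * x⁻¹) ≈⟨ *-congʳ x≈ss ⟨
      x * (x⁻¹ * x⁻¹)       ≈⟨ *-assoc x x⁻¹ x⁻¹ ⟨
      (x * x⁻¹) * x⁻¹       ≈⟨ *-congʳ (proj₂ (inverse x x≉0)) ⟩
      1# * x⁻¹              ≈⟨ *-identityˡ x⁻¹ ⟩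
      x⁻¹                   ∎)
      where
      x⁻¹ = proj₁ (inverse x x≉0)
      x⁻¹≉0 : ¬ x⁻¹ ≈ 0#
      x⁻¹≉0 x⁻¹≈0 = 1≉0 (begin
        1#      ≈⟨ proj₂ (inverse x x≉0) ⟨
        x * x⁻¹ ≈⟨ *-congˡ x⁻¹≈0 ⟩
        x * 0#  ≈⟨ zeroʳ x ⟩
        0#      ∎)

  SquareSubset : ℕ → Set (c ⊔ ℓ)
  SquareSubset = FiniteSubset (AbelianGroup.setoid Squares)

  entry : ∀ {k} → SquareSubset k → Vector Carrier k
  entry B a = proj₁ (FiniteSubset.element B a)

  LogIsomorphism : (AbelianGroup.Carrier Squares → ℤ) → Set (c ⊔ ℓ)
  LogIsomorphism φ = IsGroupIsomorphism φ
    where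
    open GroupMorphisms (AbelianGroup.rawGroup Squares)
                        (AbelianGroup.rawGroup (ℤ/ (half q)))

  record IsHeffterDifferencePacking
    (φ : AbelianGroup.Carrier Squares → ℤ) {k n : ℕ}
    (B : Fin n → SquareSubset k) : Set ℓ where

    log : Fin n → Fin k → ℤ
    log i a = φ (FiniteSubset.element (B i) a)

    field
      -- The multiset of differences is indexed by triples (i , a , b) with
      -- a ≢ b; it is repetition-free when distinct triples give distinct
      -- differences.
      differences-distinct :
        ∀ {i j a b a′ b′} → a ≢ b → a′ ≢ b′ →
        log i a ℤ.- log i b ≡ log j a′ ℤ.- log j b′ [mod half q ] →
        i ≡ j × a ≡ a′ × b ≡ b′
      k∣half          : k ℕ.∣ half q
      distinct-mod-k  : ∀ i → Injective _≡_ (λ x y → x ≡ y [mod k ]) (log i)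
      zero-sum        : ∀ i → sum (entry (B i)) ≈ 0#

  -- partialSum b j = b₀ + ⋯ + bⱼ, including the j-th term.
  partialSum : ∀ {k} → Vector Carrier k → Fin k → Carrier
  partialSum b zero    = b zero
  partialSum b (suc j) = b zero + partialSum (tail b) j

  HasSimpleOrdering : ∀ {k} → SquareSubset k → Set ℓ
  HasSimpleOrdering {k} B = ∃ λ (π : Permutation′ k) →
    Injective _≡_ _≈_ (partialSum (entry B ∘ (π ⟨$⟩ʳ_)))

{-# OPTIONS --safe #-}
module Submission where

-- Taking logarithms, a block is a vector of integers modulo v = k w.  Blocks
-- are added one at a time, with the a-th entry in the class of a modulo k.
-- All entries of a new block but the first three are chosen greedily; the
-- first three, x, y and z, range over cosets of the subgroup of order w,
-- subject to x + y + z = − s with s the sum of the others.  A second moment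
-- computation (incidences between points and lines of the affine plane
-- over F) shows that, for some choice of representatives, there are more
-- than B w such triples, where B = (k − 2) (3 n k + 2).  On the other hand a
-- triple is unusable only if one of B events occurs, and each event holds
-- for at most w triples: together with one of the entries (or, for three
-- entries in geometric progression, their ratio) it determines the triple.
-- The block is kept in its given order: as its sum is 0, distinct partial
-- sums amount to distinct sums of proper suffixes.

-- One slope accounts for only w of the q² lines, and a large deviation on these alone is compatible
-- with the total variance. But multiplying the slope by an element of the subgroup of order w
-- merely relabels z inside its coset, so w slopes ask for the same triples, and if there were at
-- most B w of them then w² lines would be poor at once. With l = w² - q B this forces l² ≤ q² (q -
-- w). In units of w⁴ the left side is at least 2401/4096 and the right side at most 2400/4096. The
-- events must also stay below the main term: w³ / q is about w² / (2 k), so w has to exceed about 2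
-- k B, while q > 8 k⁵ n gives w ≥ 4 k⁴ n. With all positions of a coincidence a - b = a′ - b′ as
-- indices, B would be of order 3 k³ n and w ≥ 6 k⁴ n would be wanted. But the classes modulo k of
-- three of the entries determine that of the fourth, and a block meets each class only once, so b′
-- is not an index and B is of order 3 k² n.

open import Defs
open import Algebra.Bundles using (AbelianGroup)
open import Algebra.Morphism.Structures using (module GroupMorphisms)
import Algebra.Properties.AbelianGroup as AbelianGroupProperties
import Algebra.Properties.CommutativeMonoid.Sum as Sum
import Algebra.Properties.CommutativeSemigroup as CommutativeSemigroupProperties
import Algebra.Properties.Ring as RingProperties
import Algebra.Solver.Ring.NaturalCoefficients.Default as SemiringSolver
open import Data.Fin.Base as Fin using (Fin; zero; suc; toℕ; fromℕ<; _↑ˡ_; _↑ʳ_; combine)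
import Data.Fin.Permutation as Permutation
import Data.Fin.Properties as Fin
open import Data.Integer.Base as ℤ using (ℤ; +_; 0ℤ; 1ℤ; -1ℤ)
import Data.Integer.DivMod as ℤ
import Data.Integer.Divisibility.Signed as ℤ
import Data.Integer.Properties as ℤ
open import Data.Integer.Tactic.RingSolver using (solve-∀)
open import Data.List.Base using (List; []; _∷_; _++_; map; length; cartesianProduct; allFin)
open import Data.List.Membership.Propositional using (_∈_)
open import Data.List.Membership.Propositional.Properties using (∈-allFin)
open import Data.List.Properties using (length-tabulate)
open import Data.List.Relation.Unary.All as All using ()
open import Data.List.Relation.Unary.AllPairs using (_∷_)
open import Data.List.Relation.Unary.Any using (here; there)
open import Data.List.Relation.Unary.Unique.Propositional using (Unique)
import Data.List.Relation.Unary.Unique.Propositional.Properties as Unique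
open import Data.Nat.Base as ℕ using (ℕ; zero; suc)
import Data.Nat.Divisibility as ℕ
import Data.Nat.DivMod as ℕ
import Data.Nat.Properties as ℕ
import Data.Nat.Tactic.RingSolver as ℕ
open import Data.Product.Base using (Σ; ∃; _×_; _,_; proj₁; proj₂)
open import Data.Product.Function.NonDependent.Propositional using (_×-↔_)
open import Data.Sum.Base using (_⊎_; inj₁; inj₂)
open import Data.Sum.Function.Propositional using (_⊎-↔_)
open import Function.Base using (_∘_; id)
open import Function.Bundles using (Inverse; _↔_)
open import Function.Construct.Composition using (_↔-∘_)
open import Function.Construct.Identity using (↔-id)
open import Function.Definitions using (Injective)
open import Level using (Lift; lift; lower; _⊔_)
open import Relation.Binary.PropositionalEquality as ≡ using (_≡_; _≢_)
import Relation.Binary.Reasoning.Setoid as SetoidReasoning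
open import Relation.Nullary.Decidable as Dec using (Dec; yes; no; ¬?; _×-dec_; decidable-stable)
open import Relation.Nullary.Negation using (¬_; contradiction)

-- Sums over lists and counting

module _ {A : Set} where

  ∑ : List A → (A → ℤ) → ℤ
  ∑ []       f = 0ℤ
  ∑ (x ∷ xs) f = f x ℤ.+ ∑ xs f

  ∑-cong : ∀ xs {f g : A → ℤ} → (∀ x → f x ≡ g x) → ∑ xs f ≡ ∑ xs g
  ∑-cong []       f≡g = ≡.refl
  ∑-cong (x ∷ xs) f≡g = ≡.cong₂ ℤ._+_ (f≡g x) (∑-cong xs f≡g)

  ∑-mono : ∀ xs {f g : A → ℤ} → (∀ x → f x ℤ.≤ g x) → ∑ xs f ℤ.≤ ∑ xs g
  ∑-mono []       f≤g = ℤ.≤-refl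
  ∑-mono (x ∷ xs) f≤g = ℤ.+-mono-≤ (f≤g x) (∑-mono xs f≤g)

  ∑-distrib-+ : ∀ xs (f g : A → ℤ) → ∑ xs (λ x → f x ℤ.+ g x) ≡ ∑ xs f ℤ.+ ∑ xs g
  ∑-distrib-+ []       f g = ≡.refl
  ∑-distrib-+ (x ∷ xs) f g =
    ≡.trans (≡.cong (ℤ._+_ (f x ℤ.+ g x)) (∑-distrib-+ xs f g)) (interchange (f x) (g x) (∑ xs f) (∑ xs g))
    where
    interchange : ∀ a b c d → (a ℤ.+ b) ℤ.+ (c ℤ.+ d) ≡ (a ℤ.+ c) ℤ.+ (b ℤ.+ d)
    interchange = solve-∀

  *-distribˡ-∑ : ∀ c xs (f : A → ℤ) → ∑ xs (λ x → c ℤ.* f x) ≡ c ℤ.* ∑ xs f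
  *-distribˡ-∑ c []       f = ≡.sym (ℤ.*-zeroʳ c)
  *-distribˡ-∑ c (x ∷ xs) f =
    ≡.trans (≡.cong (ℤ._+_ (c ℤ.* f x)) (*-distribˡ-∑ c xs f)) (≡.sym (ℤ.*-distribˡ-+ c _ _))

  *-distribʳ-∑ : ∀ c xs (f : A → ℤ) → ∑ xs (λ x → f x ℤ.* c) ≡ ∑ xs f ℤ.* c
  *-distribʳ-∑ c xs f = ≡.trans (∑-cong xs (λ x → ℤ.*-comm (f x) c))
    (≡.trans (*-distribˡ-∑ c xs f) (ℤ.*-comm c _))

  ∑-const : ∀ xs c → ∑ xs (λ _ → c) ≡ + length xs ℤ.* c
  ∑-const []       c = ≡.sym (ℤ.*-zeroˡ c)
  ∑-const (x ∷ xs) c = ≡.trans (≡.cong (ℤ._+_ c) (∑-const xs c)) (≡.sym (ℤ.suc-* (+ length xs) c))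

  ∑-nonneg : ∀ xs {f : A → ℤ} → (∀ x → 0ℤ ℤ.≤ f x) → 0ℤ ℤ.≤ ∑ xs f
  ∑-nonneg []       0≤f = ℤ.≤-refl
  ∑-nonneg (x ∷ xs) 0≤f = ℤ.+-mono-≤ (0≤f x) (∑-nonneg xs 0≤f)

  term≤∑ : ∀ {xs x} {f : A → ℤ} → (∀ x → 0ℤ ℤ.≤ f x) → x ∈ xs → f x ℤ.≤ ∑ xs f
  term≤∑ {y ∷ xs} {x} {f} 0≤f (here ≡.refl) = ≡.subst (ℤ._≤ (f x ℤ.+ ∑ xs f)) (ℤ.+-identityʳ (f x))
    (ℤ.+-monoʳ-≤ (f x) (∑-nonneg xs 0≤f))
  term≤∑ {y ∷ xs} {x} {f} 0≤f (there x∈xs) = ≡.subst (ℤ._≤ (f y ℤ.+ ∑ xs f)) (ℤ.+-identityˡ (f x))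
    (ℤ.+-mono-≤ (0≤f y) (term≤∑ 0≤f x∈xs))

∑-comm : ∀ {A B : Set} (xs : List A) (ys : List B) (f : A → B → ℤ) →
         ∑ xs (λ x → ∑ ys (f x)) ≡ ∑ ys (λ y → ∑ xs (λ x → f x y))
∑-comm []       ys f = ≡.sym (≡.trans (∑-const ys 0ℤ) (ℤ.*-zeroʳ (+ length ys)))
∑-comm (x ∷ xs) ys f =
  ≡.trans (≡.cong (ℤ._+_ (∑ ys (f x))) (∑-comm xs ys f)) (≡.sym (∑-distrib-+ ys (f x) _))

∑-++ : ∀ {A : Set} (xs ys : List A) f → ∑ (xs ++ ys) f ≡ ∑ xs f ℤ.+ ∑ ys f
∑-++ []       ys f = ≡.sym (ℤ.+-identityˡ _)
∑-++ (x ∷ xs) ys f = ≡.trans (≡.cong (ℤ._+_ (f x)) (∑-++ xs ys f)) (≡.sym (ℤ.+-assoc (f x) _ _))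

∑-map : ∀ {A B : Set} (g : A → B) xs f → ∑ (map g xs) f ≡ ∑ xs (f ∘ g)
∑-map g []       f = ≡.refl
∑-map g (x ∷ xs) f = ≡.cong (ℤ._+_ (f (g x))) (∑-map g xs f)

∑-cartesianProduct : ∀ {A B : Set} (xs : List A) (ys : List B) f →
                     ∑ (cartesianProduct xs ys) f ≡ ∑ xs (λ x → ∑ ys (λ y → f (x , y)))
∑-cartesianProduct []       ys f = ≡.refl
∑-cartesianProduct (x ∷ xs) ys f = ≡.trans (∑-++ (map (x ,_) ys) _ f)
  (≡.cong₂ ℤ._+_ (∑-map (x ,_) ys f) (∑-cartesianProduct xs ys f))

𝟙 : ∀ {p} {P : Set p} → Dec P → ℤ
𝟙 (yes _) = 1ℤ
𝟙 (no  _) = 0ℤ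

𝟙-yes : ∀ {p} {P : Set p} (P? : Dec P) → P → 𝟙 P? ≡ 1ℤ
𝟙-yes (yes _) p = ≡.refl
𝟙-yes (no ¬p) p = contradiction p ¬p

𝟙-no : ∀ {p} {P : Set p} (P? : Dec P) → ¬ P → 𝟙 P? ≡ 0ℤ
𝟙-no (yes p) ¬p = contradiction p ¬p
𝟙-no (no  _) ¬p = ≡.refl

𝟙-nonneg : ∀ {p} {P : Set p} (P? : Dec P) → 0ℤ ℤ.≤ 𝟙 P?
𝟙-nonneg (yes _) = ℤ.+≤+ ℕ.z≤n
𝟙-nonneg (no  _) = ℤ.≤-refl

𝟙-mono : ∀ {p r} {P : Set p} {R : Set r} (P? : Dec P) (R? : Dec R) → (P → R) → 𝟙 P? ℤ.≤ 𝟙 R?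
𝟙-mono (yes p) R? f = ℤ.≤-reflexive (≡.sym (𝟙-yes R? (f p)))
𝟙-mono (no  _) R? f = 𝟙-nonneg R?

-- The label `h` may depend on the proof of `P x`, because the label of a triple is read off from
-- the event found for it; hence injectivity is asked across all proofs. In the induction the label
-- of the head is punched out of the labels of the tail.
count-injection : ∀ {A : Set} {p} {P : A → Set p} (P? : ∀ x → Dec (P x)) K {xs} → Unique xs →
                  (h : ∀ {x} → x ∈ xs → P x → Fin K) →
                  (∀ {x y} (i : x ∈ xs) (j : y ∈ xs) (p : P x) (r : P y) → h i p ≡ h j r → x ≡ y) →
                  ∑ xs (λ x → 𝟙 (P? x)) ℤ.≤ + K
count-injection P? K {[]} _ h inj = ℤ.+≤+ ℕ.z≤n
count-injection P? K {x ∷ xs} (x∉xs ∷ xs!) h inj with P? x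
... | no  _ = ≡.subst (ℤ._≤ + K) (≡.sym (ℤ.+-identityˡ _))
  (count-injection P? K xs! (h ∘ there) (λ i j → inj (there i) (there j)))
count-injection P? zero    {x ∷ xs} _ h inj | yes p with () ← h (here ≡.refl) p
count-injection P? (suc K) {x ∷ xs} (x∉xs ∷ xs!) h inj | yes p = ℤ.+-monoʳ-≤ 1ℤ
  (count-injection P? K xs! (λ i r → Fin.punchOut (h≢ i r))
    (λ i j r s e → inj (there i) (there j) r s (Fin.punchOut-injective (h≢ i r) (h≢ j s) e)))
  where
  h≢ : ∀ {y} (i : y ∈ xs) r → h (here ≡.refl) p ≢ h (there i) r
  h≢ i r e = All.lookup x∉xs i (inj (here ≡.refl) (there i) p r e)

∑-𝟙-≡ : ∀ {A : Set} (_≟_ : (x y : A) → Dec (x ≡ y)) {xs y} → Unique xs → y ∈ xs →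
        ∑ xs (λ x → 𝟙 (x ≟ y)) ≡ 1ℤ
∑-𝟙-≡ _≟_ {xs} {y} xs! y∈xs = ℤ.≤-antisym
  (count-injection (_≟ y) 1 xs! (λ _ _ → zero) (λ { _ _ ≡.refl ≡.refl _ → ≡.refl }))
  (≡.subst (ℤ._≤ ∑ xs (λ x → 𝟙 (x ≟ y))) (𝟙-yes (y ≟ y) ≡.refl)
    (term≤∑ {f = λ x → 𝟙 (x ≟ y)} (λ x → 𝟙-nonneg (x ≟ y)) y∈xs))

-- Each `f (g x)` is spread over `ys` as the sum of `f y` times the indicator of `g x ≡ y`. After
-- exchanging the sums, `f y` is weighted by the size of its fibre, which is at most 1.
∑-injection : ∀ {A B : Set} (_≟_ : (x y : B) → Dec (x ≡ y)) {xs : List A} {ys : List B} →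
              Unique xs → (g : A → B) → (∀ {x y} → g x ≡ g y → x ≡ y) → (∀ y → y ∈ ys) → Unique ys →
              ∀ {f} → (∀ y → 0ℤ ℤ.≤ f y) → ∑ xs (f ∘ g) ℤ.≤ ∑ ys f
∑-injection _≟_ {xs} {ys} xs! g inj ∈ys ys! {f} 0≤f = begin
  ∑ xs (f ∘ g)                                         ≡⟨ ∑-cong xs (λ x → spread (g x)) ⟩
  ∑ xs (λ x → ∑ ys (λ y → f y ℤ.* 𝟙 (g x ≟ y)))        ≡⟨ ∑-comm xs ys _ ⟩
  ∑ ys (λ y → ∑ xs (λ x → f y ℤ.* 𝟙 (g x ≟ y)))        ≡⟨ ∑-cong ys (λ y → *-distribˡ-∑ (f y) xs _) ⟩
  ∑ ys (λ y → f y ℤ.* ∑ xs (λ x → 𝟙 (g x ≟ y)))        ≤⟨ ∑-mono ys (λ y → ≤-scale y (fibre y)) ⟩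
  ∑ ys (λ y → f y)                                     ∎
  where
  open ℤ.≤-Reasoning
  fibre : ∀ y → ∑ xs (λ x → 𝟙 (g x ≟ y)) ℤ.≤ 1ℤ
  fibre y = count-injection (λ x → g x ≟ y) 1 xs! (λ _ _ → zero)
    (λ _ _ p r _ → inj (≡.trans p (≡.sym r)))
  ≤-scale : ∀ y {c} → c ℤ.≤ 1ℤ → f y ℤ.* c ℤ.≤ f y
  ≤-scale y {c} c≤1 = ≡.subst (f y ℤ.* c ℤ.≤_) (ℤ.*-identityʳ (f y))
    (ℤ.*-monoˡ-≤-nonNeg (f y) {{ℤ.nonNegative (0≤f y)}} c≤1)
  spread : ∀ z → f z ≡ ∑ ys (λ y → f y ℤ.* 𝟙 (z ≟ y))
  spread z = ≡.sym (≡-begin)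
    where
    point : ∀ y → f y ℤ.* 𝟙 (z ≟ y) ≡ f z ℤ.* 𝟙 (y ≟ z)
    point y with z ≟ y | y ≟ z
    ... | yes ≡.refl | yes _  = ≡.refl
    ... | yes ≡.refl | no z≢z = contradiction ≡.refl z≢z
    ... | no z≢z | yes ≡.refl = contradiction ≡.refl z≢z
    ... | no _ | no _ = ≡.trans (ℤ.*-zeroʳ (f y)) (≡.sym (ℤ.*-zeroʳ (f z)))
    ≡-begin : ∑ ys (λ y → f y ℤ.* 𝟙 (z ≟ y)) ≡ f z
    ≡-begin = ≡.trans (∑-cong ys point) (≡.trans (*-distribˡ-∑ (f z) ys _)
      (≡.trans (≡.cong (f z ℤ.*_) (∑-𝟙-≡ _≟_ ys! (∈ys z))) (ℤ.*-identityʳ (f z))))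

-- The numerical inequality behind the bound 8 k⁵ n < q

module _ where
  open import Data.Nat.Base using (_+_; _*_; _≤_; _<_)

  +slack : ∀ {a b} c → b ≡ a + c → a ≤ b
  +slack {a} c ≡.refl = ℕ.m≤m+n a c

  -- The constant 7/16 is exact at k = 4, n = 1. Expanded at k = 3 + m the difference for n = 1 is
  -- 13 - 35 m + 15 m² + 7 m³, which is no polynomial over ℕ; so k = 3 and k = 4 are split off, and
  -- the expansion at k = 5 + m has natural coefficients.
  events-bound : ∀ m n′ {k n j} → k ≡ 3 + m → n ≡ 1 + n′ → j ≡ 1 + m →
                 16 * (j * (3 * (n * k) + 2)) ≤ 7 * (k * k * k) * n
  events-bound m n′ k≡ n≡ j≡ = +slack (excess m) (cases m k≡ n≡ j≡)
    where
    excess : ℕ → ℕ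
    excess zero          = 13 + 45 * n′
    excess (suc zero)    = 64 * n′
    excess (suc (suc m)) = (59 + 109 * m + 57 * (m * m) + 7 * (m * m * m)) + n′ * (155 + 141 * m + 57 * (m * m) + 7 * (m * m * m))
    subst-eq : ∀ {k n j k₀ n₀ j₀ e} → k ≡ k₀ → n ≡ n₀ → j ≡ j₀ →
      7 * (k₀ * k₀ * k₀) * n₀ ≡ 16 * (j₀ * (3 * (n₀ * k₀) + 2)) + e →
      7 * (k * k * k) * n ≡ 16 * (j * (3 * (n * k) + 2)) + e
    subst-eq ≡.refl ≡.refl ≡.refl e = e
    eq₀ : ∀ n → 7 * (3 * 3 * 3) * (1 + n) ≡ 16 * (1 * (3 * ((1 + n) * 3) + 2)) + (13 + 45 * n)
    eq₀ = ℕ.solve-∀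
    eq₁ : ∀ n → 7 * (4 * 4 * 4) * (1 + n) ≡ 16 * (2 * (3 * ((1 + n) * 4) + 2)) + 64 * n
    eq₁ = ℕ.solve-∀
    eq₂ : ∀ m n → 7 * ((5 + m) * (5 + m) * (5 + m)) * (1 + n)
      ≡ 16 * ((3 + m) * (3 * ((1 + n) * (5 + m)) + 2))
        + ((59 + 109 * m + 57 * (m * m) + 7 * (m * m * m)) + n * (155 + 141 * m + 57 * (m * m) + 7 * (m * m * m)))
    eq₂ = ℕ.solve-∀
    cases : ∀ m {k n j} → k ≡ 3 + m → n ≡ 1 + n′ → j ≡ 1 + m →
            7 * (k * k * k) * n ≡ 16 * (j * (3 * (n * k) + 2)) + excess m
    cases zero          k≡ n≡ j≡ = subst-eq {k₀ = 3} {n₀ = 1 + n′} {j₀ = 1} k≡ n≡ j≡ (eq₀ n′)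
    cases (suc zero)    k≡ n≡ j≡ = subst-eq {k₀ = 4} {n₀ = 1 + n′} {j₀ = 2} k≡ n≡ j≡ (eq₁ n′)
    cases (suc (suc m)) k≡ n≡ j≡ = subst-eq {k₀ = 5 + m} {n₀ = 1 + n′} {j₀ = 3 + m} k≡ n≡ j≡ (eq₂ m n′)

  -- With k = 3 + m and r = 2 k − 1.
  module Quartic (m : ℕ) {k r : ℕ} (k≡ : k ≡ 3 + m) (r≡ : r ≡ 5 + 2 * m) where

    2+4k²≤4k⁴ : 2 + 4 * (k * k) ≤ 4 * (k * k * k * k)
    2+4k²≤4k⁴ = +slack _ (subst-eq k≡ (eq m))
      where
      subst-eq : ∀ {k k₀ e} → k ≡ k₀ → 4 * (k₀ * k₀ * k₀ * k₀) ≡ (2 + 4 * (k₀ * k₀)) + e →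
                 4 * (k * k * k * k) ≡ (2 + 4 * (k * k)) + e
      subst-eq ≡.refl e = e
      eq : ∀ m → 4 * ((3 + m) * (3 + m) * (3 + m) * (3 + m)) ≡ (2 + 4 * ((3 + m) * (3 + m))) +
        (286 + m * (408 + 212 * m + 48 * (m * m) + 4 * (m * m * m)))
      eq = ℕ.solve-∀

    1+4k≤2+4k² : 1 + 4 * k ≤ 2 + 4 * (k * k)
    1+4k≤2+4k² = +slack _ (subst-eq k≡ (eq m))
      where
      subst-eq : ∀ {k k₀ e} → k ≡ k₀ → 2 + 4 * (k₀ * k₀) ≡ (1 + 4 * k₀) + e →
                 2 + 4 * (k * k) ≡ (1 + 4 * k) + e
      subst-eq ≡.refl e = e
      eq : ∀ m → 2 + 4 * ((3 + m) * (3 + m)) ≡ (1 + 4 * (3 + m)) + (25 + 20 * m + 4 * (m * m))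
      eq = ℕ.solve-∀

    -- At k = 3 the sides are 5952 and 6075. The factor 75 turns into 600 in `cubic` and into 4 ·
    -- 600 = 2400 in the last comparison, just below 49² = 2401.
    32[4k²+1]r+32≤75k⁴ : 32 * ((1 + 4 * (k * k)) * r) + 32 ≤ 75 * (k * k * k * k)
    32[4k²+1]r+32≤75k⁴ = +slack _ (subst-eq k≡ r≡ (eq m))
      where
      subst-eq : ∀ {k k₀ r r₀ e} → k ≡ k₀ → r ≡ r₀ →
                 75 * (k₀ * k₀ * k₀ * k₀) ≡ (32 * ((1 + 4 * (k₀ * k₀)) * r₀) + 32) + e →
                 75 * (k * k * k * k) ≡ (32 * ((1 + 4 * (k * k)) * r) + 32) + e
      subst-eq ≡.refl ≡.refl e = e
      eq : ∀ m → 75 * ((3 + m) * (3 + m) * (3 + m) * (3 + m)) ≡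
        (32 * ((1 + 4 * ((3 + m) * (3 + m))) * (5 + 2 * m)) + 32)
        + (123 + 1892 * m + 1874 * (m * m) + 644 * (m * m * m) + 75 * (m * m * m * m))
      eq = ℕ.solve-∀

  -- In units of w², q B is at most 7/32 up to a term linear in w, so that the gap w² - q B is at
  -- least 49/64. In units of w⁴, q² (q - w) is at most 600/1024.
  module Discrepancy (m : ℕ) {k r n B w q : ℕ} (k≡ : k ≡ 3 + m) (r≡ : r ≡ 5 + 2 * m)
    (1≤n : 1 ≤ n) (16B≤7k³n : 16 * B ≤ 7 * (k * k * k) * n)
    (4k⁴n≤w : 4 * (k * k * k * k) * n ≤ w) (q≡ : q ≡ 1 + 2 * (k * w)) where

    open Quartic m k≡ r≡
    open ℕ.≤-Reasoning

    3≤k : 3 ≤ k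
    3≤k = +slack m k≡

    64kB≤7w : 64 * (k * B) ≤ 7 * w
    64kB≤7w = begin
      64 * (k * B)                 ≡⟨ eq₁ k B ⟩
      4 * k * (16 * B)             ≤⟨ ℕ.*-monoʳ-≤ (4 * k) 16B≤7k³n ⟩
      4 * k * (7 * (k * k * k) * n)  ≡⟨ eq₂ k n ⟩
      7 * (4 * (k * k * k * k) * n)  ≤⟨ ℕ.*-monoʳ-≤ 7 4k⁴n≤w ⟩
      7 * w                        ∎
      where
      eq₁ : ∀ k B → 64 * (k * B) ≡ 4 * k * (16 * B)
      eq₁ = ℕ.solve-∀
      eq₂ : ∀ k n → 4 * k * (7 * (k * k * k) * n) ≡ 7 * (4 * (k * k * k * k) * n)
      eq₂ = ℕ.solve-∀

    32B≤2w : 32 * B ≤ 2 * w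
    32B≤2w = ℕ.*-cancelˡ-≤ 6 (begin
      6 * (32 * B)  ≡⟨ eq₁ B ⟩
      64 * (3 * B)  ≤⟨ ℕ.*-monoʳ-≤ 64 (ℕ.*-monoˡ-≤ B 3≤k) ⟩
      64 * (k * B)  ≤⟨ 64kB≤7w ⟩
      7 * w         ≤⟨ ℕ.*-monoˡ-≤ w (ℕ.m≤m+n 7 5) ⟩
      12 * w        ≡⟨ eq₂ w ⟩
      6 * (2 * w)   ∎)
      where
      eq₁ : ∀ B → 6 * (32 * B) ≡ 64 * (3 * B)
      eq₁ = ℕ.solve-∀
      eq₂ : ∀ w → 12 * w ≡ 6 * (2 * w)
      eq₂ = ℕ.solve-∀

    32qB≤7w²+2w : 32 * (q * B) ≤ 7 * (w * w) + 2 * w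
    32qB≤7w²+2w = begin
      32 * (q * B)                  ≡⟨ ≡.cong (λ q → 32 * (q * B)) q≡ ⟩
      32 * ((1 + 2 * (k * w)) * B)  ≡⟨ eq₁ k w B ⟩
      w * (64 * (k * B)) + 32 * B   ≤⟨ ℕ.+-mono-≤ (ℕ.*-monoʳ-≤ w 64kB≤7w) 32B≤2w ⟩
      w * (7 * w) + 2 * w           ≡⟨ eq₂ w ⟩
      7 * (w * w) + 2 * w           ∎
      where
      eq₁ : ∀ k w B → 32 * ((1 + 2 * (k * w)) * B) ≡ w * (64 * (k * B)) + 32 * B
      eq₁ = ℕ.solve-∀
      eq₂ : ∀ w → w * (7 * w) + 2 * w ≡ 7 * (w * w) + 2 * w
      eq₂ = ℕ.solve-∀

    4k⁴≤w : 4 * (k * k * k * k) ≤ w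
    4k⁴≤w = ℕ.≤-trans (ℕ.m≤m*n (4 * (k * k * k * k)) n {{ℕ.>-nonZero 1≤n}}) 4k⁴n≤w

    4k²+2≤w : 2 + 4 * (k * k) ≤ w
    4k²+2≤w = ℕ.≤-trans 2+4k²≤4k⁴ 4k⁴≤w

    4k+1≤w : 1 + 4 * k ≤ w
    4k+1≤w = ℕ.≤-trans 1+4k≤2+4k² 4k²+2≤w

    q²≤ : q * q ≤ (1 + 4 * (k * k)) * (w * w)
    q²≤ = begin
      q * q                                 ≡⟨ ≡.cong₂ _*_ q≡ q≡ ⟩
      (1 + 2 * (k * w)) * (1 + 2 * (k * w)) ≡⟨ eq₁ k w ⟩
      4 * (k * k) * (w * w) + (4 * k * w + 1) ≤⟨ ℕ.+-monoʳ-≤ (4 * (k * k) * (w * w)) (begin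
        4 * k * w + 1                       ≤⟨ ℕ.+-monoʳ-≤ (4 * k * w) 1≤w ⟩
        4 * k * w + w                       ≡⟨ eq₂ k w ⟩
        (1 + 4 * k) * w                     ≤⟨ ℕ.*-monoˡ-≤ w 4k+1≤w ⟩
        w * w                               ∎) ⟩
      4 * (k * k) * (w * w) + w * w         ≡⟨ eq₃ k w ⟩
      (1 + 4 * (k * k)) * (w * w)           ∎
      where
      1≤w : 1 ≤ w
      1≤w = ℕ.≤-trans (ℕ.m≤m+n 1 (4 * k)) 4k+1≤w
      eq₁ : ∀ k w → (1 + 2 * (k * w)) * (1 + 2 * (k * w)) ≡ 4 * (k * k) * (w * w) + (4 * k * w + 1)
      eq₁ = ℕ.solve-∀
      eq₂ : ∀ k w → 4 * k * w + w ≡ (1 + 4 * k) * w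
      eq₂ = ℕ.solve-∀
      eq₃ : ∀ k w → 4 * (k * k) * (w * w) + w * w ≡ (1 + 4 * (k * k)) * (w * w)
      eq₃ = ℕ.solve-∀

    linear : 32 * ((1 + 4 * (k * k)) * (r * w + 1)) ≤ 75 * (k * k * k * k) * w
    linear = begin
      32 * (c * (r * w + 1))      ≡⟨ eq₁ c r w ⟩
      32 * (c * r) * w + 32 * c   ≤⟨ ℕ.+-monoʳ-≤ (32 * (c * r) * w) (ℕ.*-monoʳ-≤ 32 (ℕ.≤-trans (ℕ.n≤1+n c) 4k²+2≤w)) ⟩
      32 * (c * r) * w + 32 * w   ≡⟨ ℕ.*-distribʳ-+ w (32 * (c * r)) 32 ⟨
      (32 * (c * r) + 32) * w     ≤⟨ ℕ.*-monoˡ-≤ w 32[4k²+1]r+32≤75k⁴ ⟩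
      75 * (k * k * k * k) * w    ∎
      where
      c = 1 + 4 * (k * k)
      eq₁ : ∀ a b w → 32 * (a * (b * w + 1)) ≡ 32 * (a * b) * w + 32 * a
      eq₁ = ℕ.solve-∀

    -- Here q − w = r w + 1.
    cubic : 1024 * (q * q * (r * w + 1)) ≤ 600 * (w * w * (w * w))
    cubic = begin
      1024 * (q * q * p)                   ≤⟨ ℕ.*-monoʳ-≤ 1024 (ℕ.*-monoˡ-≤ p q²≤) ⟩
      1024 * (c * (w * w) * p)             ≡⟨ eq₁ c (w * w) p ⟩
      32 * (w * w) * (32 * (c * p))        ≤⟨ ℕ.*-monoʳ-≤ (32 * (w * w)) linear ⟩
      32 * (w * w) * (75 * k⁴ * w)         ≡⟨ eq₂ (w * w) k⁴ w ⟩
      600 * (w * w * (4 * k⁴ * w))         ≤⟨ ℕ.*-monoʳ-≤ 600 (ℕ.*-monoʳ-≤ (w * w) (ℕ.*-monoˡ-≤ w 4k⁴≤w)) ⟩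
      600 * (w * w * (w * w))              ∎
      where
      c = 1 + 4 * (k * k)
      p = r * w + 1
      k⁴ = k * k * k * k
      eq₁ : ∀ a s p → 1024 * (a * s * p) ≡ 32 * s * (32 * (a * p))
      eq₁ = ℕ.solve-∀
      eq₂ : ∀ s a w → 32 * s * (75 * a * w) ≡ 600 * (s * (4 * a * w))
      eq₂ = ℕ.solve-∀

    49w²+64qB≤64w² : 49 * (w * w) + 64 * (q * B) ≤ 64 * (w * w)
    49w²+64qB≤64w² = begin
      49 * (w * w) + 64 * (q * B)                 ≡⟨ eq₁ (w * w) (q * B) ⟩
      49 * (w * w) + 2 * (32 * (q * B))           ≤⟨ ℕ.+-monoʳ-≤ (49 * (w * w)) (ℕ.*-monoʳ-≤ 2 32qB≤7w²+2w) ⟩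
      49 * (w * w) + 2 * (7 * (w * w) + 2 * w)    ≡⟨ eq₂ w ⟩
      63 * (w * w) + 4 * w                        ≤⟨ ℕ.+-monoʳ-≤ (63 * (w * w)) (ℕ.*-monoˡ-≤ w 4≤w) ⟩
      63 * (w * w) + w * w                        ≡⟨ eq₃ w ⟩
      64 * (w * w)                                ∎
      where
      4≤w : 4 ≤ w
      4≤w = ℕ.≤-trans (ℕ.≤-trans (ℕ.*-monoʳ-≤ 4 (ℕ.≤-trans (ℕ.s≤s ℕ.z≤n) 3≤k)) (ℕ.n≤1+n (4 * k))) 4k+1≤w
      eq₁ : ∀ a b → 49 * a + 64 * b ≡ 49 * a + 2 * (32 * b)
      eq₁ = ℕ.solve-∀
      eq₂ : ∀ w → 49 * (w * w) + 2 * (7 * (w * w) + 2 * w) ≡ 63 * (w * w) + 4 * w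
      eq₂ = ℕ.solve-∀
      eq₃ : ∀ w → 63 * (w * w) + w * w ≡ 64 * (w * w)
      eq₃ = ℕ.solve-∀

    qB≤w² : q * B ≤ w * w
    qB≤w² = ℕ.*-cancelˡ-≤ 64 (ℕ.≤-trans (ℕ.m≤n+m (64 * (q * B)) (49 * (w * w))) 49w²+64qB≤64w²)

    q²[q-w]<gap² : ∀ {l} → w * w ≡ q * B + l → q * q * (r * w + 1) < l * l
    q²[q-w]<gap² {l} w²≡ = ℕ.*-cancelˡ-< 4096 (q * q * (r * w + 1)) (l * l) (begin-strict
      4096 * (q * q * (r * w + 1))         ≡⟨ eq₁ (q * q * (r * w + 1)) ⟩
      4 * (1024 * (q * q * (r * w + 1)))   ≤⟨ ℕ.*-monoʳ-≤ 4 cubic ⟩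
      -- The whole margin is this single copy of w⁴: 49² = 4 · 600 + 1.
      4 * (600 * (w * w * (w * w)))        <⟨ ℕ.m<m+n _ 0<w⁴ ⟩
      4 * (600 * (w * w * (w * w))) + w * w * (w * w) ≡⟨ eq₂ (w * w) ⟩
      (49 * (w * w)) * (49 * (w * w))      ≤⟨ ℕ.*-mono-≤ 49w²≤64l 49w²≤64l ⟩
      (64 * l) * (64 * l)                  ≡⟨ eq₃ l ⟩
      4096 * (l * l)                       ∎)
      where
      0<w : 0 < w
      0<w = ℕ.≤-trans (ℕ.m≤m+n 1 (4 * k)) 4k+1≤w
      0<w⁴ : 0 < w * w * (w * w)
      0<w⁴ = ℕ.*-mono-≤ (ℕ.*-mono-≤ 0<w 0<w) (ℕ.*-mono-≤ 0<w 0<w)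
      49w²≤64l : 49 * (w * w) ≤ 64 * l
      49w²≤64l = ℕ.+-cancelʳ-≤ (64 * (q * B)) (49 * (w * w)) (64 * l)
        (ℕ.≤-trans 49w²+64qB≤64w² (ℕ.≤-reflexive (≡.trans (≡.cong (64 *_) w²≡) (eq₄ (q * B) l))))
        where
        eq₄ : ∀ a l → 64 * (a + l) ≡ 64 * l + 64 * a
        eq₄ = ℕ.solve-∀
      eq₁ : ∀ x → 4096 * x ≡ 4 * (1024 * x)
      eq₁ = ℕ.solve-∀
      eq₂ : ∀ s → 4 * (600 * (s * s)) + s * s ≡ (49 * s) * (49 * s)
      eq₂ = ℕ.solve-∀
      eq₃ : ∀ l → (64 * l) * (64 * l) ≡ 4096 * (l * l)
      eq₃ = ℕ.solve-∀

-- Finite fields and incidences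

sq : ℤ → ℤ
sq x = x ℤ.* x

sq-nonneg : ∀ x → 0ℤ ℤ.≤ sq x
sq-nonneg (+ n)      = ≡.subst (0ℤ ℤ.≤_) (ℤ.pos-* n n) (ℤ.+≤+ ℕ.z≤n)
sq-nonneg ℤ.-[1+ n ] = ℤ.+≤+ ℕ.z≤n

∑-allFin-const : ∀ n c → ∑ (allFin n) (λ _ → c) ≡ + n ℤ.* c
∑-allFin-const n c = ≡.trans (∑-const (allFin n) c) (≡.cong (λ l → + l ℤ.* c) (length-tabulate {n = n} id))

module FieldProperties {c ℓ} {q : ℕ} (F : FiniteField c ℓ q) where
  open FiniteField F hiding (zero)
  open RingProperties ring using (+-cancelˡ; +-cancelʳ; -‿distribʳ-*) public
  open Inverse enumeration public using (to; from; to-cong; from-cong; strictlyInverseˡ; strictlyInverseʳ)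
  open SetoidReasoning setoid

  to-injective : ∀ {x y} → to x ≡ to y → x ≈ y
  to-injective {x} {y} e = trans (sym (strictlyInverseʳ x)) (trans (from-cong e) (strictlyInverseʳ y))

  infix 4 _≈?_
  _≈?_ : ∀ x y → Dec (x ≈ y)
  x ≈? y = Dec.map′ to-injective to-cong (to x Fin.≟ to y)

  *-cancelˡ : ∀ {a x y} → ¬ a ≈ 0# → a * x ≈ a * y → x ≈ y
  *-cancelˡ {a} {x} {y} a≉0 ax≈ay = begin
    x             ≈⟨ shift x ⟨
    a⁻¹ * (a * x) ≈⟨ *-congˡ ax≈ay ⟩
    a⁻¹ * (a * y) ≈⟨ shift y ⟩
    y             ∎
    where
    a⁻¹ = proj₁ (inverse a a≉0)
    shift : ∀ z → a⁻¹ * (a * z) ≈ z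
    shift z = begin
      a⁻¹ * (a * z) ≈⟨ *-assoc a⁻¹ a z ⟨
      (a⁻¹ * a) * z ≈⟨ *-congʳ (trans (*-comm a⁻¹ a) (proj₂ (inverse a a≉0))) ⟩
      1# * z        ≈⟨ *-identityˡ z ⟩
      z             ∎

  *-cancelʳ : ∀ {a x y} → ¬ a ≈ 0# → x * a ≈ y * a → x ≈ y
  *-cancelʳ a≉0 e = *-cancelˡ a≉0 (trans (*-comm _ _) (trans e (*-comm _ _)))

  x-y≈0⇒x≈y : ∀ {x y} → x - y ≈ 0# → x ≈ y
  x-y≈0⇒x≈y {x} {y} e = begin
    x             ≈⟨ +-identityʳ x ⟨
    x + 0#        ≈⟨ +-congˡ (-‿inverseˡ y) ⟨
    x + (- y + y) ≈⟨ +-assoc x (- y) y ⟨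
    x - y + y     ≈⟨ +-congʳ e ⟩
    0# + y        ≈⟨ +-identityˡ y ⟩
    y             ∎

  -- From x a + y b = x b + y a, that is (x − y) (a − b) = 0.
  exchange : ∀ {x y a b} → ¬ a ≈ b → x * a + y * b ≈ x * b + y * a → x ≈ y
  exchange {x} {y} {a} {b} a≉b e = *-cancelʳ (a≉b ∘ x-y≈0⇒x≈y) (begin
    x * (a - b)                             ≈⟨ expand x ⟩
    x * a - x * b                           ≈⟨ +-cancelʳ (x * b + y * b) _ _ (begin
      (x * a - x * b) + (x * b + y * b)     ≈⟨ absorb (x * a) (x * b) (y * b) ⟩
      x * a + y * b                         ≈⟨ e ⟩
      x * b + y * a                         ≈⟨ +-comm (x * b) (y * a) ⟩
      y * a + x * b                         ≈⟨ absorb (y * a) (y * b) (x * b) ⟨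
      (y * a - y * b) + (y * b + x * b)     ≈⟨ +-congˡ (+-comm (y * b) (x * b)) ⟩
      (y * a - y * b) + (x * b + y * b)     ∎) ⟩
    y * a - y * b                           ≈⟨ expand y ⟨
    y * (a - b)                             ∎)
    where
    expand : ∀ z → z * (a - b) ≈ z * a - z * b
    expand z = trans (distribˡ z a (- b)) (+-congˡ (sym (-‿distribʳ-* z b)))
    absorb : ∀ r s t → (r - s) + (s + t) ≈ r + t
    absorb r s t = begin
      (r - s) + (s + t)   ≈⟨ +-assoc r (- s) (s + t) ⟩
      r + (- s + (s + t)) ≈⟨ +-congˡ (+-assoc (- s) s t) ⟨
      r + ((- s + s) + t) ≈⟨ +-congˡ (+-congʳ (-‿inverseˡ s)) ⟩
      r + (0# + t)        ≈⟨ +-congˡ (+-identityˡ t) ⟩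
      r + t               ∎

  ∑-𝟙-from : ∀ a → ∑ (allFin q) (λ t → 𝟙 (a ≈? from t)) ≡ 1ℤ
  ∑-𝟙-from a = ≡.trans
    (∑-cong (allFin q) (λ t → ℤ.≤-antisym
      (𝟙-mono (a ≈? from t) (t Fin.≟ to a) (λ e → ≡.trans (≡.sym (strictlyInverseˡ t)) (≡.sym (to-cong e))))
      (𝟙-mono (t Fin.≟ to a) (a ≈? from t) (λ { ≡.refl → sym (strictlyInverseʳ a) }))))
    (∑-𝟙-≡ Fin._≟_ (Unique.allFin⁺ q) (∈-allFin (to a)))

-- Second moment of the incidences between the w² points (d e , x u) and
-- the lines t = x + c d of slope c and intercept t.
module Incidence {c ℓ} {q : ℕ} (F : FiniteField c ℓ q) {w : ℕ}
  (x d : Fin w → FiniteField.Carrier F)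
  (x-injective : ∀ {u u′} → FiniteField._≈_ F (x u) (x u′) → u ≡ u′)
  (d-injective : ∀ {e e′} → FiniteField._≈_ F (d e) (d e′) → e ≡ e′) where
  open FiniteField F hiding (zero)
  open FieldProperties F

  points : List (Fin w × Fin w)
  points = cartesianProduct (allFin w) (allFin w)

  slopes : List (Fin q)
  slopes = allFin q

  value : Carrier → Fin w × Fin w → Carrier
  value c (u , e) = x u + c * d e

  incidences : Carrier → Carrier → ℤ
  incidences c t = ∑ points (λ i → 𝟙 (value c i ≈? t))

  incidences-cong : ∀ {c c′ t t′} → c ≈ c′ → t ≈ t′ → incidences c t ≡ incidences c′ t′
  incidences-cong c≈ t≈ = ∑-cong points λ i → ℤ.≤-antisym
    (𝟙-mono (_ ≈? _) (_ ≈? _) (λ e → trans (sym (+-congˡ (*-congʳ c≈))) (trans e t≈)))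
    (𝟙-mono (_ ≈? _) (_ ≈? _) (λ e → trans (+-congˡ (*-congʳ c≈)) (trans e (sym t≈))))

  ∑∑ : (Carrier → Carrier → ℤ) → ℤ
  ∑∑ f = ∑ slopes (λ c → ∑ slopes (λ t → f (from c) (from t)))

  ∑-points-const : ∀ a → ∑ points (λ _ → a) ≡ + w ℤ.* (+ w ℤ.* a)
  ∑-points-const a = ≡.trans (∑-cartesianProduct (allFin w) (allFin w) (λ _ → a))
    (≡.trans (∑-cong (allFin w) (λ _ → ∑-allFin-const w a)) (∑-allFin-const w (+ w ℤ.* a)))

  firstMoment : ∑∑ incidences ≡ + q ℤ.* (+ w ℤ.* + w)
  firstMoment = ≡.trans
    (∑-cong slopes (λ c → ≡.trans
      (∑-comm slopes points _)
      (≡.trans (∑-cong points (λ i → ∑-𝟙-from (value (from c) i))) (∑-points-const 1ℤ))))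
    (≡.trans (∑-allFin-const q _) (≡.cong (λ z → + q ℤ.* (+ w ℤ.* z)) (ℤ.*-identityʳ (+ w))))

  -- q if the points coincide, 0 if they only share d (no line is vertical), 1 otherwise.
  common : Fin w × Fin w → Fin w × Fin w → ℤ
  common (u , e) (u′ , e′) = 1ℤ ℤ.- 𝟙 (e′ Fin.≟ e) ℤ.+ + q ℤ.* (𝟙 (u′ Fin.≟ u) ℤ.* 𝟙 (e′ Fin.≟ e))

  slopes-through : ∀ i j → ∑ slopes (λ c → 𝟙 (value (from c) i ≈? value (from c) j)) ℤ.≤ common i j
  slopes-through (u , e) (u′ , e′) with e′ Fin.≟ e | u′ Fin.≟ u
  ... | yes ≡.refl | yes ≡.refl = ≡.subst (total ℤ.≤_) (≡.sym (eq (+ q)))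
    (count-injection _ q (Unique.allFin⁺ q) (λ {c} _ _ → c) (λ _ _ _ _ e → e))
    where
    total = ∑ slopes (λ c → 𝟙 (value (from c) (u , e) ≈? value (from c) (u , e)))
    eq : ∀ q → 1ℤ ℤ.- 1ℤ ℤ.+ q ℤ.* (1ℤ ℤ.* 1ℤ) ≡ q
    eq = solve-∀
  ... | yes ≡.refl | no u≢ = ≡.subst (total ℤ.≤_) (≡.sym (eq (+ q)))
    (count-injection _ 0 (Unique.allFin⁺ q) (λ _ e → contradiction (≡.sym (x-injective (+-cancelʳ _ _ _ e))) u≢)
      (λ _ _ e _ _ → contradiction (≡.sym (x-injective (+-cancelʳ _ _ _ e))) u≢))
    where
    total = ∑ slopes (λ c → 𝟙 (value (from c) (u , e) ≈? value (from c) (u′ , e)))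
    eq : ∀ q → 1ℤ ℤ.- 1ℤ ℤ.+ q ℤ.* (0ℤ ℤ.* 1ℤ) ≡ 0ℤ
    eq = solve-∀
  ... | no e≢ | u? = ≡.subst (total ℤ.≤_) (≡.sym (eq (+ q) (𝟙 u?)))
    (count-injection _ 1 (Unique.allFin⁺ q) (λ _ _ → zero) (λ {a} {b} _ _ r s _ → unique a b r s))
    where
    total = ∑ slopes (λ c → 𝟙 (value (from c) (u , e) ≈? value (from c) (u′ , e′)))
    eq : ∀ q z → 1ℤ ℤ.- 0ℤ ℤ.+ q ℤ.* (z ℤ.* 0ℤ) ≡ 1ℤ
    eq = solve-∀
    open SetoidReasoning setoid
    unique : ∀ a b → value (from a) (u , e) ≈ value (from a) (u′ , e′) →
             value (from b) (u , e) ≈ value (from b) (u′ , e′) → a ≡ b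
    unique a b r s = ≡.trans (≡.sym (strictlyInverseˡ a)) (≡.trans (to-cong (exchange
      (λ d≈ → e≢ (≡.sym (d-injective d≈)))
      (+-cancelˡ (x u + x u′) _ _ (begin
        (x u + x u′) + (α * d e + β * d e′)   ≈⟨ interchange _ _ _ _ ⟩
        (x u + α * d e) + (x u′ + β * d e′)   ≈⟨ +-cong r (sym s) ⟩
        (x u′ + α * d e′) + (x u + β * d e)   ≈⟨ interchange _ _ _ _ ⟨
        (x u′ + x u) + (α * d e′ + β * d e)   ≈⟨ +-congʳ (+-comm (x u′) (x u)) ⟩
        (x u + x u′) + (α * d e′ + β * d e)   ∎)))) (strictlyInverseˡ b))
      where
      α = from a
      β = from b
      open CommutativeSemigroupProperties +-commutativeSemigroup using (interchange)

  common-sum : ∀ i → ∑ points (common i) ≡ + w ℤ.* (+ w ℤ.* 1ℤ) ℤ.- + w ℤ.+ + q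
  common-sum (u , e) = ≡.trans (∑-cartesianProduct (allFin w) (allFin w) (common (u , e))) (≡.trans
    (∑-cong (allFin w) row) (≡.trans (∑-distrib-+ (allFin w) _ _) (≡.trans
      (≡.cong₂ ℤ._+_ (∑-allFin-const w (+ w ℤ.* 1ℤ ℤ.- 1ℤ))
        (≡.trans (*-distribˡ-∑ (+ q) (allFin w) _)
          (≡.cong (+ q ℤ.*_) (∑-𝟙-≡ Fin._≟_ (Unique.allFin⁺ w) (∈-allFin u)))))
      (eq (+ w) (+ q)))))
    where
    eq : ∀ w q → w ℤ.* (w ℤ.* 1ℤ ℤ.- 1ℤ) ℤ.+ q ℤ.* 1ℤ ≡ w ℤ.* (w ℤ.* 1ℤ) ℤ.- w ℤ.+ q
    eq = solve-∀
    eq′ : ∀ w → w ℤ.+ ℤ.-1ℤ ℤ.* 1ℤ ≡ w ℤ.- 1ℤ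
    eq′ = solve-∀
    split : ∀ a q r → 1ℤ ℤ.- a ℤ.+ q ℤ.* (r ℤ.* a) ≡ (1ℤ ℤ.+ ℤ.-1ℤ ℤ.* a) ℤ.+ (q ℤ.* r) ℤ.* a
    split = solve-∀
    point : ∑ (allFin w) (λ e′ → 𝟙 (e′ Fin.≟ e)) ≡ 1ℤ
    point = ∑-𝟙-≡ Fin._≟_ (Unique.allFin⁺ w) (∈-allFin e)
    row : ∀ u′ → ∑ (allFin w) (λ e′ → common (u , e) (u′ , e′)) ≡
                 (+ w ℤ.* 1ℤ ℤ.- 1ℤ) ℤ.+ + q ℤ.* 𝟙 (u′ Fin.≟ u)
    row u′ = ≡.trans (∑-cong (allFin w) (λ e′ → split (𝟙 (e′ Fin.≟ e)) (+ q) (𝟙 (u′ Fin.≟ u))))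
      (≡.trans (∑-distrib-+ (allFin w) _ _) (≡.cong₂ ℤ._+_
        (≡.trans (∑-distrib-+ (allFin w) _ _) (≡.trans
          (≡.cong₂ ℤ._+_ (∑-allFin-const w 1ℤ) (≡.trans (*-distribˡ-∑ ℤ.-1ℤ (allFin w) _) (≡.cong (ℤ.-1ℤ ℤ.*_) point)))
          (eq′ (+ w ℤ.* 1ℤ))))
        (≡.trans (*-distribˡ-∑ (+ q ℤ.* 𝟙 (u′ Fin.≟ u)) (allFin w) _)
          (≡.trans (≡.cong ((+ q ℤ.* 𝟙 (u′ Fin.≟ u)) ℤ.*_) point) (ℤ.*-identityʳ _)))))

  -- Expanding the square counts, for each pair of points, the lines through both.
  secondMoment : ∑∑ (λ c t → sq (incidences c t)) ℤ.≤ + w ℤ.* (+ w ℤ.* (+ w ℤ.* + w ℤ.- + w ℤ.+ + q))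
  secondMoment = begin
    ∑ slopes (λ c → ∑ slopes (λ t → sq (incidences (from c) (from t))))
      ≡⟨ ∑-cong slopes (λ c → ∑-cong slopes (λ t → square c t)) ⟩
    ∑ slopes (λ c → ∑ slopes (λ t → ∑ points (λ i → ∑ points (both c t i))))
      ≡⟨ ∑-cong slopes (λ c → ∑-comm₂ (both c)) ⟩
    ∑ slopes (λ c → ∑ points (λ i → ∑ points (λ j → ∑ slopes (λ t → both c t i j))))
      ≤⟨ ∑-mono slopes (λ c → ∑-mono points (λ i → ∑-mono points (through c i))) ⟩
    ∑ slopes (λ c → ∑ points (λ i → ∑ points (λ j → meet c i j)))
      ≡⟨ ∑-comm₂ meet ⟩
    ∑ points (λ i → ∑ points (λ j → ∑ slopes (λ c → meet c i j)))
      ≤⟨ ∑-mono points (λ i → ∑-mono points (slopes-through i)) ⟩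
    ∑ points (λ i → ∑ points (common i))
      ≡⟨ ∑-cong points common-sum ⟩
    ∑ points (λ _ → + w ℤ.* (+ w ℤ.* 1ℤ) ℤ.- + w ℤ.+ + q)
      ≡⟨ ∑-points-const _ ⟩
    + w ℤ.* (+ w ℤ.* (+ w ℤ.* (+ w ℤ.* 1ℤ) ℤ.- + w ℤ.+ + q))
      ≡⟨ ≡.cong (λ z → + w ℤ.* (+ w ℤ.* (+ w ℤ.* z ℤ.- + w ℤ.+ + q))) (ℤ.*-identityʳ (+ w)) ⟩
    + w ℤ.* (+ w ℤ.* (+ w ℤ.* + w ℤ.- + w ℤ.+ + q)) ∎
    where
    open ℤ.≤-Reasoning
    on : Fin q → Fin q → Fin w × Fin w → ℤ
    on c t i = 𝟙 (value (from c) i ≈? from t)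
    both : Fin q → Fin q → Fin w × Fin w → Fin w × Fin w → ℤ
    both c t i j = on c t i ℤ.* on c t j
    meet : Fin q → Fin w × Fin w → Fin w × Fin w → ℤ
    meet c i j = 𝟙 (value (from c) i ≈? value (from c) j)
    square : ∀ c t → sq (incidences (from c) (from t)) ≡ ∑ points (λ i → ∑ points (both c t i))
    square c t = ≡.sym (≡.trans (∑-cong points (λ i → *-distribˡ-∑ (on c t i) points _))
      (*-distribʳ-∑ _ points _))
    ∑-comm₂ : ∀ (f : Fin q → Fin w × Fin w → Fin w × Fin w → ℤ) →
              ∑ slopes (λ t → ∑ points (λ i → ∑ points (f t i))) ≡
              ∑ points (λ i → ∑ points (λ j → ∑ slopes (λ t → f t i j)))
    ∑-comm₂ f = ≡.trans (∑-comm slopes points _) (∑-cong points (λ i → ∑-comm slopes points (λ t → f t i)))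
    pointwise : ∀ {a b} t → 𝟙 (a ≈? t) ℤ.* 𝟙 (b ≈? t) ℤ.≤ 𝟙 (a ≈? b) ℤ.* 𝟙 (a ≈? t)
    pointwise {a} {b} t with a ≈? t | b ≈? t
    ... | no  _ | b? = ℤ.≤-reflexive (≡.trans (ℤ.*-zeroˡ (𝟙 b?)) (≡.sym (ℤ.*-zeroʳ (𝟙 (a ≈? b)))))
    ... | yes e | yes e′ = ℤ.≤-reflexive (≡.sym (≡.cong (ℤ._* 1ℤ) (𝟙-yes (a ≈? b) (trans e (sym e′)))))
    ... | yes _ | no _ = ≡.subst (0ℤ ℤ.≤_) (≡.sym (ℤ.*-identityʳ (𝟙 (a ≈? b)))) (𝟙-nonneg (a ≈? b))
    through : ∀ c i j → ∑ slopes (λ t → both c t i j) ℤ.≤ meet c i j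
    through c i j = ℤ.≤-trans (∑-mono slopes (λ t → pointwise (from t)))
      (ℤ.≤-reflexive (≡.trans (*-distribˡ-∑ (meet c i j) slopes _)
        (≡.trans (≡.cong (meet c i j ℤ.*_) (∑-𝟙-from (value (from c) i))) (ℤ.*-identityʳ _))))

  deviation : Carrier → Carrier → ℤ
  deviation c t = + w ℤ.* + w ℤ.- + q ℤ.* incidences c t

  -- The mean number of incidences of a line is w² / q; `deviation` is the distance from it scaled
  -- by q to stay in ℤ. On expansion the terms in w⁴ cancel. Pairs of points on a common vertical
  -- contribute nothing to the second moment, and this lowers q to q - w.
  variance : ∑∑ (λ c t → sq (deviation c t)) ℤ.≤ sq (+ q) ℤ.* (sq (+ w) ℤ.* (+ q ℤ.- + w))
  variance = begin
    ∑∑ (λ c t → sq (deviation c t))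
      ≡⟨ ∑-cong slopes (λ c → ∑-cong slopes (λ t → expand (+ w) (+ q) (incidences (from c) (from t)))) ⟩
    ∑∑ (λ c t → sq (sq (+ w)) ℤ.+ (α ℤ.* incidences c t ℤ.+ β ℤ.* sq (incidences c t)))
      ≡⟨ linear ⟩
    + q ℤ.* (+ q ℤ.* sq (sq (+ w))) ℤ.+ (α ℤ.* ∑∑ incidences ℤ.+ β ℤ.* ∑∑ (λ c t → sq (incidences c t)))
      ≡⟨ ≡.cong (λ z → + q ℤ.* (+ q ℤ.* sq (sq (+ w))) ℤ.+ (α ℤ.* z ℤ.+ β ℤ.* ∑∑ (λ c t → sq (incidences c t)))) firstMoment ⟩
    + q ℤ.* (+ q ℤ.* sq (sq (+ w))) ℤ.+ (α ℤ.* (+ q ℤ.* (+ w ℤ.* + w)) ℤ.+ β ℤ.* ∑∑ (λ c t → sq (incidences c t)))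
      ≤⟨ ℤ.+-monoʳ-≤ (+ q ℤ.* (+ q ℤ.* sq (sq (+ w)))) (ℤ.+-monoʳ-≤ (α ℤ.* (+ q ℤ.* (+ w ℤ.* + w)))
           (ℤ.*-monoˡ-≤-nonNeg β {{ℤ.nonNegative (sq-nonneg (+ q))}} secondMoment)) ⟩
    + q ℤ.* (+ q ℤ.* sq (sq (+ w))) ℤ.+ (α ℤ.* (+ q ℤ.* (+ w ℤ.* + w)) ℤ.+
      β ℤ.* (+ w ℤ.* (+ w ℤ.* (+ w ℤ.* + w ℤ.- + w ℤ.+ + q))))
      ≡⟨ collect (+ w) (+ q) ⟩
    sq (+ q) ℤ.* (sq (+ w) ℤ.* (+ q ℤ.- + w)) ∎
    where
    open ℤ.≤-Reasoning
    α β : ℤ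
    α = ℤ.- (+ 2 ℤ.* + q ℤ.* (+ w ℤ.* + w))
    β = sq (+ q)
    expand : ∀ w q m → (w ℤ.* w ℤ.- q ℤ.* m) ℤ.* (w ℤ.* w ℤ.- q ℤ.* m) ≡
             (w ℤ.* w) ℤ.* (w ℤ.* w) ℤ.+ (ℤ.- (+ 2 ℤ.* q ℤ.* (w ℤ.* w)) ℤ.* m ℤ.+ (q ℤ.* q) ℤ.* (m ℤ.* m))
    expand = solve-∀
    collect : ∀ w q → q ℤ.* (q ℤ.* ((w ℤ.* w) ℤ.* (w ℤ.* w))) ℤ.+
      (ℤ.- (+ 2 ℤ.* q ℤ.* (w ℤ.* w)) ℤ.* (q ℤ.* (w ℤ.* w)) ℤ.+
       (q ℤ.* q) ℤ.* (w ℤ.* (w ℤ.* (w ℤ.* w ℤ.- w ℤ.+ q)))) ≡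
      (q ℤ.* q) ℤ.* ((w ℤ.* w) ℤ.* (q ℤ.- w))
    collect = solve-∀
    ∑∑-+ : ∀ f g → ∑∑ (λ c t → f c t ℤ.+ g c t) ≡ ∑∑ f ℤ.+ ∑∑ g
    ∑∑-+ f g = ≡.trans (∑-cong slopes (λ c → ∑-distrib-+ slopes _ _)) (∑-distrib-+ slopes _ _)
    ∑∑-* : ∀ a f → ∑∑ (λ c t → a ℤ.* f c t) ≡ a ℤ.* ∑∑ f
    ∑∑-* a f = ≡.trans (∑-cong slopes (λ c → *-distribˡ-∑ a slopes _)) (*-distribˡ-∑ a slopes _)
    ∑∑-const : ∀ a → ∑∑ (λ _ _ → a) ≡ + q ℤ.* (+ q ℤ.* a)
    ∑∑-const a = ≡.trans (∑-cong slopes (λ _ → ∑-allFin-const q a)) (∑-allFin-const q _)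
    I I² : Carrier → Carrier → ℤ
    I c t = α ℤ.* incidences c t
    I² c t = β ℤ.* sq (incidences c t)
    linear : ∑∑ (λ c t → sq (sq (+ w)) ℤ.+ (I c t ℤ.+ I² c t)) ≡
             + q ℤ.* (+ q ℤ.* sq (sq (+ w))) ℤ.+ (α ℤ.* ∑∑ incidences ℤ.+ β ℤ.* ∑∑ (λ c t → sq (incidences c t)))
    linear = ≡.trans (∑∑-+ (λ _ _ → sq (sq (+ w))) (λ c t → I c t ℤ.+ I² c t))
      (≡.cong₂ ℤ._+_ (∑∑-const (sq (sq (+ w)))) (≡.trans (∑∑-+ I I²)
        (≡.cong₂ ℤ._+_ (∑∑-* α incidences) (∑∑-* β (λ c t → sq (incidences c t))))))

  module _ (g h : Fin w → Carrier) (g-injective : ∀ {e e′} → g e ≈ g e′ → e ≡ e′)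
           (h-injective : ∀ {y y′} → h y ≈ h y′ → y ≡ y′) where

    restricted : ∑ (allFin w) (λ e → ∑ (allFin w) (λ y → sq (deviation (g e) (h y)))) ℤ.≤
                 ∑∑ (λ c t → sq (deviation c t))
    restricted = begin
      ∑ (allFin w) (λ e → ∑ (allFin w) (λ y → f (g e) (h y)))
        ≡⟨ ∑-cong (allFin w) (λ e → ∑-cong (allFin w) (λ y → f-cong (g e) (h y))) ⟩
      ∑ (allFin w) (λ e → ∑ (allFin w) (λ y → f (from (to (g e))) (from (to (h y)))))
        ≤⟨ ∑-mono (allFin w) (λ e → ∑-injection Fin._≟_ (Unique.allFin⁺ w) (to ∘ h) (h-injective ∘ to-injective)
             ∈-allFin (Unique.allFin⁺ q) {λ t → f (from (to (g e))) (from t)}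
             (λ t → sq-nonneg (deviation (from (to (g e))) (from t)))) ⟩
      ∑ (allFin w) (λ e → ∑ slopes (λ t → f (from (to (g e))) (from t)))
        ≤⟨ ∑-injection Fin._≟_ (Unique.allFin⁺ w) (to ∘ g) (g-injective ∘ to-injective)
             ∈-allFin (Unique.allFin⁺ q) {λ c → ∑ slopes (λ t → f (from c) (from t))}
             (λ c → ∑-nonneg slopes (λ t → sq-nonneg (deviation (from c) (from t)))) ⟩
      ∑∑ f ∎
      where
      open ℤ.≤-Reasoning
      f : Carrier → Carrier → ℤ
      f c t = sq (deviation c t)
      f-cong : ∀ c t → f c t ≡ f (from (to c)) (from (to t))
      f-cong c t = ≡.cong (λ m → sq (+ w ℤ.* + w ℤ.- + q ℤ.* m))
        (incidences-cong (sym (strictlyInverseʳ c)) (sym (strictlyInverseʳ t)))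

    -- In a row with at most B w incidences the mean of `deviation` is at least w² - q B = l, so its
    -- squares sum to at least w l²; the tangent inequality takes the place of Cauchy-Schwarz. The w
    -- rows together are then set against the total variance.
    few-incidences : ∀ {B l} → w ℕ.* w ≡ q ℕ.* B ℕ.+ l →
      (∀ e → ∑ (allFin w) (λ y → incidences (g e) (h y)) ℤ.≤ + (B ℕ.* w)) →
      sq (+ w) ℤ.* sq (+ l) ℤ.≤ sq (+ w) ℤ.* (sq (+ q) ℤ.* (+ q ℤ.- + w))
    few-incidences {B} {l} w²≡ few = begin
      sq (+ w) ℤ.* sq L
        ≡⟨ ℤ.*-assoc (+ w) (+ w) (sq L) ⟩
      + w ℤ.* (+ w ℤ.* sq L)
        ≡⟨ ∑-allFin-const w _ ⟨
      ∑ (allFin w) (λ _ → + w ℤ.* sq L)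
        ≤⟨ ∑-mono (allFin w) row ⟩
      ∑ (allFin w) (λ e → ∑ (allFin w) (λ y → sq (deviation (g e) (h y))))
        ≤⟨ restricted ⟩
      ∑∑ (λ c t → sq (deviation c t))
        ≤⟨ variance ⟩
      sq (+ q) ℤ.* (sq (+ w) ℤ.* (+ q ℤ.- + w))
        ≡⟨ swap (sq (+ q)) (sq (+ w)) (+ q ℤ.- + w) ⟩
      sq (+ w) ℤ.* (sq (+ q) ℤ.* (+ q ℤ.- + w)) ∎
      where
      open ℤ.≤-Reasoning
      L : ℤ
      L = + l
      swap : ∀ a b c → a ℤ.* (b ℤ.* c) ≡ b ℤ.* (a ℤ.* c)
      swap = solve-∀
      w²≡ℤ : + w ℤ.* + w ≡ + q ℤ.* + B ℤ.+ L
      w²≡ℤ = ≡.trans (≡.sym (ℤ.pos-* w w)) (≡.trans (≡.cong +_ w²≡) (≡.trans (ℤ.pos-+ (q ℕ.* B) l) (≡.cong (ℤ._+ L) (ℤ.pos-* q B))))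
      -- a² ≥ 2 L a − L², the tangent of the square at the mean L.
      tangent : ∀ m → let a = + w ℤ.* + w ℤ.- + q ℤ.* m in
                (+ 2 ℤ.* L ℤ.* (+ w ℤ.* + w) ℤ.- sq L) ℤ.+ ℤ.- (+ 2 ℤ.* L ℤ.* + q) ℤ.* m ℤ.≤ sq a
      tangent m = ℤ.0≤i-j⇒j≤i (≡.subst (0ℤ ℤ.≤_) (eq (+ w) (+ q) L m) (sq-nonneg ((+ w ℤ.* + w ℤ.- + q ℤ.* m) ℤ.- L)))
        where
        eq : ∀ w q L m → let a = w ℤ.* w ℤ.- q ℤ.* m in
             (a ℤ.- L) ℤ.* (a ℤ.- L) ≡ a ℤ.* a ℤ.- ((+ 2 ℤ.* L ℤ.* (w ℤ.* w) ℤ.- L ℤ.* L) ℤ.+ ℤ.- (+ 2 ℤ.* L ℤ.* q) ℤ.* m)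
        eq = solve-∀
      row : ∀ e → + w ℤ.* sq L ℤ.≤ ∑ (allFin w) (λ y → sq (deviation (g e) (h y)))
      row e = begin
        + w ℤ.* sq L
          ≡⟨ eq₁ (+ w) (+ q) (+ B) L (+ w ℤ.* + w) w²≡ℤ ⟩
        + w ℤ.* κ ℤ.+ ℤ.- (+ 2 ℤ.* L ℤ.* + q) ℤ.* (+ B ℤ.* + w)
          ≤⟨ ℤ.+-monoʳ-≤ (+ w ℤ.* κ) (ℤ.*-monoˡ-≤-nonPos (ℤ.- (+ 2 ℤ.* L ℤ.* + q)) {{nonPos}}
               (≡.subst (N ℤ.≤_) (ℤ.pos-* B w) (few e))) ⟩
        + w ℤ.* κ ℤ.+ ℤ.- (+ 2 ℤ.* L ℤ.* + q) ℤ.* N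
          ≡⟨ ≡.cong₂ ℤ._+_ (∑-allFin-const w κ) (*-distribˡ-∑ (ℤ.- (+ 2 ℤ.* L ℤ.* + q)) (allFin w) (λ y → incidences (g e) (h y))) ⟨
        ∑ (allFin w) (λ _ → κ) ℤ.+ ∑ (allFin w) (λ y → ℤ.- (+ 2 ℤ.* L ℤ.* + q) ℤ.* incidences (g e) (h y))
          ≡⟨ ∑-distrib-+ (allFin w) _ _ ⟨
        ∑ (allFin w) (λ y → κ ℤ.+ ℤ.- (+ 2 ℤ.* L ℤ.* + q) ℤ.* incidences (g e) (h y))
          ≤⟨ ∑-mono (allFin w) (λ y → tangent (incidences (g e) (h y))) ⟩
        ∑ (allFin w) (λ y → sq (deviation (g e) (h y))) ∎
        where
        κ N : ℤ
        κ = + 2 ℤ.* L ℤ.* (+ w ℤ.* + w) ℤ.- sq L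
        N = ∑ (allFin w) (λ y → incidences (g e) (h y))
        nonPos : ℤ.NonPositive (ℤ.- (+ 2 ℤ.* L ℤ.* + q))
        nonPos = ℤ.nonPositive (ℤ.neg-mono-≤ (≡.subst (0ℤ ℤ.≤_) (≡.trans (ℤ.pos-* (2 ℕ.* l) q) (≡.cong (ℤ._* + q) (ℤ.pos-* 2 l))) (ℤ.+≤+ ℕ.z≤n)))
        eq₁ : ∀ w q B L s → s ≡ q ℤ.* B ℤ.+ L →
              w ℤ.* (L ℤ.* L) ≡ w ℤ.* (+ 2 ℤ.* L ℤ.* s ℤ.- L ℤ.* L) ℤ.+ ℤ.- (+ 2 ℤ.* L ℤ.* q) ℤ.* (B ℤ.* w)
        eq₁ w q B L _ ≡.refl = eq w q B L
          where
          eq : ∀ w q B L → w ℤ.* (L ℤ.* L) ≡ w ℤ.* (+ 2 ℤ.* L ℤ.* (q ℤ.* B ℤ.+ L) ℤ.- L ℤ.* L) ℤ.+ ℤ.- (+ 2 ℤ.* L ℤ.* q) ℤ.* (B ℤ.* w)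
          eq = solve-∀

-- Congruences and exponentials

-- A record around x ≡ y [mod n ], whose unfolding would hide x and y from
-- unification.
record Cong (n : ℕ) (x y : ℤ) : Set where
  constructor ⟨_⟩
  field
    divides : x ≡ y [mod n ]

open Cong

module _ {n : ℕ} where

  combine₁ : ∀ α {x y z z′} → Cong n x y → z ℤ.- z′ ≡ α ℤ.* (x ℤ.- y) → Cong n z z′
  combine₁ α ⟨ p ⟩ e = ⟨ ≡.subst (+ n ℤ.∣_) (≡.sym e) (ℤ.∣n⇒∣m*n α p) ⟩

  combine₂ : ∀ α β {x y x′ y′ z z′} → Cong n x y → Cong n x′ y′ →
             z ℤ.- z′ ≡ α ℤ.* (x ℤ.- y) ℤ.+ β ℤ.* (x′ ℤ.- y′) → Cong n z z′
  combine₂ α β ⟨ p ⟩ ⟨ r ⟩ e =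
    ⟨ ≡.subst (+ n ℤ.∣_) (≡.sym e) (ℤ.∣m∣n⇒∣m+n (ℤ.∣n⇒∣m*n α p) (ℤ.∣n⇒∣m*n β r)) ⟩

  combine₃ : ∀ α β γ {x y x′ y′ x″ y″ z z′} → Cong n x y → Cong n x′ y′ → Cong n x″ y″ →
             z ℤ.- z′ ≡ α ℤ.* (x ℤ.- y) ℤ.+ β ℤ.* (x′ ℤ.- y′) ℤ.+ γ ℤ.* (x″ ℤ.- y″) → Cong n z z′
  combine₃ α β γ ⟨ p ⟩ ⟨ r ⟩ ⟨ s ⟩ e = ⟨ ≡.subst (+ n ℤ.∣_) (≡.sym e)
    (ℤ.∣m∣n⇒∣m+n (ℤ.∣m∣n⇒∣m+n (ℤ.∣n⇒∣m*n α p) (ℤ.∣n⇒∣m*n β r)) (ℤ.∣n⇒∣m*n γ s)) ⟩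

  Cong-reflexive : ∀ {x y} → x ≡ y → Cong n x y
  Cong-reflexive {x} ≡.refl = ⟨ ≡.subst (+ n ℤ.∣_) (≡.sym (ℤ.+-inverseʳ x)) (ℤ.divides 0ℤ (≡.sym (ℤ.*-zeroˡ (+ n)))) ⟩

  Cong-refl : ∀ {x} → Cong n x x
  Cong-refl = Cong-reflexive ≡.refl

  Cong-sym : ∀ {x y} → Cong n x y → Cong n y x
  Cong-sym {x} {y} p = combine₁ -1ℤ p (eq x y)
    where
    eq : ∀ x y → y ℤ.- x ≡ -1ℤ ℤ.* (x ℤ.- y)
    eq = solve-∀

  Cong-trans : ∀ {x y z} → Cong n x y → Cong n y z → Cong n x z
  Cong-trans {x} {y} {z} p r = combine₂ 1ℤ 1ℤ p r (eq x y z)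
    where
    eq : ∀ x y z → x ℤ.- z ≡ 1ℤ ℤ.* (x ℤ.- y) ℤ.+ 1ℤ ℤ.* (y ℤ.- z)
    eq = solve-∀

  _Cong?_ : ∀ x y → Dec (Cong n x y)
  x Cong? y = Dec.map′ ⟨_⟩ divides (+ n ℤ.∣? (x ℤ.- y))

  -- Modulo an odd n = 1 + 2 h the number 2 is invertible: x - y = (x - y) n - h (2 x - 2 y).
  Cong-halve : ∀ h → n ≡ 1 ℕ.+ 2 ℕ.* h → ∀ {x y} → Cong n (x ℤ.+ x) (y ℤ.+ y) → Cong n x y
  Cong-halve h n≡ {x} {y} p = combine₂ (x ℤ.- y) (ℤ.- (+ h)) multiple p
    (≡.trans (eq x y (+ h)) (≡.cong (λ z → (x ℤ.- y) ℤ.* (z ℤ.- 0ℤ) ℤ.+ ℤ.- (+ h) ℤ.* ((x ℤ.+ x) ℤ.- (y ℤ.+ y)))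
      (≡.sym (≡.trans (≡.cong +_ n≡) (≡.trans (ℤ.pos-+ 1 (2 ℕ.* h)) (≡.cong (ℤ._+_ 1ℤ) (ℤ.pos-* 2 h)))))))
    where
    multiple : Cong n (+ n) 0ℤ
    multiple = ⟨ ≡.subst (+ n ℤ.∣_) (≡.sym (ℤ.+-identityʳ (+ n))) ℤ.∣-refl ⟩
    eq : ∀ x y h → x ℤ.- y ≡ (x ℤ.- y) ℤ.* ((1ℤ ℤ.+ + 2 ℤ.* h) ℤ.- 0ℤ) ℤ.+ ℤ.- h ℤ.* ((x ℤ.+ x) ℤ.- (y ℤ.+ y))
    eq = solve-∀

Cong-∣ : ∀ {d n x y} → d ℕ.∣ n → Cong n x y → Cong d x y
Cong-∣ d∣n ⟨ p ⟩ = ⟨ ℤ.∣-trans (ℤ.∣ᵤ⇒∣ d∣n) p ⟩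

Cong-toℕ-injective : ∀ {n} {u u′ : Fin n} → Cong n (+ toℕ u) (+ toℕ u′) → u ≡ u′
Cong-toℕ-injective {n} {u} {u′} ⟨ p ⟩ with u Fin.≟ u′
... | yes u≡u′ = u≡u′
... | no  u≢u′ = contradiction (ℕ.∣⇒≤ {{nonZero}} (ℤ.∣⇒∣ᵤ p)) (ℕ.<⇒≱ small)
  where
  nonZero : ℕ.NonZero ℤ.∣ + toℕ u ℤ.- + toℕ u′ ∣
  nonZero = ℕ.≢-nonZero (λ e → u≢u′ (Fin.toℕ-injective (ℤ.+-injective (ℤ.i-j≡0⇒i≡j _ _ (ℤ.∣i∣≡0⇒i≡0 e)))))
  small : ℤ.∣ + toℕ u ℤ.- + toℕ u′ ∣ ℕ.< n
  small = ≡.subst (λ z → ℤ.∣ z ∣ ℕ.< n) (≡.sym (ℤ.m-n≡m⊖n (toℕ u) (toℕ u′)))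
    (ℕ.≤-<-trans (ℤ.∣m⊝n∣≤m⊔n (toℕ u) (toℕ u′)) (ℕ.⊔-pres-<m (Fin.toℕ<n u) (Fin.toℕ<n u′)))

module _ {w : ℕ} .{{_ : ℕ.NonZero w}} where

  residue : ℤ → Fin w
  residue i = fromℕ< (ℤ.n%ℕd<d i w)

  residue-injective : ∀ {i j} → residue i ≡ residue j → Cong w i j
  residue-injective {i} {j} e = Cong-trans (reduce i)
    (Cong-trans (Cong-reflexive (≡.cong +_ (Fin.fromℕ<-injective _ _ _ _ e))) (Cong-sym (reduce j)))
    where
    reduce : ∀ i → Cong w i (+ (i ℤ.%ℕ w))
    reduce i = ⟨ ℤ.divides (i ℤ./ℕ w) (≡.trans (≡.cong (ℤ._- + (i ℤ.%ℕ w)) (ℤ.a≡a%ℕn+[a/ℕn]*n i w))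
                   (eq (+ (i ℤ.%ℕ w)) ((i ℤ./ℕ w) ℤ.* + w))) ⟩
      where
      eq : ∀ a b → a ℤ.+ b ℤ.- a ≡ b
      eq = solve-∀

module Class (k w : ℕ) {v : ℕ} (v≡kw : v ≡ k ℕ.* w) where

  k∣v : k ℕ.∣ v
  k∣v = ≡.subst (k ℕ.∣_) (≡.sym v≡kw) (ℕ.m∣m*n w)

  -- Through `exp`, these w exponents list the coset of the subgroup of order w that belongs to the
  -- class of r modulo k.
  at : ℤ → Fin w → ℤ
  at r u = r ℤ.+ + k ℤ.* + toℕ u

  at-class : ∀ r u → Cong k (at r u) r
  at-class r u = ⟨ ℤ.divides (+ toℕ u) (eq r (+ k) (+ toℕ u)) ⟩
    where
    eq : ∀ r k u → r ℤ.+ k ℤ.* u ℤ.- r ≡ u ℤ.* k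
    eq = solve-∀

  +v≡ : + v ≡ + k ℤ.* + w
  +v≡ = ≡.trans (≡.cong +_ v≡kw) (ℤ.pos-* k w)

  Cong-scale : ∀ {x y} → Cong w x y → Cong v (+ k ℤ.* x) (+ k ℤ.* y)
  Cong-scale {x} {y} ⟨ p ⟩ = ⟨ ≡.subst₂ ℤ._∣_ (≡.sym +v≡) (eq (+ k) x y) (ℤ.*-monoʳ-∣ (+ k) p) ⟩
    where
    eq : ∀ k x y → k ℤ.* (x ℤ.- y) ≡ k ℤ.* x ℤ.- k ℤ.* y
    eq = solve-∀

  at-injective : .{{_ : ℕ.NonZero k}} → ∀ r {u u′} → Cong v (at r u) (at r u′) → u ≡ u′
  at-injective r {u} {u′} ⟨ p ⟩ = Cong-toℕ-injective ⟨ ℤ.*-cancelˡ-∣ (+ k)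
    (≡.subst₂ ℤ._∣_ +v≡ (eq r (+ k) (+ toℕ u) (+ toℕ u′)) p) ⟩
    where
    eq : ∀ r k u u′ → (r ℤ.+ k ℤ.* u) ℤ.- (r ℤ.+ k ℤ.* u′) ≡ k ℤ.* (u ℤ.- u′)
    eq = solve-∀

-- The last field says that −1 is not a square.
record Exponential {c ℓ} {q : ℕ} (F : FiniteField c ℓ q) (v : ℕ) : Set (c ⊔ ℓ) where
  open FiniteField F hiding (zero)
  field
    exp           : ℤ → Carrier
    exp-cong      : ∀ {i j} → Cong v i j → exp i ≈ exp j
    exp-injective : ∀ {i j} → exp i ≈ exp j → Cong v i j
    exp-+         : ∀ i j → exp (i ℤ.+ j) ≈ exp i * exp j
    exp≉0         : ∀ i → ¬ exp i ≈ 0#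
    exp+exp≉0     : ∀ i j → ¬ exp i + exp j ≈ 0#

module ExponentialProperties {c ℓ} {q : ℕ} {F : FiniteField c ℓ q} {v : ℕ} (X : Exponential F v) where
  open FiniteField F hiding (zero)
  open FieldProperties F
  open Exponential X
  open SetoidReasoning setoid
  open SemiringSolver commutativeSemiring using (solve; _:=_; _:+_; _:*_; con)

  -- In the field, x y = z f gives y (x + f) = (y + z) f, and x + f ≠ 0.
  product-determines : ∀ {x y z x′ y′ z′ f} → Cong v (x ℤ.+ y) (z ℤ.+ f) → Cong v (x′ ℤ.+ y′) (z′ ℤ.+ f) →
    exp x + exp y + exp z ≈ exp x′ + exp y′ + exp z′ → Cong v x x′ → Cong v y y′
  product-determines {x} {y} {z} {x′} {y′} {z′} {f} p p′ total x≡x′ =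
    exp-injective (*-cancelʳ (exp+exp≉0 x f) (begin
      exp y * (exp x + exp f)                  ≈⟨ rearrange p refl ⟩
      (exp y + exp z) * exp f                  ≈⟨ *-congʳ (+-cancelˡ (exp x) _ _ (begin
        exp x + (exp y + exp z)                ≈⟨ +-assoc _ _ _ ⟨
        exp x + exp y + exp z                  ≈⟨ total ⟩
        exp x′ + exp y′ + exp z′               ≈⟨ +-assoc _ _ _ ⟩
        exp x′ + (exp y′ + exp z′)             ≈⟨ +-congʳ (exp-cong x≡x′) ⟨
        exp x + (exp y′ + exp z′)              ∎)) ⟩
      (exp y′ + exp z′) * exp f                ≈⟨ rearrange p′ (exp-cong x≡x′) ⟨
      exp y′ * (exp x + exp f)                 ∎))
    where
    rearrange : ∀ {x₁ y z} → Cong v (x₁ ℤ.+ y) (z ℤ.+ f) → exp x ≈ exp x₁ →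
              exp y * (exp x + exp f) ≈ (exp y + exp z) * exp f
    rearrange {x₁} {y} {z} p x≈ = begin
      exp y * (exp x + exp f)         ≈⟨ distribˡ (exp y) (exp x) (exp f) ⟩
      exp y * exp x + exp y * exp f   ≈⟨ +-congʳ (begin
        exp y * exp x                 ≈⟨ *-comm _ _ ⟩
        exp x * exp y                 ≈⟨ *-congʳ x≈ ⟩
        exp x₁ * exp y                ≈⟨ exp-+ x₁ y ⟨
        exp (x₁ ℤ.+ y)                ≈⟨ exp-cong p ⟩
        exp (z ℤ.+ f)                 ≈⟨ exp-+ z f ⟩
        exp z * exp f                 ∎) ⟩
      exp z * exp f + exp y * exp f   ≈⟨ +-comm _ _ ⟩
      exp y * exp f + exp z * exp f   ≈⟨ distribʳ (exp f) (exp y) (exp z) ⟨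
      (exp y + exp z) * exp f         ∎

  trinomial : ℤ → Carrier
  trinomial t = 1# + exp t + exp t * exp t

  progression-sum : ∀ {x y z} → Cong v (y ℤ.+ y) (x ℤ.+ z) →
                    exp x + exp y + exp z ≈ exp x * trinomial (y ℤ.- x)
  progression-sum {x} {y} {z} p = begin
    exp x + exp y + exp z                             ≈⟨ +-cong (+-congˡ (trans (exp-cong (Cong-reflexive (eq₁ x y))) (exp-+ x t)))
                                                           (trans (exp-cong (combine₁ -1ℤ p (eq₂ x y z))) (trans (exp-+ x _) (*-congˡ (exp-+ t t)))) ⟩
    exp x + exp x * exp t + exp x * (exp t * exp t)   ≈⟨ solve 2 (λ x t → x :+ x :* t :+ x :* (t :* t) := x :* (con 1 :+ t :+ t :* t)) refl (exp x) (exp t) ⟩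
    exp x * trinomial t                               ∎
    where
    t = y ℤ.- x
    eq₁ : ∀ x y → y ≡ x ℤ.+ (y ℤ.- x)
    eq₁ = solve-∀
    eq₂ : ∀ x y z → z ℤ.- (x ℤ.+ ((y ℤ.- x) ℤ.+ (y ℤ.- x))) ≡ -1ℤ ℤ.* ((y ℤ.+ y) ℤ.- (x ℤ.+ z))
    eq₂ = solve-∀

  -- The total is `exp x` times a trinomial in the ratio alone. As the total is nonzero so is the
  -- trinomial, and it can be cancelled.
  ratio-determines : ∀ {x y z x′ y′ z′} → Cong v (y ℤ.+ y) (x ℤ.+ z) → Cong v (y′ ℤ.+ y′) (x′ ℤ.+ z′) →
    exp x + exp y + exp z ≈ exp x′ + exp y′ + exp z′ → ¬ exp x + exp y + exp z ≈ 0# →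
    Cong v (y ℤ.- x) (y′ ℤ.- x′) → Cong v x x′
  ratio-determines {x} {y} {z} {x′} {y′} {z′} p p′ total total≉0 t≡t′ =
    exp-injective (*-cancelʳ trinomial≉0 (begin
      exp x * trinomial (y ℤ.- x)      ≈⟨ progression-sum p ⟨
      exp x + exp y + exp z            ≈⟨ total ⟩
      exp x′ + exp y′ + exp z′         ≈⟨ progression-sum p′ ⟩
      exp x′ * trinomial (y′ ℤ.- x′)   ≈⟨ *-congˡ (+-cong (+-congˡ τ≈) (*-cong τ≈ τ≈)) ⟨
      exp x′ * trinomial (y ℤ.- x)     ∎))
    where
    τ≈ = exp-cong t≡t′
    trinomial≉0 : ¬ trinomial (y ℤ.- x) ≈ 0#
    trinomial≉0 e = total≉0 (trans (progression-sum p) (trans (*-congˡ e) (zeroʳ (exp x))))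

  -- Roots t, t′ of 1 + t + t² satisfy (t′ − t) (t′ − t²) = 0.
  trinomial-roots : ∀ {t t′} → trinomial t ≈ 0# → trinomial t′ ≈ 0# → ¬ Cong v t′ t → Cong v t′ (t ℤ.+ t)
  trinomial-roots {t} {t′} e e′ t′≢t = exp-injective (trans
    (exchange (t′≢t ∘ exp-injective) (+-cancelʳ τ′ _ _ (begin
      τ′ * τ′ + (τ * τ) * τ + τ′       ≈⟨ +-congʳ (+-congˡ τ³≈1) ⟩
      τ′ * τ′ + 1# + τ′                ≈⟨ trans (+-assoc _ _ _) (+-comm _ _) ⟩
      1# + τ′ + τ′ * τ′                ≈⟨ e′ ⟩
      0#                               ≈⟨ zeroʳ τ′ ⟨
      τ′ * 0#                          ≈⟨ *-congˡ e ⟨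
      τ′ * (1# + τ + τ * τ)            ≈⟨ distribˡ τ′ (1# + τ) (τ * τ) ⟩
      τ′ * (1# + τ) + τ′ * (τ * τ)     ≈⟨ +-congʳ (trans (distribˡ τ′ 1# τ) (+-congʳ (*-identityʳ τ′))) ⟩
      τ′ + τ′ * τ + τ′ * (τ * τ)       ≈⟨ trans (+-assoc _ _ _) (trans (+-comm _ _) (+-congʳ (+-congˡ (*-comm _ _)))) ⟩
      τ′ * τ + (τ * τ) * τ′ + τ′       ∎)))
    (sym (exp-+ t t)))
    where
    τ τ′ : Carrier
    τ  = exp t
    τ′ = exp t′
    τ³≈1 : (τ * τ) * τ ≈ 1#
    τ³≈1 = +-cancelʳ (τ + τ * τ) _ _ (begin
      (τ * τ) * τ + (τ + τ * τ)     ≈⟨ solve 1 (λ t → (t :* t) :* t :+ (t :+ t :* t) := t :* (con 1 :+ t :+ t :* t)) refl τ ⟩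
      τ * (1# + τ + τ * τ)          ≈⟨ *-congˡ e ⟩
      τ * 0#                        ≈⟨ zeroʳ τ ⟩
      0#                            ≈⟨ e ⟨
      1# + τ + τ * τ                ≈⟨ +-assoc _ _ _ ⟩
      1# + (τ + τ * τ)              ∎)

  -- With total 0 the ratio is a root of 1 + t + t², so there are two candidates, t and its square.
  -- If the second triple had the square, its exponent y′ - x′ would be 2 (y - x); but x and y keep
  -- their classes modulo k, so y - x would vanish modulo k, against `¬ Cong k y x`.
  outer-determines : ∀ {k x y z x′ y′ z′} → k ℕ.∣ v → ¬ Cong k y x → Cong k y y′ →
    Cong v (y ℤ.+ y) (x ℤ.+ z) → Cong v (y′ ℤ.+ y′) (x′ ℤ.+ z′) →
    exp x + exp y + exp z ≈ 0# → exp x′ + exp y′ + exp z′ ≈ 0# →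
    Cong v x x′ → Cong v y y′
  outer-determines {k} {x} {y} {z} {x′} {y′} k∣v y≢x yk p p′ total total′ x≡x′ with (y′ ℤ.- x′) Cong? (y ℤ.- x)
  ... | yes t≡t′ = combine₂ -1ℤ 1ℤ t≡t′ x≡x′ (eq x y x′ y′)
    where
    eq : ∀ x y x′ y′ → y ℤ.- y′ ≡ -1ℤ ℤ.* ((y′ ℤ.- x′) ℤ.- (y ℤ.- x)) ℤ.+ 1ℤ ℤ.* (x ℤ.- x′)
    eq = solve-∀
  ... | no  t≢t′ = contradiction (combine₃ -1ℤ -1ℤ 1ℤ (Cong-∣ k∣v square) yk (Cong-∣ k∣v x≡x′) (eq x y x′ y′)) y≢x
    where
    square : Cong v (y′ ℤ.- x′) ((y ℤ.- x) ℤ.+ (y ℤ.- x))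
    square = trinomial-roots (root p total) (root p′ total′) t≢t′
      where
      root : ∀ {x y z} → Cong v (y ℤ.+ y) (x ℤ.+ z) → exp x + exp y + exp z ≈ 0# → trinomial (y ℤ.- x) ≈ 0#
      root {x} p e = *-cancelˡ (exp≉0 x) (trans (sym (progression-sum p)) (trans e (sym (zeroʳ (exp x)))))
    eq : ∀ x y x′ y′ → y ℤ.- x ≡
      -1ℤ ℤ.* ((y′ ℤ.- x′) ℤ.- ((y ℤ.- x) ℤ.+ (y ℤ.- x))) ℤ.+ -1ℤ ℤ.* (y ℤ.- y′) ℤ.+ 1ℤ ℤ.* (x ℤ.- x′)
    eq = solve-∀

-- Blocks and the greedy choice

module _ {T : Set} {N : ℕ} (index : Fin N ↔ T) where
  open Inverse index

  index-any? : ∀ {p} {P : T → Set p} → (∀ t → Dec (P t)) → Dec (∃ P)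
  index-any? {P = P} P? = Dec.map′ (λ (i , p) → to i , p) (λ (t , p) → from t , ≡.subst P (≡.sym (strictlyInverseˡ t)) p)
    (Fin.any? (P? ∘ to))

  index-injective : ∀ {t t′} → from t ≡ from t′ → t ≡ t′
  index-injective {t} {t′} e = ≡.trans (≡.sym (strictlyInverseˡ t)) (≡.trans (≡.cong to e) (strictlyInverseˡ t′))

-- Pigeonhole: if every u met an event, choosing one for each u would inject `Fin w` into the N
-- indices.
avoid-events : ∀ {p} {T : Set} {N w : ℕ} → Fin N ↔ T → {P : Fin w → T → Set p} → (∀ u t → Dec (P u t)) →
               (∀ {u u′} t → P u t → P u′ t → u ≡ u′) → N ℕ.< w → ∃ λ u → ∀ t → ¬ P u t
avoid-events {w = w} index {P} P? unique N<w with Fin.any? (λ u → ¬? (index-any? index (P? u)))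
... | yes (u , none) = u , λ t p → none (t , p)
... | no  covered    = contradiction (Fin.injective⇒≤ event-injective) (ℕ.<⇒≱ N<w)
  where
  open Inverse index
  event : ∀ u → ∃ (P u)
  event u = decidable-stable (index-any? index (P? u)) (λ none → covered (u , none))
  event-injective : Injective _≡_ _≡_ (from ∘ proj₁ ∘ event)
  event-injective {u} {u′} e with t≡ ← index-injective index e =
    unique (proj₁ (event u)) (proj₂ (event u)) (≡.subst (P u′) (≡.sym t≡) (proj₂ (event u′)))

cons : ∀ {j} → ℤ → (Fin j → ℤ) → Fin (suc j) → ℤ
cons x c zero    = x
cons x c (suc i) = c i

Aligned : ∀ (k : ℕ) {j} → (Fin j → ℤ) → (Fin j → ℤ) → Set
Aligned k r x = ∀ a → Cong k (x a) (r a)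

Injective-mod : ∀ (k : ℕ) {j} → (Fin j → ℤ) → Set
Injective-mod k r = ∀ {a b} → Cong k (r a) (r b) → a ≡ b

aligned-injective : ∀ {k v} → k ℕ.∣ v → ∀ {j} {r x : Fin j → ℤ} → Injective-mod k r → Aligned k r x →
                    ∀ {a b} → Cong v (x a) (x b) → a ≡ b
aligned-injective k∣v r-inj x~r e = r-inj (Cong-trans (Cong-sym (x~r _)) (Cong-trans (Cong-∣ k∣v e) (x~r _)))

module _ (v : ℕ) where

  Sidon : ∀ {j} → (Fin j → ℤ) → Set
  Sidon x = ∀ a b a′ b′ → a ≢ b → a ≢ a′ → ¬ Cong v (x a ℤ.- x b) (x a′ ℤ.- x b′)

  negate : ∀ a b c d → Cong v (a ℤ.- b) (c ℤ.- d) → Cong v (b ℤ.- a) (d ℤ.- c)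
  negate a b c d e = combine₁ -1ℤ e (eq a b c d)
    where
    eq : ∀ a b c d → (b ℤ.- a) ℤ.- (d ℤ.- c) ≡ -1ℤ ℤ.* ((a ℤ.- b) ℤ.- (c ℤ.- d))
    eq = solve-∀

  -- The four inequalities are permuted by `reverse` and `exchange-pairs`, so any of the four
  -- positions can be brought to the front. The cases a = b′ and b = a′ remain possible; they are
  -- the progressions.
  record Quadruple {j} (x : Fin j → ℤ) (a b a′ b′ : Fin j) : Set where
    constructor quadruple
    field
      a≢b   : a ≢ b
      a≢a′  : a ≢ a′
      b≢b′  : b ≢ b′
      a′≢b′ : a′ ≢ b′
      equal : Cong v (x a ℤ.- x b) (x a′ ℤ.- x b′)

  module _ {j} {x : Fin j → ℤ} where

    quadruple? : ∀ a b a′ b′ → Dec (Quadruple x a b a′ b′)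
    quadruple? a b a′ b′ = Dec.map′
      (λ (p , r , s , t , e) → quadruple p r s t e)
      (λ (quadruple p r s t e) → p , r , s , t , e)
      (¬? (a Fin.≟ b) ×-dec ¬? (a Fin.≟ a′) ×-dec ¬? (b Fin.≟ b′) ×-dec ¬? (a′ Fin.≟ b′)
        ×-dec ((x a ℤ.- x b) Cong? (x a′ ℤ.- x b′)))

    reverse : ∀ {a b a′ b′} → Quadruple x a b a′ b′ → Quadruple x b a b′ a′
    reverse {a} {b} {a′} {b′} (quadruple p r s t e) =
      quadruple (p ∘ ≡.sym) s r (t ∘ ≡.sym) (negate (x a) (x b) (x a′) (x b′) e)

    exchange-pairs : ∀ {a b a′ b′} → Quadruple x a b a′ b′ → Quadruple x a′ b′ a b
    exchange-pairs (quadruple p r s t e) = quadruple t (r ∘ ≡.sym) (s ∘ ≡.sym) p (Cong-sym e)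

    -- Any member of a coincidence can be moved to its front.
    sidon-from : ∀ {k r} → k ℕ.∣ v → Injective-mod k r → Aligned k r x →
                 {S R : Fin j → Set} → (∀ a → S a ⊎ R a) →
                 (∀ {a b a′ b′} → S a → ¬ Quadruple x a b a′ b′) →
                 (∀ {a b a′ b′} → R a → R b → R a′ → R b′ → ¬ Quadruple x a b a′ b′) →
                 Sidon x
    sidon-from k∣v r-inj x~r split special rest a b a′ b′ a≢b a≢a′ e = go (split a) (split b) (split a′) (split b′)
      where
      eq₁ : ∀ a b c → a ℤ.- c ≡ 1ℤ ℤ.* ((a ℤ.- b) ℤ.- (c ℤ.- b))
      eq₁ = solve-∀
      eq₂ : ∀ a b c → a ℤ.- b ≡ 1ℤ ℤ.* ((a ℤ.- b) ℤ.- (c ℤ.- c))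
      eq₂ = solve-∀
      quad : Quadruple x a b a′ b′
      quad = quadruple a≢b a≢a′
        (λ { ≡.refl → a≢a′ (aligned-injective k∣v r-inj x~r (combine₁ 1ℤ e (eq₁ (x a) (x b) (x a′)))) })
        (λ { ≡.refl → a≢b (aligned-injective k∣v r-inj x~r (combine₁ 1ℤ e (eq₂ (x a) (x b) (x a′)))) }) e
      go : _ → _ → _ → _ → _
      go (inj₁ s) _ _ _ = special s quad
      go _ (inj₁ s) _ _ = special s (reverse quad)
      go _ _ (inj₁ s) _ = special s (exchange-pairs quad)
      go _ _ _ (inj₁ s) = special s (reverse (exchange-pairs quad))
      go (inj₂ p) (inj₂ r) (inj₂ s) (inj₂ t) = rest p r s t quad

module _ {c ℓ} {q : ℕ} (F : FiniteField c ℓ q) where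
  open FiniteField F hiding (zero)
  open Sum +-commutativeMonoid using (sum)

  -- There are j + 1 suffixes, the last of them empty with sum 0. Injectivity therefore also says
  -- that no nonempty suffix sums to 0.
  suffixSum : ∀ {j} → (Fin j → Carrier) → Fin (suc j) → Carrier
  suffixSum {_}     x zero    = sum x
  suffixSum {suc j} x (suc i) = suffixSum (x ∘ suc) i

  partialSum+suffixSum : ∀ {j} (x : Fin j → Carrier) i → partialSum F x i + suffixSum x (suc i) ≈ sum x
  partialSum+suffixSum x zero    = refl
  partialSum+suffixSum x (suc i) = trans (+-assoc _ _ _) (+-congˡ (partialSum+suffixSum (x ∘ suc) i))

-- Blocks are handled through the vectors of their logarithms.
module Blocks {c ℓ} {q : ℕ} {F : FiniteField c ℓ q} {k w v : ℕ} (v≡kw : v ≡ k ℕ.* w) (X : Exponential F v)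
              {n K : ℕ} (o : Fin n → Fin K → ℤ) where
  open FiniteField F hiding (zero)
  open FieldProperties F
  open Exponential X
  open Class k w v≡kw
  open Sum +-commutativeMonoid using (sum)

  Avoids : ∀ {j} → (Fin j → ℤ) → Set
  Avoids x = ∀ a b i a′ b′ → a ≢ b → ¬ Cong v (x a ℤ.- x b) (o i a′ ℤ.- o i b′)

  -- Distinctness is kept for suffix sums because a block grows at its front: a new entry adds one
  -- suffix sum and leaves the others alone, whereas it would shift every partial sum.
  record Good {j} (r x : Fin j → ℤ) : Set ℓ where
    field
      aligned        : Aligned k r x
      sidon          : Sidon v x
      avoids         : Avoids x
      suffix-distinct : Injective _≡_ _≈_ (suffixSum F (exp ∘ x))

  record NewBlock (r x : Fin K → ℤ) : Set ℓ where
    field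
      aligned          : Aligned k r x
      sidon            : Sidon v x
      avoids           : Avoids x
      sum≈0            : sum (exp ∘ x) ≈ 0#
      partial-distinct : Injective _≡_ _≈_ (partialSum F (exp ∘ x))

  module Extend .{{_ : ℕ.NonZero k}} {h : ℕ} (odd : v ≡ 1 ℕ.+ 2 ℕ.* h)
                {j} {r : Fin (suc j) → ℤ} (r-inj : Injective-mod k r)
                {c : Fin j → ℤ} (good : Good (r ∘ suc) c) where
    open Good good

    candidate : Fin w → Fin (suc j) → ℤ
    candidate u = cons (at (r zero) u) c

    Index : Set
    Index = (Fin j × Fin n × Fin K × Fin K) ⊎ (Fin (suc j) × Fin (suc j) × Fin (suc j)) ⊎ Fin (suc j)

    index : Fin (j ℕ.* (n ℕ.* (K ℕ.* K)) ℕ.+ (suc j ℕ.* (suc j ℕ.* suc j) ℕ.+ suc j)) ↔ Index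
    index = (((↔-id _ ×-↔ ((↔-id _ ×-↔ Fin.*↔×) ↔-∘ Fin.*↔×)) ↔-∘ Fin.*↔×)
             ⊎-↔ ((((↔-id _ ×-↔ Fin.*↔×) ↔-∘ Fin.*↔×) ⊎-↔ ↔-id _) ↔-∘ Fin.+↔⊎)) ↔-∘ Fin.+↔⊎

    Event : Fin w → Index → Set ℓ
    Event u (inj₁ (b , i , a′ , b′)) = Lift ℓ (Cong v (at (r zero) u ℤ.- c b) (o i a′ ℤ.- o i b′))
    Event u (inj₂ (inj₁ (b , a′ , b′))) = Lift ℓ (Quadruple v (candidate u) zero b a′ b′)
    Event u (inj₂ (inj₂ l)) = suffixSum F (exp ∘ candidate u) zero ≈ suffixSum F (exp ∘ c) l

    event? : ∀ u t → Dec (Event u t)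
    event? u (inj₁ _)        = Dec.map′ lift lower (_ Cong? _)
    event? u (inj₂ (inj₁ _)) = Dec.map′ lift lower (quadruple? v _ _ _ _)
    event? u (inj₂ (inj₂ _)) = _ ≈? _

    -- Each event is an equation in the new entry x alone. It is linear in the exponent with
    -- coefficient 1, except when x occurs on both sides of a coincidence: x - b = a′ - x fixes 2 x,
    -- which suffices as v is odd. An equality of suffix sums fixes `exp x`.
    event-unique : ∀ {u u′} t → Event u t → Event u′ t → u ≡ u′
    event-unique {u} {u′} (inj₁ (b , i , a′ , b′)) (lift e) (lift e′) =
      at-injective (r zero) (combine₂ 1ℤ -1ℤ e e′ (eq (at (r zero) u) (at (r zero) u′) (c b) (o i a′ ℤ.- o i b′)))
      where
      eq : ∀ x x′ c d → x ℤ.- x′ ≡ 1ℤ ℤ.* ((x ℤ.- c) ℤ.- d) ℤ.+ -1ℤ ℤ.* ((x′ ℤ.- c) ℤ.- d)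
      eq = solve-∀
    event-unique (inj₂ (inj₁ (zero , _ , _))) (lift e) _ = contradiction ≡.refl (Quadruple.a≢b e)
    event-unique (inj₂ (inj₁ (suc _ , zero , _))) (lift e) _ = contradiction ≡.refl (Quadruple.a≢a′ e)
    event-unique {u} {u′} (inj₂ (inj₁ (suc b , suc a′ , zero))) (lift e) (lift e′) =
      at-injective (r zero) (Cong-halve h odd (combine₂ 1ℤ -1ℤ (Quadruple.equal e) (Quadruple.equal e′)
        (eq (at (r zero) u) (at (r zero) u′) (c b) (c a′))))
      where
      eq : ∀ x x′ b a′ → (x ℤ.+ x) ℤ.- (x′ ℤ.+ x′) ≡
        1ℤ ℤ.* ((x ℤ.- b) ℤ.- (a′ ℤ.- x)) ℤ.+ -1ℤ ℤ.* ((x′ ℤ.- b) ℤ.- (a′ ℤ.- x′))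
      eq = solve-∀
    event-unique {u} {u′} (inj₂ (inj₁ (suc b , suc a′ , suc b′))) (lift e) (lift e′) =
      at-injective (r zero) (combine₂ 1ℤ -1ℤ (Quadruple.equal e) (Quadruple.equal e′)
        (eq (at (r zero) u) (at (r zero) u′) (c b) (c a′ ℤ.- c b′)))
      where
      eq : ∀ x x′ b d → x ℤ.- x′ ≡ 1ℤ ℤ.* ((x ℤ.- b) ℤ.- d) ℤ.+ -1ℤ ℤ.* ((x′ ℤ.- b) ℤ.- d)
      eq = solve-∀
    event-unique (inj₂ (inj₂ l)) e e′ = at-injective (r zero) (exp-injective (+-cancelʳ _ _ _ (trans e (sym e′))))

    extend : j ℕ.* (n ℕ.* (K ℕ.* K)) ℕ.+ (suc j ℕ.* (suc j ℕ.* suc j) ℕ.+ suc j) ℕ.< w → ∃ (Good r)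
    extend few with u , none ← avoid-events index event? event-unique few = candidate u , record
      { aligned = aligned′
      ; sidon   = sidon-from v k∣v r-inj aligned′ {S = λ a → zero ≡ a} {R = λ a → ∃ λ b → a ≡ suc b}
          (λ { zero → inj₁ ≡.refl ; (suc a) → inj₂ (a , ≡.refl) })
          (λ { {b = b} {a′ = a′} {b′ = b′} ≡.refl e → none (inj₂ (inj₁ (b , a′ , b′))) (lift e) })
          (λ { (a , ≡.refl) (b , ≡.refl) (a′ , ≡.refl) (b′ , ≡.refl) e →
             sidon a b a′ b′ (Quadruple.a≢b e ∘ ≡.cong suc) (Quadruple.a≢a′ e ∘ ≡.cong suc) (Quadruple.equal e) })
      ; avoids = avoids′
      ; suffix-distinct = distinct′
      }
      where
      aligned′ : Aligned k r (candidate u)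
      aligned′ zero    = at-class (r zero) u
      aligned′ (suc a) = aligned a
      avoids′ : Avoids (candidate u)
      avoids′ zero zero i _ _ a≢b _ = a≢b ≡.refl
      avoids′ zero (suc b) i a′ b′ _ e = none (inj₁ (b , i , a′ , b′)) (lift e)
      avoids′ (suc a) zero i a′ b′ _ e = none (inj₁ (a , i , b′ , a′))
        (lift (negate v (c a) (candidate u zero) (o i a′) (o i b′) e))
      avoids′ (suc a) (suc b) i a′ b′ a≢b e = avoids a b i a′ b′ (a≢b ∘ ≡.cong suc) e
      distinct′ : Injective _≡_ _≈_ (suffixSum F (exp ∘ candidate u))
      distinct′ {zero}  {zero}  _ = ≡.refl
      distinct′ {zero}  {suc l} e = contradiction e (none (inj₂ (inj₂ l)))
      distinct′ {suc l} {zero}  e = contradiction (sym e) (none (inj₂ (inj₂ l)))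
      distinct′ {suc l} {suc _} e = ≡.cong suc (suffix-distinct e)

  good-exists : .{{_ : ℕ.NonZero k}} → ∀ {h} → v ≡ 1 ℕ.+ 2 ℕ.* h →
                n ℕ.* (K ℕ.* K ℕ.* K) ℕ.+ (K ℕ.* (K ℕ.* K) ℕ.+ K) ℕ.< w →
                ∀ j → j ℕ.≤ K → (r : Fin j → ℤ) → Injective-mod k r → ∃ (Good r)
  good-exists odd few zero    _   r r-inj = r , record
    { aligned = λ () ; sidon = λ () ; avoids = λ ()
    ; suffix-distinct = λ { {zero} {zero} _ → ≡.refl } }
  good-exists {h} odd few (suc j) j<K r r-inj =
    Extend.extend {h} odd r-inj (proj₂ (good-exists {h} odd few j (ℕ.<⇒≤ j<K) (r ∘ suc) (Fin.suc-injective ∘ r-inj)))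
      (ℕ.≤-<-trans (ℕ.+-mono-≤
        (ℕ.≤-trans (ℕ.*-monoˡ-≤ (n ℕ.* (K ℕ.* K)) (ℕ.<⇒≤ j<K)) (ℕ.≤-reflexive (eq n K)))
        (ℕ.+-mono-≤ (ℕ.*-mono-≤ j<K (ℕ.*-mono-≤ j<K j<K)) j<K)) few)
    where
    eq : ∀ n K → K ℕ.* (n ℕ.* (K ℕ.* K)) ≡ n ℕ.* (K ℕ.* K ℕ.* K)
    eq = ℕ.solve-∀

-- The last three entries of a block

-- Again a record for the sake of unification.
record Balanced (v : ℕ) (a b a′ b′ : ℤ) : Set where
  constructor balanced
  field
    differences : Cong v (a ℤ.- b) (a′ ℤ.- b′)

quadruple-balanced : ∀ {v j} {x : Fin j → ℤ} {a b a′ b′} → Quadruple v x a b a′ b′ → Balanced v (x a) (x b) (x a′) (x b′)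
quadruple-balanced e = balanced (Quadruple.equal e)

-- The same coincidence is read in two triples and the two equations are subtracted, so that every
-- entry on which the triples agree drops out.
module Compare {v : ℕ} {a b a′ b′ a₁ b₁ a′₁ b′₁ : ℤ}
  (e : Balanced v a b a′ b′) (e₁ : Balanced v a₁ b₁ a′₁ b′₁) where

  difference : Cong v ((a ℤ.- a₁) ℤ.+ (b′ ℤ.- b′₁)) ((b ℤ.- b₁) ℤ.+ (a′ ℤ.- a′₁))
  difference = combine₂ 1ℤ -1ℤ (Balanced.differences e) (Balanced.differences e₁) (eq a b a′ b′ a₁ b₁ a′₁ b′₁)
    where
    eq : ∀ a b a′ b′ a₁ b₁ a′₁ b′₁ →
      ((a ℤ.- a₁) ℤ.+ (b′ ℤ.- b′₁)) ℤ.- ((b ℤ.- b₁) ℤ.+ (a′ ℤ.- a′₁)) ≡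
      1ℤ ℤ.* ((a ℤ.- b) ℤ.- (a′ ℤ.- b′)) ℤ.+ -1ℤ ℤ.* ((a₁ ℤ.- b₁) ℤ.- (a′₁ ℤ.- b′₁))
    eq = solve-∀

  determine-b : Cong v a a₁ → Cong v a′ a′₁ → Cong v b′ b′₁ → Cong v b b₁
  determine-b p r s = combine₂ -1ℤ 1ℤ difference known (eq a a₁ b b₁ a′ a′₁ b′ b′₁)
    where
    eq₁ : ∀ a a₁ a′ a′₁ b′ b′₁ → ((a ℤ.- a₁) ℤ.+ (b′ ℤ.- b′₁)) ℤ.- (a′ ℤ.- a′₁) ≡
      1ℤ ℤ.* (a ℤ.- a₁) ℤ.+ -1ℤ ℤ.* (a′ ℤ.- a′₁) ℤ.+ 1ℤ ℤ.* (b′ ℤ.- b′₁)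
    eq₁ = solve-∀
    eq : ∀ a a₁ b b₁ a′ a′₁ b′ b′₁ → b ℤ.- b₁ ≡
      -1ℤ ℤ.* (((a ℤ.- a₁) ℤ.+ (b′ ℤ.- b′₁)) ℤ.- ((b ℤ.- b₁) ℤ.+ (a′ ℤ.- a′₁))) ℤ.+
      1ℤ ℤ.* (((a ℤ.- a₁) ℤ.+ (b′ ℤ.- b′₁)) ℤ.- (a′ ℤ.- a′₁))
    eq = solve-∀
    known : Cong v ((a ℤ.- a₁) ℤ.+ (b′ ℤ.- b′₁)) (a′ ℤ.- a′₁)
    known = combine₃ 1ℤ -1ℤ 1ℤ p r s (eq₁ a a₁ a′ a′₁ b′ b′₁)

  double-b : a′ ≡ b → a′₁ ≡ b₁ → Cong v a a₁ → Cong v b′ b′₁ → Cong v (b ℤ.+ b) (b₁ ℤ.+ b₁)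
  double-b ≡.refl ≡.refl p s = combine₃ -1ℤ 1ℤ 1ℤ difference p s (eq a a₁ b b₁ b′ b′₁)
    where
    eq : ∀ a a₁ b b₁ b′ b′₁ → (b ℤ.+ b) ℤ.- (b₁ ℤ.+ b₁) ≡
      -1ℤ ℤ.* (((a ℤ.- a₁) ℤ.+ (b′ ℤ.- b′₁)) ℤ.- ((b ℤ.- b₁) ℤ.+ (b ℤ.- b₁))) ℤ.+
      1ℤ ℤ.* (a ℤ.- a₁) ℤ.+ 1ℤ ℤ.* (b′ ℤ.- b′₁)
    eq = solve-∀

module _ {v : ℕ} {a b a′ b′ : ℤ} where

  reverse-sides : Balanced v a b a′ b′ → Balanced v b a b′ a′
  reverse-sides (balanced e) = balanced (negate v a b a′ b′ e)

  exchange-sides : Balanced v a b a′ b′ → Balanced v a′ b′ a b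
  exchange-sides (balanced e) = balanced (Cong-sym e)

  transpose : Balanced v a b a′ b′ → Balanced v a a′ b b′
  transpose (balanced e) = balanced (combine₁ 1ℤ e (eq a b a′ b′))
    where
    eq : ∀ a b a′ b′ → (a ℤ.- a′) ℤ.- (b ℤ.- b′) ≡ 1ℤ ℤ.* ((a ℤ.- b) ℤ.- (a′ ℤ.- b′))
    eq = solve-∀

  cross-sums : Balanced v a b a′ b′ → Cong v (a ℤ.+ b′) (b ℤ.+ a′)
  cross-sums (balanced e) = combine₁ 1ℤ e (eq a b a′ b′)
    where
    eq : ∀ a b a′ b′ → (a ℤ.+ b′) ℤ.- (b ℤ.+ a′) ≡ 1ℤ ℤ.* ((a ℤ.- b) ℤ.- (a′ ℤ.- b′))
    eq = solve-∀

  cross-sums′ : Balanced v a b a′ b′ → Cong v (a ℤ.+ b′) (a′ ℤ.+ b)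
  cross-sums′ e = Cong-trans (cross-sums e) (Cong-reflexive (ℤ.+-comm b a′))

next : Fin 3 → Fin 3
next zero             = suc zero
next (suc zero)       = suc (suc zero)
next (suc (suc zero)) = zero

prev : Fin 3 → Fin 3
prev a = next (next a)

next-prev : ∀ a → next (prev a) ≡ a
next-prev zero             = ≡.refl
next-prev (suc zero)       = ≡.refl
next-prev (suc (suc zero)) = ≡.refl

next≢ : ∀ a → next a ≢ a
next≢ zero             ()
next≢ (suc zero)       ()
next≢ (suc (suc zero)) ()

module _ {m : ℕ} where

  free : Fin 3 → Fin (3 ℕ.+ m)
  free a = a ↑ˡ m

  -- Positions as seen from a. The cyclic symmetry of the three free positions lets one case
  -- analysis serve for every a.
  data View (a : Fin 3) : Fin (3 ℕ.+ m) → Set where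
    self : View a (free a)
    nxt  : View a (free (next a))
    prv  : View a (free (prev a))
    fix  : ∀ l → View a (3 ↑ʳ l)

  view : ∀ a p → View a p
  view zero             zero                = self
  view zero             (suc zero)          = nxt
  view zero             (suc (suc zero))    = prv
  view (suc zero)       zero                = prv
  view (suc zero)       (suc zero)          = self
  view (suc zero)       (suc (suc zero))    = nxt
  view (suc (suc zero)) zero                = nxt
  view (suc (suc zero)) (suc zero)          = prv
  view (suc (suc zero)) (suc (suc zero))    = self
  view zero             (suc (suc (suc l))) = fix l
  view (suc zero)       (suc (suc (suc l))) = fix l
  view (suc (suc zero)) (suc (suc (suc l))) = fix l

  -- The difference from a to prev a is the reverse of that from prev a to its next.
  target : Fin 3 → Fin (suc m) → Fin (3 ℕ.+ m)
  target a zero    = free (next a)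
  target a (suc l) = 3 ↑ʳ l

-- Blocks whose first three entries vary, with logarithms in the classes of
-- r modulo k, in front of the fixed entries c.
module Triples {c ℓ} {q : ℕ} {F : FiniteField c ℓ q} {m k w v : ℕ} .{{_ : ℕ.NonZero w}} .{{_ : ℕ.NonZero k}}
  (v≡kw : v ≡ k ℕ.* w) (X : Exponential F v) {h : ℕ} (odd : v ≡ 1 ℕ.+ 2 ℕ.* h)
  {n : ℕ} (o : Fin n → Fin (3 ℕ.+ m) → ℤ) {ρ : Fin (3 ℕ.+ m) → ℤ}
  (ρ-injective : Injective-mod k ρ) (o~ρ : ∀ i → Aligned k ρ (o i))
  {tail : Fin m → ℤ} (tail-good : Blocks.Good {k = k} {w = w} v≡kw X o (λ l → ρ (3 ↑ʳ l)) tail)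
  (r : Fin 3 → ℤ) (r~ρ : ∀ a → Cong k (r a) (ρ (free a))) where

  open FiniteField F hiding (zero)
  open FieldProperties F
  open Exponential X
  open ExponentialProperties X
  open Class k w v≡kw
  open Blocks {k = k} {w = w} v≡kw X o
  open Sum +-commutativeMonoid using (sum)
  open AbelianGroupProperties +-abelianGroup using (inverseˡ-unique)

  s : Carrier
  s = sum (exp ∘ tail)

  -- The order is y, x, z: the intercept of a line comes first and the remaining pair is a point of
  -- the plane, which matches a sum of incidences over the intercepts.
  Triple : Set
  Triple = Fin w × Fin w × Fin w

  coord : Triple → Fin 3 → Fin w
  coord (y , u , e) zero             = u
  coord (y , u , e) (suc zero)       = y
  coord (y , u , e) (suc (suc zero)) = e

  block : Triple → Fin (3 ℕ.+ m) → ℤ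
  block σ zero                = at (r zero) (coord σ zero)
  block σ (suc zero)          = at (r (suc zero)) (coord σ (suc zero))
  block σ (suc (suc zero))    = at (r (suc (suc zero))) (coord σ (suc (suc zero)))
  block σ (suc (suc (suc l))) = tail l

  entryAt : Triple → Fin 3 → ℤ
  entryAt σ a = block σ (free a)

  entryAt≡at : ∀ σ a → entryAt σ a ≡ at (r a) (coord σ a)
  entryAt≡at σ zero             = ≡.refl
  entryAt≡at σ (suc zero)       = ≡.refl
  entryAt≡at σ (suc (suc zero)) = ≡.refl

  block-aligned : ∀ σ → Aligned k ρ (block σ)
  block-aligned σ zero                = Cong-trans (at-class (r zero) (coord σ zero)) (r~ρ zero)
  block-aligned σ (suc zero)          = Cong-trans (at-class (r (suc zero)) (coord σ (suc zero))) (r~ρ (suc zero))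
  block-aligned σ (suc (suc zero))    = Cong-trans (at-class (r (suc (suc zero))) (coord σ (suc (suc zero)))) (r~ρ (suc (suc zero)))
  block-aligned σ (suc (suc (suc l))) = Good.aligned tail-good l

  Solution : Triple → Set ℓ
  Solution σ = sum (exp ∘ block σ) ≈ 0#

  Agree : Triple → Triple → Set
  Agree σ τ = ∀ a → Cong v (entryAt σ a) (entryAt τ a)

  agree⇒≡ : ∀ {σ τ} → Agree σ τ → σ ≡ τ
  agree⇒≡ {σ} {τ} agree = ≡.cong₂ _,_ (coord≡ (suc zero)) (≡.cong₂ _,_ (coord≡ zero) (coord≡ (suc (suc zero))))
    where
    coord≡ : ∀ a → coord σ a ≡ coord τ a
    coord≡ a = at-injective (r a) (Cong-trans (Cong-sym (Cong-reflexive (entryAt≡at σ a)))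
      (Cong-trans (agree a) (Cong-reflexive (entryAt≡at τ a))))

  coord⇒Cong : ∀ {σ τ} a → coord σ a ≡ coord τ a → Cong v (entryAt σ a) (entryAt τ a)
  coord⇒Cong {σ} {τ} a e = Cong-reflexive
    (≡.trans (entryAt≡at σ a) (≡.trans (≡.cong (at (r a)) e) (≡.sym (entryAt≡at τ a))))

  module _ where
    open SetoidReasoning setoid

    rotate : ∀ x y z → y + z + x ≈ x + y + z
    rotate x y z = trans (+-comm (y + z) x) (sym (+-assoc x y z))

    swapʳ : ∀ x y z → x + z + y ≈ x + y + z
    swapʳ x y z = trans (+-assoc x z y) (trans (+-congˡ (+-comm z y)) (sym (+-assoc x y z)))

    swapˡ : ∀ x y z → y + x + z ≈ x + y + z
    swapˡ x y z = +-congʳ (+-comm y x)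

    total : ∀ {σ} → Solution σ → ∀ a →
            exp (entryAt σ a) + exp (entryAt σ (next a)) + exp (entryAt σ (prev a)) ≈ - s
    total {σ} sol zero = inverseˡ-unique _ s (begin
      x + y + z + s     ≈⟨ +-assoc (x + y) z s ⟩
      x + y + (z + s)   ≈⟨ +-assoc x y (z + s) ⟩
      x + (y + (z + s)) ≈⟨ sol ⟩
      0#                ∎)
      where
      x = exp (entryAt σ zero)
      y = exp (entryAt σ (suc zero))
      z = exp (entryAt σ (suc (suc zero)))
    total {σ} sol (suc zero)       = trans (rotate _ _ _) (total {σ} sol zero)
    total {σ} sol (suc (suc zero)) = trans (sym (rotate _ _ _)) (total {σ} sol zero)

  agree-from : ∀ {σ τ} a → Cong v (entryAt σ a) (entryAt τ a) →
               Cong v (entryAt σ (next a)) (entryAt τ (next a)) →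
               Cong v (entryAt σ (prev a)) (entryAt τ (prev a)) → Agree σ τ
  agree-from zero             p r s zero             = p
  agree-from zero             p r s (suc zero)       = r
  agree-from zero             p r s (suc (suc zero)) = s
  agree-from (suc zero)       p r s zero             = s
  agree-from (suc zero)       p r s (suc zero)       = p
  agree-from (suc zero)       p r s (suc (suc zero)) = r
  agree-from (suc (suc zero)) p r s zero             = r
  agree-from (suc (suc zero)) p r s (suc zero)       = s
  agree-from (suc (suc zero)) p r s (suc (suc zero)) = p

  data Projection : Set where
    coordinate : Fin 3 → Projection
    ratio      : (y x : Fin 3) → Projection

  project : Projection → Triple → Fin w
  project (coordinate a) σ = coord σ a
  project (ratio y x)    σ = residue (+ toℕ (coord σ y) ℤ.- + toℕ (coord σ x))

  -- For three entries in progression, x + y + z = − s with y² = x z: the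
  -- ratio determines them unless s = 0, when x does.
  progression : Fin 3 → Fin 3 → Projection
  progression y x with s ≈? 0#
  ... | yes _ = coordinate x
  ... | no  _ = ratio y x

  -- The recorded coordinate is one that makes the event linear in a second entry. If `free a` is
  -- the only free entry involved, the event already fixes it, and the next one is recorded. In a -
  -- next = prev - f, where the field has a f = next · prev, recording a would leave two entries
  -- with known sum and product, a quadratic equation; recording next gives the situation of
  -- `product-determines`. The two ways to form a progression among the free entries go to
  -- `progression`.
  choose : ∀ a (β : Fin (suc m)) {a′ b′ : Fin (3 ℕ.+ m)} → View a a′ → View a b′ → Projection
  choose a (suc _) (fix _) (fix _) = coordinate (next a)
  choose a (suc _) (fix _) self    = coordinate (next a)
  choose a zero    prv     (fix _) = coordinate (next a)
  choose a zero    nxt     prv     = progression (next a) a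
  choose a zero    prv     self    = progression a (next a)
  choose a _       _       _       = coordinate a

  module _ {σ τ : Triple} (sol : Solution σ) (sol′ : Solution τ) where

    same-total : ∀ a → exp (entryAt σ a) + exp (entryAt σ (next a)) + exp (entryAt σ (prev a)) ≈
                       exp (entryAt τ a) + exp (entryAt τ (next a)) + exp (entryAt τ (prev a))
    same-total a = trans (total {σ} sol a) (sym (total {τ} sol′ a))

    agree-next : ∀ a → Cong v (entryAt σ a) (entryAt τ a) →
                 Cong v (entryAt σ (next a)) (entryAt τ (next a)) → Agree σ τ
    agree-next a p r = agree-from {σ} {τ} a p r (exp-injective (+-cancelˡ _ _ _
      (trans (same-total a) (+-congʳ (sym (+-cong (exp-cong p) (exp-cong r)))))))

    agree-prev : ∀ a → Cong v (entryAt σ a) (entryAt τ a) →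
                 Cong v (entryAt σ (prev a)) (entryAt τ (prev a)) → Agree σ τ
    agree-prev a p r = agree-next (prev a) r (≡.subst (λ b → Cong v (entryAt σ b) (entryAt τ b)) (≡.sym (next-prev a)) p)

    progression-determines : ∀ {y x z} → y ≢ x →
      Cong v (entryAt σ y ℤ.+ entryAt σ y) (entryAt σ x ℤ.+ entryAt σ z) →
      Cong v (entryAt τ y ℤ.+ entryAt τ y) (entryAt τ x ℤ.+ entryAt τ z) →
      exp (entryAt σ x) + exp (entryAt σ y) + exp (entryAt σ z) ≈ - s →
      exp (entryAt τ x) + exp (entryAt τ y) + exp (entryAt τ z) ≈ - s →
      project (progression y x) σ ≡ project (progression y x) τ →
      Cong v (entryAt σ x) (entryAt τ x) × Cong v (entryAt σ y) (entryAt τ y)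
    progression-determines {y} {x} {z} y≢x e e′ t t′ same with s ≈? 0#
    ... | yes s≈0 = x≡ , outer-determines k∣v
      (λ p → y≢x (Fin.↑ˡ-injective m y x (ρ-injective (Cong-trans (Cong-sym (block-aligned σ (free y))) (Cong-trans p (block-aligned σ (free x)))))))
      (Cong-trans (block-aligned σ (free y)) (Cong-sym (block-aligned τ (free y))))
      e e′ (trans t -s≈0) (trans t′ -s≈0) x≡
      where
      x≡ = coord⇒Cong {σ} {τ} x same
      -s≈0 : - s ≈ 0#
      -s≈0 = sym (inverseˡ-unique 0# s (trans (+-identityˡ s) s≈0))
    ... | no s≉0 = x≡ , combine₂ 1ℤ 1ℤ ratio≡ x≡ (eq (entryAt σ x) (entryAt σ y) (entryAt τ x) (entryAt τ y))
      where
      eq : ∀ x y x′ y′ → y ℤ.- y′ ≡ 1ℤ ℤ.* ((y ℤ.- x) ℤ.- (y′ ℤ.- x′)) ℤ.+ 1ℤ ℤ.* (x ℤ.- x′)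
      eq = solve-∀
      ratio-at : ∀ σ → entryAt σ y ℤ.- entryAt σ x ≡
                 (r y ℤ.- r x) ℤ.+ + k ℤ.* (+ toℕ (coord σ y) ℤ.- + toℕ (coord σ x))
      ratio-at σ = ≡.trans (≡.cong₂ ℤ._-_ (entryAt≡at σ y) (entryAt≡at σ x))
        (eq₁ (r y) (r x) (+ k) (+ toℕ (coord σ y)) (+ toℕ (coord σ x)))
        where
        eq₁ : ∀ r s k u u′ → (r ℤ.+ k ℤ.* u) ℤ.- (s ℤ.+ k ℤ.* u′) ≡ (r ℤ.- s) ℤ.+ k ℤ.* (u ℤ.- u′)
        eq₁ = solve-∀
      ratio≡ : Cong v (entryAt σ y ℤ.- entryAt σ x) (entryAt τ y ℤ.- entryAt τ x)
      ratio≡ = Cong-trans (Cong-reflexive (ratio-at σ)) (Cong-trans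
        (combine₁ 1ℤ (Cong-scale (residue-injective same)) (eq₂ (r y ℤ.- r x) _ _))
        (Cong-sym (Cong-reflexive (ratio-at τ))))
        where
        eq₂ : ∀ a x y → (a ℤ.+ x) ℤ.- (a ℤ.+ y) ≡ 1ℤ ℤ.* (x ℤ.- y)
        eq₂ = solve-∀
      x≡ = ratio-determines e e′ (trans t (sym t′))
        (λ t≈0 → s≉0 (trans (sym (-‿involutive s)) (trans (-‿cong (trans (sym t) t≈0)) -0≈0))) ratio≡
        where
        -0≈0 : - 0# ≈ 0#
        -0≈0 = sym (inverseˡ-unique 0# 0# (+-identityˡ 0#))
        open AbelianGroupProperties +-abelianGroup using () renaming (⁻¹-involutive to -‿involutive)

    -- Once two free entries agree, the common total gives the third. `Compare.determine-b` solves
    -- for the second slot of a coincidence only; `reverse-sides`, `exchange-sides` and `transpose`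
    -- bring the unknown entry into that slot.
    determined : ∀ a β {a′ b′} (α : View a a′) (γ : View a b′) →
      Quadruple v (block σ) (free a) (target a β) a′ b′ → Quadruple v (block τ) (free a) (target a β) a′ b′ →
      project (choose a β α γ) σ ≡ project (choose a β α γ) τ → Agree σ τ
    determined a β α γ e e′ = go β α γ (quadruple-balanced e) (quadruple-balanced e′)
      (Quadruple.a≢a′ e) (Quadruple.b≢b′ e) (Quadruple.a′≢b′ e)
      where
      A A′ N N′ P P′ : ℤ
      A  = entryAt σ a
      A′ = entryAt τ a
      N  = entryAt σ (next a)
      N′ = entryAt τ (next a)
      P  = entryAt σ (prev a)
      P′ = entryAt τ (prev a)
      same-a : coord σ a ≡ coord τ a → Cong v A A′
      same-a = coord⇒Cong {σ} {τ} a
      same-next : coord σ (next a) ≡ coord τ (next a) → Cong v N N′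
      same-next = coord⇒Cong {σ} {τ} (next a)
      total-APN : exp A + exp P + exp N ≈ exp A′ + exp P′ + exp N′
      total-APN = trans (swapʳ _ _ _) (trans (same-total a) (sym (swapʳ _ _ _)))
      total-NPA : exp N + exp P + exp A ≈ exp N′ + exp P′ + exp A′
      total-NPA = trans (rotate _ _ _) (trans (same-total a) (sym (rotate _ _ _)))
      halve : ∀ {x y} → Cong v (x ℤ.+ x) (y ℤ.+ y) → Cong v x y
      halve = Cong-halve h odd
      go : ∀ β {a′ b′} (α : View a a′) (γ : View a b′) →
        Balanced v A (block σ (target a β)) (block σ a′) (block σ b′) →
        Balanced v A′ (block τ (target a β)) (block τ a′) (block τ b′) →
        free a ≢ a′ → target a β ≢ b′ → a′ ≢ b′ →
        project (choose a β α γ) σ ≡ project (choose a β α γ) τ → Agree σ τ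
      go _       self    _       e e′ a≢ b≢ ≢b′ same = contradiction ≡.refl a≢
      go zero    _       nxt     e e′ a≢ b≢ ≢b′ same = contradiction ≡.refl b≢
      go _       nxt     nxt     e e′ a≢ b≢ ≢b′ same = contradiction ≡.refl ≢b′
      go _       prv     prv     e e′ a≢ b≢ ≢b′ same = contradiction ≡.refl ≢b′
      go (suc _) (fix _) (fix _) e e′ _ _ _ same = agree-next a
        (Compare.determine-b (reverse-sides e) (reverse-sides e′) Cong-refl Cong-refl Cong-refl) (same-next same)
      go (suc _) (fix _) self    e e′ _ _ _ same = agree-next a
        (halve (Compare.double-b (reverse-sides e) (reverse-sides e′) ≡.refl ≡.refl Cong-refl Cong-refl)) (same-next same)
      go (suc _) (fix _) nxt     e e′ _ _ _ same = agree-next a (same-a same)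
        (Compare.determine-b (exchange-sides e) (exchange-sides e′) Cong-refl (same-a same) Cong-refl)
      go (suc _) (fix _) prv     e e′ _ _ _ same = agree-prev a (same-a same)
        (Compare.determine-b (exchange-sides e) (exchange-sides e′) Cong-refl (same-a same) Cong-refl)
      go (suc _) nxt     (fix _) e e′ _ _ _ same = agree-next a (same-a same)
        (Compare.determine-b (transpose e) (transpose e′) (same-a same) Cong-refl Cong-refl)
      go (suc _) nxt     self    e e′ _ _ _ same = agree-next a (same-a same)
        (Compare.determine-b (transpose e) (transpose e′) (same-a same) Cong-refl (same-a same))
      go (suc _) nxt     prv     e e′ _ _ _ same = agree-prev a (same-a same)
        (product-determines (cross-sums′ e) (cross-sums′ e′) total-APN (same-a same))
      go (suc _) prv     (fix _) e e′ _ _ _ same = agree-prev a (same-a same)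
        (Compare.determine-b (transpose e) (transpose e′) (same-a same) Cong-refl Cong-refl)
      go (suc _) prv     self    e e′ _ _ _ same = agree-prev a (same-a same)
        (Compare.determine-b (transpose e) (transpose e′) (same-a same) Cong-refl (same-a same))
      go (suc _) prv     nxt     e e′ _ _ _ same = agree-next a (same-a same)
        (product-determines (cross-sums′ e) (cross-sums′ e′) (same-total a) (same-a same))
      go zero    (fix _) (fix _) e e′ _ _ _ same = agree-next a (same-a same)
        (Compare.determine-b e e′ (same-a same) Cong-refl Cong-refl)
      go zero    (fix _) self    e e′ _ _ _ same = agree-next a (same-a same)
        (Compare.determine-b e e′ (same-a same) Cong-refl (same-a same))
      go zero    (fix _) prv     e e′ _ _ _ same = agree-prev a (same-a same)
        (product-determines (cross-sums e) (cross-sums e′) total-APN (same-a same))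
      go zero    nxt     (fix _) e e′ _ _ _ same = agree-next a (same-a same)
        (halve (Compare.double-b e e′ ≡.refl ≡.refl (same-a same) Cong-refl))
      go zero    nxt     self    e e′ _ _ _ same = agree-next a (same-a same)
        (halve (Compare.double-b e e′ ≡.refl ≡.refl (same-a same) (same-a same)))
      go zero    nxt     prv     e e′ _ _ _ same =
        let A≡ , N≡ = progression-determines {z = prev a} (next≢ a) (Cong-sym (cross-sums e)) (Cong-sym (cross-sums e′))
                        (total {σ} sol a) (total {τ} sol′ a) same
        in agree-next a A≡ N≡
      go zero    prv     (fix _) e e′ _ _ _ same = agree-next (next a) (same-next same)
        (product-determines (Cong-sym (cross-sums e)) (Cong-sym (cross-sums e′)) total-NPA (same-next same))
      go zero    prv     self    e e′ _ _ _ same =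
        let N≡ , A≡ = progression-determines {z = prev a} (next≢ a ∘ ≡.sym) (cross-sums e) (cross-sums e′)
                        (trans (swapˡ _ _ _) (total {σ} sol a)) (trans (swapˡ _ _ _) (total {τ} sol′ a)) same
        in agree-next a A≡ N≡

  -- Since k divides v, a coincidence can be read modulo k, where each logarithm becomes the class
  -- of its position. So a, b and a′ determine b′ whatever the actual entries are.
  partner : ∀ {x y : Fin (3 ℕ.+ m) → ℤ} → Aligned k ρ x → Aligned k ρ y → ∀ a b a′ b′ →
            Cong v (x a ℤ.- x b) (y a′ ℤ.- y b′) → Cong k (ρ b′) (ρ a′ ℤ.- (ρ a ℤ.- ρ b))
  partner {x} {y} x~ρ y~ρ a b a′ b′ e = Cong-trans
    (combine₂ -1ℤ 1ℤ (y~ρ b′) (Cong-∣ k∣v e) (eq₁ (ρ b′) (x a) (x b) (y a′) (y b′)))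
    (combine₃ 1ℤ -1ℤ 1ℤ (y~ρ a′) (x~ρ a) (x~ρ b) (eq₂ (x a) (x b) (y a′) (ρ a) (ρ b) (ρ a′)))
    where
    eq₁ : ∀ r x x₁ y y₁ → r ℤ.- (y ℤ.- (x ℤ.- x₁)) ≡ -1ℤ ℤ.* (y₁ ℤ.- r) ℤ.+ 1ℤ ℤ.* ((x ℤ.- x₁) ℤ.- (y ℤ.- y₁))
    eq₁ = solve-∀
    eq₂ : ∀ x x₁ y r r₁ r′ → (y ℤ.- (x ℤ.- x₁)) ℤ.- (r′ ℤ.- (r ℤ.- r₁)) ≡
          1ℤ ℤ.* (y ℤ.- r′) ℤ.+ -1ℤ ℤ.* (x ℤ.- r) ℤ.+ 1ℤ ℤ.* (x₁ ℤ.- r₁)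
    eq₂ = solve-∀

  -- The m + 1 = k - 2 values of β serve twice. With a they list each pair of positions that
  -- contains a free one, once up to order; with `Fin 2` they list the suffixes of the tail, the
  -- empty one included, that the suffix from z or the suffix from y could equal.
  Index : Set
  Index = Fin (suc m) × ((Fin 3 × Fin (suc n) × Fin (3 ℕ.+ m)) ⊎ Fin 2)

  index : Fin (suc m ℕ.* (3 ℕ.* (suc n ℕ.* (3 ℕ.+ m)) ℕ.+ 2)) ↔ Index
  index = (↔-id _ ×-↔ ((((↔-id _ ×-↔ Fin.*↔×) ↔-∘ Fin.*↔×) ⊎-↔ ↔-id _) ↔-∘ Fin.+↔⊎)) ↔-∘ Fin.*↔×

  -- The new block counts as one more of the old ones, with index zero.
  Clash : Triple → Fin 3 → Fin (suc m) → Fin (suc n) → (a′ b′ : Fin (3 ℕ.+ m)) → Set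
  Clash σ a β zero    a′ b′ = Quadruple v (block σ) (free a) (target a β) a′ b′
  Clash σ a β (suc i) a′ b′ = Cong v (block σ (free a) ℤ.- block σ (target a β)) (o i a′ ℤ.- o i b′)

  Event : Triple → Index → Set ℓ
  Event σ (β , inj₁ (a , i , a′))  = Lift ℓ (∃ λ b′ → Clash σ a β i a′ b′)
  Event σ (β , inj₂ zero)          = suffixSum F (exp ∘ block σ) (suc (suc zero)) ≈ suffixSum F (exp ∘ tail) β
  Event σ (β , inj₂ (suc _))       = suffixSum F (exp ∘ block σ) (suc zero) ≈ suffixSum F (exp ∘ tail) β

  clash? : ∀ σ a β i a′ b′ → Dec (Clash σ a β i a′ b′)
  clash? σ a β zero    a′ b′ = quadruple? v (free a) (target a β) a′ b′
  clash? σ a β (suc i) a′ b′ = _ Cong? _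

  event? : ∀ σ t → Dec (Event σ t)
  event? σ (β , inj₁ (a , i , a′)) = Dec.map′ lift lower (Fin.any? (clash? σ a β i a′))
  event? σ (β , inj₂ zero)         = _ ≈? _
  event? σ (β , inj₂ (suc _))      = _ ≈? _

  clash-partner : ∀ σ a β i a′ b′ → Clash σ a β i a′ b′ → Cong k (ρ b′) (ρ a′ ℤ.- (ρ (free a) ℤ.- ρ (target a β)))
  clash-partner σ a β zero    a′ b′ e = partner (block-aligned σ) (block-aligned σ) (free a) (target a β) a′ b′ (Quadruple.equal e)
  clash-partner σ a β (suc i) a′ b′ e = partner (block-aligned σ) (o~ρ i) (free a) (target a β) a′ b′ e

  -- A difference between a free entry and a tail entry that equals an old difference fixes the free
  -- entry, so the next one is recorded. The suffix from z fixes z, and x is recorded. The suffix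
  -- from y fixes x because the whole block sums to 0, and y is recorded.
  projection : ∀ σ t → Event σ t → Fin w
  projection σ (β     , inj₁ (a , zero  , a′)) (lift (b′ , _)) = project (choose a β (view a a′) (view a b′)) σ
  projection σ (zero  , inj₁ (a , suc i , a′)) _ = coord σ a
  projection σ (suc l , inj₁ (a , suc i , a′)) _ = coord σ (next a)
  projection σ (β     , inj₂ zero)             _ = coord σ zero
  projection σ (β     , inj₂ (suc _))          _ = coord σ (suc zero)

  event-determines : ∀ {σ τ} → Solution σ → Solution τ → ∀ t (e : Event σ t) (e′ : Event τ t) →
                     projection σ t e ≡ projection τ t e′ → Agree σ τ
  event-determines {σ} {τ} sol sol′ (β , inj₁ (a , zero , a′)) (lift (b′ , e)) (lift (b″ , e′)) same =
    -- Each triple brings its own witness, b′ or b″. They must be identified through their classes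
    -- before the two projections can be taken as the same one.
    unify (ρ-injective (Cong-trans (clash-partner σ a β zero a′ b′ e) (Cong-sym (clash-partner τ a β zero a′ b″ e′)))) e′ same
    where
    unify : ∀ {b″} → b′ ≡ b″ → Clash τ a β zero a′ b″ →
      project (choose a β (view a a′) (view a b′)) σ ≡ project (choose a β (view a a′) (view a b″)) τ → Agree σ τ
    unify ≡.refl e′ same = determined sol sol′ a β (view a a′) (view a b′) e e′ same
  event-determines {σ} {τ} sol sol′ (zero , inj₁ (a , suc i , a′)) (lift (b′ , e)) (lift (b″ , e′)) same =
    agree-next sol sol′ a A≡ (unify (ρ-injective (Cong-trans (clash-partner σ a zero (suc i) a′ b′ e)
      (Cong-sym (clash-partner τ a zero (suc i) a′ b″ e′)))) e′)
    where
    A≡ = coord⇒Cong {σ} {τ} a same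
    unify : ∀ {b″} → b′ ≡ b″ → Clash τ a zero (suc i) a′ b″ → Cong v (entryAt σ (next a)) (entryAt τ (next a))
    unify ≡.refl e′ = Compare.determine-b (balanced {a′ = o i a′} {b′ = o i b′} e) (balanced e′) A≡ Cong-refl Cong-refl
  event-determines {σ} {τ} sol sol′ (suc l , inj₁ (a , suc i , a′)) (lift (b′ , e)) (lift (b″ , e′)) same =
    agree-next sol sol′ a (unify (ρ-injective (Cong-trans (clash-partner σ a (suc l) (suc i) a′ b′ e)
      (Cong-sym (clash-partner τ a (suc l) (suc i) a′ b″ e′)))) e′) (coord⇒Cong {σ} {τ} (next a) same)
    where
    unify : ∀ {b″} → b′ ≡ b″ → Clash τ a (suc l) (suc i) a′ b″ → Cong v (entryAt σ a) (entryAt τ a)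
    unify ≡.refl e′ = Compare.determine-b (reverse-sides (balanced {b = tail l} {a′ = o i a′} {b′ = o i b′} e))
      (reverse-sides (balanced {b = tail l} e′)) Cong-refl Cong-refl Cong-refl
  event-determines {σ} {τ} sol sol′ (β , inj₂ zero) e e′ same =
    agree-prev sol sol′ zero (coord⇒Cong {σ} {τ} zero same) (exp-injective (+-cancelʳ s _ _ (trans e (sym e′))))
  event-determines {σ} {τ} sol sol′ (β , inj₂ (suc _)) e e′ same =
    agree-next sol sol′ zero (exp-injective (+-cancelʳ _ _ _ (trans sol (trans (sym sol′) (+-congˡ (trans e′ (sym e)))))))
      (coord⇒Cong {σ} {τ} (suc zero) same)

  triples : List Triple
  triples = cartesianProduct (allFin w) (cartesianProduct (allFin w) (allFin w))

  solution? : ∀ σ → Dec (Solution σ)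
  solution? σ = _ ≈? _

  few-solutions : (∀ σ → Solution σ → ∃ (Event σ)) →
    ∑ triples (λ σ → 𝟙 (solution? σ)) ℤ.≤ + ((suc m ℕ.* (3 ℕ.* (suc n ℕ.* (3 ℕ.+ m)) ℕ.+ 2)) ℕ.* w)
  few-solutions event = count-injection solution? _
    (Unique.cartesianProduct⁺ (Unique.allFin⁺ w) (Unique.cartesianProduct⁺ (Unique.allFin⁺ w) (Unique.allFin⁺ w)))
    (λ {σ} _ sol → code (event σ sol))
    (λ {σ} {τ} _ _ sol sol′ same → agree⇒≡ {σ} {τ} (decode sol sol′ (event σ sol) (event τ sol′) same))
    where
    code : ∀ {σ} → ∃ (Event σ) → Fin ((suc m ℕ.* (3 ℕ.* (suc n ℕ.* (3 ℕ.+ m)) ℕ.+ 2)) ℕ.* w)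
    code {σ} (t , e) = combine (Inverse.from index t) (projection σ t e)
    decode : ∀ {σ τ} → Solution σ → Solution τ → (e : ∃ (Event σ)) (e′ : ∃ (Event τ)) → code e ≡ code e′ → Agree σ τ
    decode {σ} {τ} sol sol′ (t , e) (t′ , e′) same
      with i≡ , p≡ ← Fin.combine-injective (Inverse.from index t) (projection σ t e) (Inverse.from index t′) (projection τ t′ e′) same = unify (index-injective index {t} {t′} i≡) e′ p≡
      where
      unify : ∀ {t′} → t ≡ t′ → (e′ : Event τ t′) → projection σ t e ≡ projection τ t′ e′ → Agree σ τ
      unify ≡.refl e′ = event-determines sol sol′ t e e′

  record Complete (x : Fin (3 ℕ.+ m) → ℤ) : Set ℓ where
    field
      aligned         : Aligned k ρ x
      sidon           : Sidon v x
      avoids          : Avoids x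
      sum≈0           : sum (exp ∘ x) ≈ 0#
      suffix-distinct : Injective _≡_ _≈_ (suffixSum F (exp ∘ x ∘ suc))

  complete : ∀ σ → Solution σ → (∀ t → ¬ Event σ t) → Complete (block σ)
  complete σ sol none = record
    { aligned         = block-aligned σ
    ; sidon           = sidon-from v k∣v ρ-injective (block-aligned σ) split
        (λ { {b = b} (a , ≡.refl) e → special a (view a b) e })
        (λ { (a , ≡.refl) (b , ≡.refl) (a′ , ≡.refl) (b′ , ≡.refl) e →
             Good.sidon tail-good a b a′ b′ (Quadruple.a≢b e ∘ ≡.cong (3 ↑ʳ_)) (Quadruple.a≢a′ e ∘ ≡.cong (3 ↑ʳ_)) (Quadruple.equal e) })
    ; avoids          = avoids
    ; sum≈0           = sol
    ; suffix-distinct = distinct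
    }
    where
    open Good tail-good using () renaming (suffix-distinct to tail-distinct)
    split : ∀ p → (∃ λ a → p ≡ free a) ⊎ (∃ λ l → p ≡ 3 ↑ʳ l)
    split zero                = inj₁ (zero , ≡.refl)
    split (suc zero)          = inj₁ (suc zero , ≡.refl)
    split (suc (suc zero))    = inj₁ (suc (suc zero) , ≡.refl)
    split (suc (suc (suc l))) = inj₂ (l , ≡.refl)
    special : ∀ a {b a′ b′} → View a b → ¬ Quadruple v (block σ) (free a) b a′ b′
    special a {a′ = a′} {b′} self    e = Quadruple.a≢b e ≡.refl
    special a {a′ = a′} {b′} nxt     e = none (zero , inj₁ (a , zero , a′)) (lift (b′ , e))
    special a {a′ = a′} {b′} (fix l) e = none (suc l , inj₁ (a , zero , a′)) (lift (b′ , e))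
    special a {a′ = a′} {b′} prv     e = none (zero , inj₁ (prev a , zero , b′)) (lift (a′ ,
      ≡.subst (λ z → Quadruple v (block σ) (free (prev a)) (free z) b′ a′) (≡.sym (next-prev a)) (reverse v e)))
    old : ∀ a i {b} a′ b′ → free a ≢ b → View a b → ¬ Cong v (block σ (free a) ℤ.- block σ b) (o i a′ ℤ.- o i b′)
    old a i a′ b′ a≢b self    e = a≢b ≡.refl
    old a i a′ b′ a≢b nxt     e = none (zero , inj₁ (a , suc i , a′)) (lift (b′ , e))
    old a i a′ b′ a≢b (fix l) e = none (suc l , inj₁ (a , suc i , a′)) (lift (b′ , e))
    old a i a′ b′ a≢b prv     e = none (zero , inj₁ (prev a , suc i , b′)) (lift (a′ ,
      ≡.subst (λ z → Cong v (entryAt σ (prev a) ℤ.- entryAt σ z) (o i b′ ℤ.- o i a′)) (≡.sym (next-prev a))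
        (negate v (entryAt σ a) (entryAt σ (prev a)) (o i a′) (o i b′) e)))
    avoids : Avoids (block σ)
    avoids a b i a′ b′ a≢b e with split a | split b
    ... | inj₁ (a , ≡.refl) | _ = old a i a′ b′ a≢b (view a b) e
    ... | inj₂ _ | inj₁ (b , ≡.refl) = old b i b′ a′ (a≢b ∘ ≡.sym) (view b a)
      (negate v (block σ a) (entryAt σ b) (o i a′) (o i b′) e)
    ... | inj₂ (a , ≡.refl) | inj₂ (b , ≡.refl) = Good.avoids tail-good a b i a′ b′ (a≢b ∘ ≡.cong (3 ↑ʳ_)) e
    -- The two suffixes that start at y and at z differ by this entry, so keeping them apart costs
    -- no event.
    y≉0 = exp≉0 (entryAt σ (suc zero))
    distinct : Injective _≡_ _≈_ (suffixSum F (exp ∘ block σ ∘ suc))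
    distinct {zero}        {zero}        e = ≡.refl
    distinct {zero}        {suc zero}    e = contradiction (+-cancelʳ _ _ _ (trans e (sym (+-identityˡ _)))) y≉0
    distinct {zero}        {suc (suc l)} e = contradiction e (none (l , inj₂ (suc zero)))
    distinct {suc zero}    {zero}        e = contradiction (+-cancelʳ _ _ _ (trans (sym e) (sym (+-identityˡ _)))) y≉0
    distinct {suc zero}    {suc zero}    e = ≡.refl
    distinct {suc zero}    {suc (suc l)} e = contradiction e (none (l , inj₂ zero))
    distinct {suc (suc l)} {zero}        e = contradiction (sym e) (none (l , inj₂ (suc zero)))
    distinct {suc (suc l)} {suc zero}    e = contradiction (sym e) (none (l , inj₂ zero))
    distinct {suc (suc l)} {suc (suc l′)} e = ≡.cong (λ i → suc (suc i)) (tail-distinct {l} {l′} e)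

  complete-or-few : ∃ Complete ⊎
    ∑ triples (λ σ → 𝟙 (solution? σ)) ℤ.≤ + ((suc m ℕ.* (3 ℕ.* (suc n ℕ.* (3 ℕ.+ m)) ℕ.+ 2)) ℕ.* w)
  complete-or-few with index-any? ((↔-id _ ×-↔ Fin.*↔×) ↔-∘ Fin.*↔×) (λ σ → solution? σ ×-dec ¬? (index-any? index (event? σ)))
  ... | yes (σ , sol , none) = inj₁ (block σ , complete σ sol (λ t e → none (t , e)))
  ... | no  covered          = inj₂ (few-solutions (λ σ sol → decidable-stable (index-any? index (event? σ))
                                 (λ none → covered (σ , sol , none))))

-- Existence of a new block

any-or-all : ∀ {n p r} {P : Set p} {Q : Fin n → Set r} → (∀ i → P ⊎ Q i) → P ⊎ (∀ i → Q i)
any-or-all {zero}  f = inj₂ (λ ())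
any-or-all {suc n} f with f zero | any-or-all (f ∘ suc)
... | inj₁ p | _      = inj₁ p
... | inj₂ _ | inj₁ p = inj₁ p
... | inj₂ r | inj₂ s = inj₂ (λ { zero → r ; (suc i) → s i })

room-for-tail : ∀ {k n w} → 3 ℕ.≤ k → 4 ℕ.* (k ℕ.* k ℕ.* k ℕ.* k) ℕ.* suc n ℕ.≤ w →
                n ℕ.* (k ℕ.* k ℕ.* k) ℕ.+ (k ℕ.* (k ℕ.* k) ℕ.+ k) ℕ.< w
room-for-tail {k@(suc _)} {n} {w} 3≤k 4k⁴n≤w = begin-strict
  n ℕ.* (k ℕ.* k ℕ.* k) ℕ.+ (k ℕ.* (k ℕ.* k) ℕ.+ k)   ≤⟨ ℕ.+-monoʳ-≤ (n ℕ.* (k ℕ.* k ℕ.* k)) (ℕ.+-monoʳ-≤ (k ℕ.* (k ℕ.* k)) k≤k³) ⟩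
  n ℕ.* (k ℕ.* k ℕ.* k) ℕ.+ (k ℕ.* (k ℕ.* k) ℕ.+ k ℕ.* (k ℕ.* k))
                                                        ≤⟨ ℕ.m≤m+n _ (n ℕ.* (k ℕ.* k ℕ.* k)) ⟩
  n ℕ.* (k ℕ.* k ℕ.* k) ℕ.+ (k ℕ.* (k ℕ.* k) ℕ.+ k ℕ.* (k ℕ.* k)) ℕ.+ n ℕ.* (k ℕ.* k ℕ.* k)
                                                        ≡⟨ eq₁ k n ⟩
  2 ℕ.* (k ℕ.* k ℕ.* k ℕ.* suc n)                       <⟨ ℕ.*-monoˡ-< (k ℕ.* k ℕ.* k ℕ.* suc n) {{nonZero}} {2} {4 ℕ.* k}
                                                             (ℕ.≤-trans (ℕ.s≤s (ℕ.s≤s (ℕ.s≤s ℕ.z≤n))) (ℕ.≤-trans 3≤k (ℕ.m≤m+n k _))) ⟩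
  4 ℕ.* k ℕ.* (k ℕ.* k ℕ.* k ℕ.* suc n)                 ≡⟨ eq₂ k (suc n) ⟩
  4 ℕ.* (k ℕ.* k ℕ.* k ℕ.* k) ℕ.* suc n                 ≤⟨ 4k⁴n≤w ⟩
  w                                                     ∎
  where
  open ℕ.≤-Reasoning
  k≤k³ : k ℕ.≤ k ℕ.* (k ℕ.* k)
  k≤k³ = ℕ.m≤m*n k (k ℕ.* k)
  nonZero : ℕ.NonZero (k ℕ.* k ℕ.* k ℕ.* suc n)
  nonZero = ℕ.m*n≢0 (k ℕ.* k ℕ.* k) (suc n)
  eq₁ : ∀ k n → n ℕ.* (k ℕ.* k ℕ.* k) ℕ.+ (k ℕ.* (k ℕ.* k) ℕ.+ k ℕ.* (k ℕ.* k)) ℕ.+ n ℕ.* (k ℕ.* k ℕ.* k) ≡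
        2 ℕ.* (k ℕ.* k ℕ.* k ℕ.* (1 ℕ.+ n))
  eq₁ = ℕ.solve-∀
  eq₂ : ∀ k n → 4 ℕ.* k ℕ.* (k ℕ.* k ℕ.* k ℕ.* n) ≡ 4 ℕ.* (k ℕ.* k ℕ.* k ℕ.* k) ℕ.* n
  eq₂ = ℕ.solve-∀

module Completion {c ℓ} {q : ℕ} {F : FiniteField c ℓ q} {m k w v : ℕ} .{{_ : ℕ.NonZero w}} .{{_ : ℕ.NonZero k}}
  (k≡ : k ≡ 3 ℕ.+ m) (v≡kw : v ≡ k ℕ.* w) (q≡ : q ≡ 1 ℕ.+ 2 ℕ.* (k ℕ.* w))
  (X : Exponential F v) {h : ℕ} (odd : v ≡ 1 ℕ.+ 2 ℕ.* h)
  {n : ℕ} (4k⁴n≤w : 4 ℕ.* (k ℕ.* k ℕ.* k ℕ.* k) ℕ.* suc n ℕ.≤ w) (o : Fin n → Fin (3 ℕ.+ m) → ℤ)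
  {ρ : Fin (3 ℕ.+ m) → ℤ} (ρ-injective : Injective-mod k ρ) (o~ρ : ∀ i → Aligned k ρ (o i)) where

  open FiniteField F hiding (zero)
  open FieldProperties F
  open Exponential X
  open Class k w v≡kw
  open Sum +-commutativeMonoid using (sum)
  open AbelianGroupProperties +-abelianGroup using (⁻¹-injective)

  B r : ℕ
  B = suc m ℕ.* (3 ℕ.* (suc n ℕ.* (3 ℕ.+ m)) ℕ.+ 2)
  r = 5 ℕ.+ 2 ℕ.* m

  16B≤7k³n : 16 ℕ.* B ℕ.≤ 7 ℕ.* (k ℕ.* k ℕ.* k) ℕ.* suc n
  16B≤7k³n = ≡.subst (λ κ → 16 ℕ.* (suc m ℕ.* (3 ℕ.* (suc n ℕ.* κ) ℕ.+ 2)) ℕ.≤ 7 ℕ.* (k ℕ.* k ℕ.* k) ℕ.* suc n) k≡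
    (events-bound m n {k} {suc n} {suc m} k≡ ≡.refl ≡.refl)

  open Discrepancy m {k} {r} {suc n} {B} {w} {q} k≡ ≡.refl (ℕ.s≤s ℕ.z≤n) 16B≤7k³n 4k⁴n≤w q≡

  gap : ℕ
  gap = w ℕ.* w ℕ.∸ q ℕ.* B

  w²≡ : w ℕ.* w ≡ q ℕ.* B ℕ.+ gap
  w²≡ = ≡.sym (ℕ.m+[n∸m]≡n qB≤w²)

  q-w : + q ℤ.- + w ≡ + (r ℕ.* w ℕ.+ 1)
  q-w = ≡.trans (≡.cong (λ z → + z ℤ.- + w) q≡w+) (≡.trans (≡.cong (ℤ._- + w) (ℤ.pos-+ w (r ℕ.* w ℕ.+ 1))) (eq (+ w) (+ (r ℕ.* w ℕ.+ 1))))
    where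
    eq : ∀ x y → x ℤ.+ y ℤ.- x ≡ y
    eq = solve-∀
    eqℕ : ∀ m w → 1 ℕ.+ 2 ℕ.* ((3 ℕ.+ m) ℕ.* w) ≡ w ℕ.+ ((5 ℕ.+ 2 ℕ.* m) ℕ.* w ℕ.+ 1)
    eqℕ = ℕ.solve-∀
    q≡w+ : q ≡ w ℕ.+ (r ℕ.* w ℕ.+ 1)
    q≡w+ = ≡.trans q≡ (≡.trans (≡.cong (λ κ → 1 ℕ.+ 2 ℕ.* (κ ℕ.* w)) k≡) (eqℕ m w))

  module _ {tail : Fin m → ℤ}
           (tail-good : Blocks.Good {k = k} {w = w} v≡kw X o (λ l → ρ (3 ↑ʳ l)) tail) where

    -- Varying e moves the representative for z inside one class modulo k. The admissible entries z
    -- stay the same modulo v, but in the plane e becomes the slope, which provides w slopes to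
    -- average over.
    classes : Fin w → Fin 3 → ℤ
    classes e zero             = ρ zero
    classes e (suc zero)       = ρ (suc zero)
    classes e (suc (suc zero)) = at (ρ (suc (suc zero))) e

    classes~ρ : ∀ e a → Cong k (classes e a) (ρ (free a))
    classes~ρ e zero             = Cong-refl
    classes~ρ e (suc zero)       = Cong-refl
    classes~ρ e (suc (suc zero)) = at-class (ρ (suc (suc zero))) e

    module T (e : Fin w) = Triples {m = m} {k = k} {w = w} v≡kw X {h} odd o {ρ} ρ-injective o~ρ {tail} tail-good (classes e) (classes~ρ e)

    Complete : (Fin (3 ℕ.+ m) → ℤ) → Set ℓ
    Complete x = Σ (Fin w) λ e → T.Complete e x

    s : Carrier
    s = sum (exp ∘ tail)

    -- With z = `g-at e * d-at e′`, the equation x + y + z = - s says that the point (`d-at e′`, x)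
    -- lies on the line of slope `g-at e` and intercept `h-at y`. The values of `d-at` form the
    -- subgroup of order w.
    x-at d-at g-at h-at : Fin w → Carrier
    x-at u = exp (at (ρ zero) u)
    d-at e = exp (at 0ℤ e)
    g-at e = exp (at (ρ (suc (suc zero))) e)
    h-at y = - (exp (at (ρ (suc zero)) y) + s)

    module I = Incidence F x-at d-at (at-injective (ρ zero) ∘ exp-injective) (at-injective 0ℤ ∘ exp-injective)

    incidence⇒solution : ∀ e y u e′ → I.value (g-at e) (u , e′) ≈ h-at y → T.Solution e (y , u , e′)
    incidence⇒solution e y u e′ inc = begin
      X₀ + (Y + (Z + s))                 ≈⟨ +-congˡ (+-congˡ (+-congʳ Z≈)) ⟩
      X₀ + (Y + (g-at e * d-at e′ + s))  ≈⟨ +-congˡ (trans (sym (+-assoc _ _ _)) (trans (+-congʳ (+-comm _ _)) (+-assoc _ _ _))) ⟩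
      X₀ + (g-at e * d-at e′ + (Y + s))  ≈⟨ +-assoc _ _ _ ⟨
      X₀ + g-at e * d-at e′ + (Y + s)    ≈⟨ +-congʳ inc ⟩
      - (Y + s) + (Y + s)                ≈⟨ -‿inverseˡ _ ⟩
      0#                                 ∎
      where
      open SetoidReasoning setoid
      X₀ = x-at u
      Y = exp (at (ρ (suc zero)) y)
      Z = exp (at (at (ρ (suc (suc zero))) e) e′)
      eq : ∀ r z → r ℤ.+ z ≡ r ℤ.+ (0ℤ ℤ.+ z)
      eq = solve-∀
      Z≈ : Z ≈ g-at e * d-at e′
      Z≈ = trans (exp-cong (Cong-reflexive (eq (at (ρ (suc (suc zero))) e) (+ k ℤ.* + toℕ e′)))) (exp-+ _ _)

    -- After cancelling w², `few-incidences` bounds the square of the gap from above by q² (q - w),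
    -- which is what `q²[q-w]<gap²` contradicts.
    not-few : ¬ (∀ e → ∑ (T.triples e) (λ σ → 𝟙 (T.solution? e σ)) ℤ.≤ + (B ℕ.* w))
    not-few few = ℕ.<⇒≱ (q²[q-w]<gap² w²≡) (ℤ.drop‿+≤+ (≡.subst₂ ℤ._≤_ (≡.sym (ℤ.pos-* gap gap)) qq
      (ℤ.*-cancelˡ-≤-pos (sq (+ gap)) (sq (+ q) ℤ.* (+ q ℤ.- + w)) (sq (+ w)) {{positive}}
        (I.few-incidences g-at h-at (at-injective (ρ (suc (suc zero))) ∘ exp-injective)
          (λ e → at-injective (ρ (suc zero)) (exp-injective (+-cancelʳ s _ _ (⁻¹-injective e)))) {B} {gap} w²≡
          (λ e → ℤ.≤-trans (few′ e) (few e))))))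
      where
      positive : ℤ.Positive (sq (+ w))
      positive = ≡.subst ℤ.Positive (ℤ.pos-* w w) (ℤ.positive (ℤ.+<+ (ℕ.>-nonZero⁻¹ (w ℕ.* w) {{ℕ.m*n≢0 w w}})))
      qq : sq (+ q) ℤ.* (+ q ℤ.- + w) ≡ + (q ℕ.* q ℕ.* (r ℕ.* w ℕ.+ 1))
      qq = ≡.trans (≡.cong₂ ℤ._*_ (≡.sym (ℤ.pos-* q q)) q-w) (≡.sym (ℤ.pos-* (q ℕ.* q) (r ℕ.* w ℕ.+ 1)))
      few′ : ∀ e → ∑ (allFin w) (λ y → I.incidences (g-at e) (h-at y)) ℤ.≤ ∑ (T.triples e) (λ σ → 𝟙 (T.solution? e σ))
      few′ e = ≡.subst (∑ (allFin w) (λ y → I.incidences (g-at e) (h-at y)) ℤ.≤_)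
        (≡.sym (∑-cartesianProduct (allFin w) I.points (λ σ → 𝟙 (T.solution? e σ))))
        (∑-mono (allFin w) (λ y → ∑-mono I.points (λ (u , e′) →
          𝟙-mono (I.value (g-at e) (u , e′) ≈? h-at y) (T.solution? e (y , u , e′)) (incidence⇒solution e y u e′))))

    completion : ∃ Complete
    completion with any-or-all (λ e → complete-or-few e)
      where
      complete-or-few : ∀ e → ∃ Complete ⊎ ∑ (T.triples e) (λ σ → 𝟙 (T.solution? e σ)) ℤ.≤ + (B ℕ.* w)
      complete-or-few e with T.complete-or-few e
      ... | inj₁ (x , x-complete) = inj₁ (x , e , x-complete)
      ... | inj₂ few              = inj₂ few
    ... | inj₁ done = done
    ... | inj₂ few  = contradiction few not-few

  newBlock : ∃ (Blocks.NewBlock {k = k} {w = w} v≡kw X o ρ)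
  newBlock
    with tail , tail-good ← Blocks.good-exists {k = k} {w = w} v≡kw X o {h} odd
           (≡.subst (λ K → n ℕ.* (K ℕ.* K ℕ.* K) ℕ.+ (K ℕ.* (K ℕ.* K) ℕ.+ K) ℕ.< w) k≡ (room-for-tail {k} {n} 3≤k 4k⁴n≤w))
           m (ℕ.m≤n+m m 3) (λ l → ρ (3 ↑ʳ l)) (λ p → Fin.↑ʳ-injective 3 _ _ (ρ-injective p))
    with x , e , x-complete ← completion tail-good
    = x , record
      { aligned          = aligned x-complete
      ; sidon            = sidon x-complete
      ; avoids           = avoids x-complete
      ; sum≈0            = sum≈0 x-complete
      ; partial-distinct = partial-distinct
      }
    where
    open Triples.Complete
    partial-distinct : Injective _≡_ _≈_ (partialSum F (exp ∘ x))
    partial-distinct {i} {j} p≈ = suffix-distinct x-complete (+-cancelˡ _ _ _ (begin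
      partialSum F (exp ∘ x) i + suffixSum F (exp ∘ x) (suc i) ≈⟨ partialSum+suffixSum F (exp ∘ x) i ⟩
      sum (exp ∘ x)                                            ≈⟨ partialSum+suffixSum F (exp ∘ x) j ⟨
      partialSum F (exp ∘ x) j + suffixSum F (exp ∘ x) (suc j) ≈⟨ +-congʳ p≈ ⟨
      partialSum F (exp ∘ x) i + suffixSum F (exp ∘ x) (suc j) ∎))
      where open SetoidReasoning setoid

-- Assembling the packing

module Families {c ℓ} {q : ℕ} {F : FiniteField c ℓ q} {v : ℕ} (X : Exponential F v) (k : ℕ) where
  open FiniteField F using (Carrier; _≈_; 0#; +-commutativeMonoid)
  open Exponential X
  open Sum +-commutativeMonoid using (sum)

  record Family {n K : ℕ} (o : Fin n → Fin K → ℤ) : Set ℓ where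
    field
      aligned  : ∀ i → Aligned k (+_ ∘ toℕ) (o i)
      distinct : ∀ i j a b a′ b′ → a ≢ b → Cong v (o i a ℤ.- o i b) (o j a′ ℤ.- o j b′) → i ≡ j × a ≡ a′
      sum≈0    : ∀ i → sum (exp ∘ o i) ≈ 0#
      partial  : ∀ i → Injective _≡_ _≈_ (partialSum F (exp ∘ o i))

  add : ∀ {n K : ℕ} → (Fin K → ℤ) → (Fin n → Fin K → ℤ) → Fin (suc n) → Fin K → ℤ
  add x o zero    = x
  add x o (suc i) = o i

  module _ {m w : ℕ} .{{_ : ℕ.NonZero w}} .{{_ : ℕ.NonZero k}} (k≡ : k ≡ 3 ℕ.+ m)
           (v≡kw : v ≡ k ℕ.* w) (q≡ : q ≡ 1 ℕ.+ 2 ℕ.* (k ℕ.* w)) {h : ℕ} (odd : v ≡ 1 ℕ.+ 2 ℕ.* h) where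

    positions-injective : Injective-mod k {3 ℕ.+ m} (+_ ∘ toℕ)
    positions-injective {a} {b} e = Cong-toℕ-injective (≡.subst (λ κ → Cong κ (+ toℕ a) (+ toℕ b)) k≡ e)

    add-block : ∀ {n} {o : Fin n → Fin (3 ℕ.+ m) → ℤ} → Family o →
                ∃ (Blocks.NewBlock {k = k} {w = w} v≡kw X o (+_ ∘ toℕ)) →
                ∃ λ (o : Fin (suc n) → Fin (3 ℕ.+ m) → ℤ) → Family o
    add-block {o = o} family (x , x-new) = add x o , record
      { aligned  = λ { zero → new.aligned ; (suc i) → Family.aligned family i }
      ; distinct = distinct′
      ; sum≈0    = λ { zero → new.sum≈0 ; (suc i) → Family.sum≈0 family i }
      ; partial  = λ { zero → new.partial-distinct ; (suc i) → Family.partial family i }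
      }
      where
      module new = Blocks.NewBlock x-new
      distinct′ : ∀ i j a b a′ b′ → a ≢ b → Cong v (add x o i a ℤ.- add x o i b) (add x o j a′ ℤ.- add x o j b′) → i ≡ j × a ≡ a′
      distinct′ zero zero a b a′ b′ a≢b e with a Fin.≟ a′
      ... | yes a≡a′ = ≡.refl , a≡a′
      ... | no  a≢a′ = contradiction e (new.sidon a b a′ b′ a≢b a≢a′)
      distinct′ zero (suc j) a b a′ b′ a≢b e = contradiction e (new.avoids a b j a′ b′ a≢b)
      -- `avoids` speaks of a difference of the new block, so a′ ≢ b′ has to be recovered: otherwise
      -- the old difference would be 0, and the entries of an old block are distinct modulo v.
      distinct′ (suc i) zero a b a′ b′ a≢b e = contradiction (Cong-sym e) (new.avoids a′ b′ i a b a′≢b′)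
        where
        eq : ∀ x y z → x ℤ.- y ≡ 1ℤ ℤ.* ((x ℤ.- y) ℤ.- (z ℤ.- z))
        eq = solve-∀
        a′≢b′ : a′ ≢ b′
        a′≢b′ ≡.refl = a≢b (aligned-injective (Class.k∣v k w v≡kw) positions-injective (Family.aligned family i)
          (combine₁ 1ℤ e (eq (o i a) (o i b) (x a′))))
      distinct′ (suc i) (suc j) a b a′ b′ a≢b e =
        let i≡j , a≡a′ = Family.distinct family i j a b a′ b′ a≢b e in ≡.cong suc i≡j , a≡a′

    family-exists : ∀ n → 4 ℕ.* (k ℕ.* k ℕ.* k ℕ.* k) ℕ.* n ℕ.≤ w → ∃ λ (o : Fin n → Fin (3 ℕ.+ m) → ℤ) → Family o
    family-exists zero    _ = (λ ()) , record
      { aligned = λ () ; distinct = λ () ; sum≈0 = λ () ; partial = λ () }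
    family-exists (suc n) 4k⁴n≤w =
      extend (family-exists n (ℕ.≤-trans (ℕ.*-monoʳ-≤ (4 ℕ.* (k ℕ.* k ℕ.* k ℕ.* k)) (ℕ.n≤1+n n)) 4k⁴n≤w))
      where
      extend : (∃ λ (o : Fin n → Fin (3 ℕ.+ m) → ℤ) → Family o) → ∃ λ (o : Fin (suc n) → Fin (3 ℕ.+ m) → ℤ) → Family o
      extend (o , family) = add-block family (Completion.newBlock {m = m} {k = k} {w = w} k≡ v≡kw q≡ X {h} odd {n}
        4k⁴n≤w o {+_ ∘ toℕ} positions-injective (Family.aligned family))

-- The exponential inverse to the logarithm, and -1 as a nonsquare

module _ {c ℓ} {q : ℕ} (F : FiniteField c ℓ q) where
  open FiniteField F hiding (zero)
  open FieldProperties F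

  -- In characteristic 2 every element is its own negative, so squaring is injective.
  square-injective : 1# + 1# ≈ 0# → ∀ {x y} → x * x ≈ y * y → x ≈ y
  square-injective 1+1≈0 {x} {y} x²≈y² with x ≈? y
  ... | yes x≈y = x≈y
  ... | no  x≉y = exchange x≉y (trans (+-congʳ x²≈y²) (trans (double≈0 (y * y))
    (sym (trans (+-congˡ (*-comm y x)) (double≈0 (x * y))))))
    where
    double≈0 : ∀ z → z + z ≈ 0#
    double≈0 z = trans (+-cong (sym (*-identityʳ z)) (sym (*-identityʳ z)))
      (trans (sym (distribˡ z 1# 1#)) (trans (*-congˡ 1+1≈0) (zeroʳ z)))

  module _ (φ : AbelianGroup.Carrier (Squares F) → ℤ) (iso : LogIsomorphism F φ) where

    private
      v = half q
      module φ = GroupMorphisms.IsGroupIsomorphism iso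
      open AbelianGroup (Squares F) using () renaming (Carrier to Square; _∙_ to _⊗_)

    element : ℤ → Square
    element i = proj₁ (φ.surjective i)

    log-element : ∀ i → Cong v (φ (element i)) i
    log-element i = ⟨ proj₂ (φ.surjective i) {element i} refl ⟩

    φ-injective : ∀ x y → Cong v (φ x) (φ y) → proj₁ x ≈ proj₁ y
    φ-injective x y ⟨ p ⟩ = φ.injective {x} {y} p

    φ-cong : ∀ x y → proj₁ x ≈ proj₁ y → Cong v (φ x) (φ y)
    φ-cong x y p = ⟨ φ.⟦⟧-cong {x} {y} p ⟩

    exp₀ : ℤ → Carrier
    exp₀ i = proj₁ (element i)

    exp₀-cong : ∀ {i j} → Cong v i j → exp₀ i ≈ exp₀ j
    exp₀-cong {i} {j} p = φ-injective (element i) (element j)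
      (Cong-trans (log-element i) (Cong-trans p (Cong-sym (log-element j))))

    exp₀-injective : ∀ {i j} → exp₀ i ≈ exp₀ j → Cong v i j
    exp₀-injective {i} {j} p = Cong-trans (Cong-sym (log-element i))
      (Cong-trans (φ-cong (element i) (element j) p) (log-element j))

    exp₀-+ : ∀ i j → exp₀ (i ℤ.+ j) ≈ exp₀ i * exp₀ j
    exp₀-+ i j = φ-injective (element (i ℤ.+ j)) (element i ⊗ element j) (Cong-trans (log-element (i ℤ.+ j))
      (Cong-trans (combine₂ -1ℤ -1ℤ (log-element i) (log-element j) (eq i j (φ (element i)) (φ (element j))))
        (Cong-sym ⟨ φ.∙-homo (element i) (element j) ⟩)))
      where
      eq : ∀ i j x y → (i ℤ.+ j) ℤ.- (x ℤ.+ y) ≡ -1ℤ ℤ.* (x ℤ.- i) ℤ.+ -1ℤ ℤ.* (y ℤ.- j)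
      eq = solve-∀

    module _ .{{_ : ℕ.NonZero v}} (q≡ : q ≡ 1 ℕ.+ 2 ℕ.* v) {h : ℕ} (odd : v ≡ 1 ℕ.+ 2 ℕ.* h) where

      -- In characteristic 2 squaring would be injective, so the logarithms of the squares would
      -- embed the nonzero elements in ℤ/v. With one more code for 0 this gives q ≤ v + 1, against q
      -- = 1 + 2 v.
      1+1≉0 : ¬ 1# + 1# ≈ 0#
      1+1≉0 1+1≈0 = ℕ.<⇒≱ v<2v (ℕ.s≤s⁻¹ (≡.subst (ℕ._≤ suc v) q≡ (Fin.injective⇒≤ code-injective)))
        where
        square : ∀ x → ¬ x ≈ 0# → Square
        square x x≉0 = x * x , (λ x²≈0 → x≉0 (*-cancelˡ x≉0 (trans x²≈0 (sym (zeroʳ x))))) , x , refl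
        code′ : ∀ x → Dec (x ≈ 0#) → Fin (suc v)
        code′ x (yes _)   = zero
        code′ x (no x≉0) = suc (residue (φ (square x x≉0)))
        code : Fin q → Fin (suc v)
        code i = code′ (from i) (from i ≈? 0#)
        code′-injective : ∀ x y dx dy → code′ x dx ≡ code′ y dy → x ≈ y
        code′-injective x y (yes x≈0) (yes y≈0) _ = trans x≈0 (sym y≈0)
        code′-injective x y (no x≉0) (no y≉0) e = square-injective 1+1≈0
          (φ-injective (square x x≉0) (square y y≉0) (residue-injective (Fin.suc-injective e)))
        code-injective : Injective _≡_ _≡_ code
        code-injective {i} {j} e = ≡.trans (≡.sym (strictlyInverseˡ i)) (≡.trans
          (to-cong (code′-injective (from i) (from j) (from i ≈? 0#) (from j ≈? 0#) e)) (strictlyInverseˡ j))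
        v<2v : v ℕ.< 2 ℕ.* v
        v<2v = ℕ.m<m+n v (≡.subst (0 ℕ.<_) (≡.sym (ℕ.+-identityʳ v)) (ℕ.>-nonZero⁻¹ v))

      exponential : Exponential F v
      exponential = record
        { exp           = exp₀
        ; exp-cong      = exp₀-cong
        ; exp-injective = exp₀-injective
        ; exp-+         = exp₀-+
        ; exp≉0         = λ i → proj₁ (proj₂ (element i))
        ; exp+exp≉0     = opposite
        }
        where
        open RingProperties ring using (-‿distribˡ-*; -‿involutive)
        open AbelianGroupProperties +-abelianGroup using (inverseˡ-unique)
        -- If exp i = − exp j then both have the same square, so i ≡ j since v is odd.
        opposite : ∀ i j → ¬ exp₀ i + exp₀ j ≈ 0#
        opposite i j e = 1+1≉0 (*-cancelˡ (proj₁ (proj₂ (element i))) (begin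
          exp₀ i * (1# + 1#)          ≈⟨ distribˡ (exp₀ i) 1# 1# ⟩
          exp₀ i * 1# + exp₀ i * 1#   ≈⟨ +-cong (*-identityʳ (exp₀ i)) (*-identityʳ (exp₀ i)) ⟩
          exp₀ i + exp₀ i             ≈⟨ +-congˡ (exp₀-cong i≡j) ⟩
          exp₀ i + exp₀ j             ≈⟨ e ⟩
          0#                          ≈⟨ zeroʳ (exp₀ i) ⟨
          exp₀ i * 0#                 ∎))
          where
          open SetoidReasoning setoid
          x≈-y : exp₀ i ≈ - exp₀ j
          x≈-y = inverseˡ-unique (exp₀ i) (exp₀ j) e
          i≡j : Cong v i j
          i≡j = Cong-halve h odd (exp₀-injective (begin
            exp₀ (i ℤ.+ i)            ≈⟨ exp₀-+ i i ⟩
            exp₀ i * exp₀ i           ≈⟨ *-cong x≈-y x≈-y ⟩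
            - exp₀ j * - exp₀ j       ≈⟨ -‿distribˡ-* (exp₀ j) (- exp₀ j) ⟨
            - (exp₀ j * - exp₀ j)     ≈⟨ -‿cong (-‿distribʳ-* (exp₀ j) (exp₀ j)) ⟨
            - - (exp₀ j * exp₀ j)     ≈⟨ -‿involutive (exp₀ j * exp₀ j) ⟩
            exp₀ j * exp₀ j           ≈⟨ exp₀-+ j j ⟨
            exp₀ (j ℤ.+ j)            ∎))

-- Arithmetic of q, and the passage from logarithms to the packing

open import Data.Nat.Base using (_+_; _*_; _^_; _≤_; _<_)
open import Data.Nat.Divisibility using (_∣_)

not-even : ∀ k → ¬ 2 ∣ k → ∃ λ h → k ≡ 1 + 2 * h
not-even zero          odd = contradiction (2 ℕ.∣0) odd
not-even (suc zero)    odd = 0 , ≡.refl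
not-even (suc (suc k)) odd with h , ≡.refl ← not-even k (odd ∘ ℕ.∣m∣n⇒∣m+n ℕ.∣-refl) = suc h , eq h
  where
  eq : ∀ h → 2 + (1 + 2 * h) ≡ 1 + 2 * (1 + h)
  eq = ℕ.solve-∀

odd*odd : ∀ g h → ∃ λ f → (1 + 2 * g) * (1 + 2 * h) ≡ 1 + 2 * f
odd*odd g h = g + h + 2 * (g * h) , eq g h
  where
  eq : ∀ g h → (1 + 2 * g) * (1 + 2 * h) ≡ 1 + 2 * (g + h + 2 * (g * h))
  eq = ℕ.solve-∀

-- The residue 2 k + 1 modulo 4 k makes (q - 1) / 2 equal to k times an odd number, the order w of
-- the subgroup. A congruence of integers also allows a negative quotient; it would give 4 k ≤ 2 k +
-- 1.
cofactor : ∀ {k q} → 1 ≤ k → + q ≡ + (2 * k + 1) [mod 4 * k ] → ∃ λ t → q ≡ 1 + 2 * (k * (1 + 2 * t))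
cofactor {k} {q} 1≤k (ℤ.divides (+ t) e) = t , ≡.trans (ℤ.+-injective (begin
  + q                                         ≡⟨ add-back (+ q) (+ (2 * k + 1)) ⟩
  (+ q ℤ.- + (2 * k + 1)) ℤ.+ + (2 * k + 1)   ≡⟨ ≡.cong (ℤ._+ + (2 * k + 1)) e ⟩
  + t ℤ.* + (4 * k) ℤ.+ + (2 * k + 1)         ≡⟨ ≡.cong (ℤ._+ + (2 * k + 1)) (ℤ.pos-* t (4 * k)) ⟨
  + (t * (4 * k)) ℤ.+ + (2 * k + 1)           ≡⟨ ℤ.pos-+ (t * (4 * k)) (2 * k + 1) ⟨
  + (t * (4 * k) + (2 * k + 1))               ∎)) (eq t k)
  where
  open ≡.≡-Reasoning
  add-back : ∀ x y → x ≡ (x ℤ.- y) ℤ.+ y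
  add-back = solve-∀
  eq : ∀ t k → t * (4 * k) + (2 * k + 1) ≡ 1 + 2 * (k * (1 + 2 * t))
  eq = ℕ.solve-∀
cofactor {k} {q} 1≤k (ℤ.divides ℤ.-[1+ t ] e) = contradiction (≡.subst (_≤ 2 * k + 1) (eq k) (begin
  4 * k                   ≤⟨ ℕ.m≤m+n (4 * k) (t * (4 * k)) ⟩
  suc t * (4 * k)         ≤⟨ ℕ.m≤n+m (suc t * (4 * k)) q ⟩
  q + suc t * (4 * k)     ≡⟨ q+ ⟩
  2 * k + 1               ∎)) (ℕ.<⇒≱ (ℕ.+-monoʳ-< (2 * k) (ℕ.*-mono-≤ {2} {2} ℕ.≤-refl 1≤k)))
  where
  open ℕ.≤-Reasoning
  eq : ∀ k → 4 * k ≡ 2 * k + 2 * k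
  eq = ℕ.solve-∀
  move : ∀ x y s d → x ℤ.- y ≡ ℤ.- s ℤ.* d → x ℤ.+ s ℤ.* d ≡ y
  move x y s d e = ≡.trans (rearrange x y s d) (≡.trans (≡.cong (λ z → z ℤ.+ y ℤ.+ s ℤ.* d) e) (cancel y s d))
    where
    rearrange : ∀ x y s d → x ℤ.+ s ℤ.* d ≡ (x ℤ.- y) ℤ.+ y ℤ.+ s ℤ.* d
    rearrange = solve-∀
    cancel : ∀ y s d → ℤ.- s ℤ.* d ℤ.+ y ℤ.+ s ℤ.* d ≡ y
    cancel = solve-∀
  q+ : q + suc t * (4 * k) ≡ 2 * k + 1
  q+ = ℤ.+-injective (≡.trans (ℤ.pos-+ q (suc t * (4 * k))) (≡.trans (≡.cong (ℤ._+_ (+ q)) (ℤ.pos-* (suc t) (4 * k)))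
    (move (+ q) (+ (2 * k + 1)) (+ suc t) (+ (4 * k)) e)))

cofactor-bound : ∀ {k n q w} .{{_ : ℕ.NonZero k}} → q ≡ 1 + 2 * (k * w) → 8 * k ^ 5 * n < q →
                 4 * (k * k * k * k) * n ≤ w
cofactor-bound {k} {n} {q} {w} q≡ 8k⁵n<q = ℕ.*-cancelˡ-≤ k (ℕ.*-cancelˡ-≤ 2 (≡.subst (_≤ 2 * (k * w)) (eq k n)
  (ℕ.s≤s⁻¹ (≡.subst (8 * k ^ 5 * n <_) q≡ 8k⁵n<q))))
  where
  eq : ∀ k n → 8 * (k * (k * (k * (k * (k * 1))))) * n ≡ 2 * (k * (4 * (k * k * k * k) * n))
  eq = ℕ.solve-∀

half-odd : ∀ {q x} → q ≡ 1 + 2 * x → half q ≡ x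
half-odd {x = x} ≡.refl = ≡.trans (≡.cong (ℕ._/ 2) (ℕ.*-comm 2 x)) (ℕ.m*n/n≡m x 2)

module Assembly {c ℓ} {k n q : ℕ} (F : FiniteField c ℓ q) (φ : AbelianGroup.Carrier (Squares F) → ℤ)
  (iso : LogIsomorphism F φ) .{{_ : ℕ.NonZero (half q)}} (q≡ : q ≡ 1 ℕ.+ 2 ℕ.* half q)
  {h : ℕ} (odd : half q ≡ 1 ℕ.+ 2 ℕ.* h) (k∣v : k ∣ half q) (o : Fin n → Fin k → ℤ)
  (family : Families.Family (exponential F φ iso q≡ {h} odd) k o) where

  open FiniteField F hiding (zero)
  open FieldProperties F
  open Families.Family family

  private
    v = half q

  position-injective : ∀ {i a b} → Cong k (o i a) (o i b) → a ≡ b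
  position-injective {i} p = Cong-toℕ-injective (Cong-trans (Cong-sym (aligned i _)) (Cong-trans p (aligned i _)))

  block : Fin n → SquareSubset F k
  block i = record
    { element  = λ a → element F φ iso (o i a)
    ; distinct = λ p → position-injective (Cong-∣ k∣v (exp₀-injective F φ iso p))
    }

  log : ∀ i a → Cong v (φ (element F φ iso (o i a))) (o i a)
  log i a = log-element F φ iso (o i a)

  log-difference : ∀ i j {a b a′ b′} →
    Cong v (φ (element F φ iso (o i a)) ℤ.- φ (element F φ iso (o i b)))
           (φ (element F φ iso (o j a′)) ℤ.- φ (element F φ iso (o j b′))) →
    Cong v (o i a ℤ.- o i b) (o j a′ ℤ.- o j b′)
  log-difference i j {a} {b} {a′} {b′} p = Cong-trans (differ i a b) (Cong-trans p (Cong-sym (differ j a′ b′)))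
    where
    eq : ∀ x x′ y y′ → (x ℤ.- y) ℤ.- (x′ ℤ.- y′) ≡ -1ℤ ℤ.* (x′ ℤ.- x) ℤ.+ 1ℤ ℤ.* (y′ ℤ.- y)
    eq = solve-∀
    differ : ∀ i a b → Cong v (o i a ℤ.- o i b) (φ (element F φ iso (o i a)) ℤ.- φ (element F φ iso (o i b)))
    differ i a b = combine₂ -1ℤ 1ℤ (log i a) (log i b)
      (eq (o i a) (φ (element F φ iso (o i a))) (o i b) (φ (element F φ iso (o i b))))

  packing : IsHeffterDifferencePacking F φ block
  packing = record
    { differences-distinct = λ {i} {j} {a} {b} {a′} {b′} a≢b _ p →
        let e = log-difference i j {a} {b} {a′} {b′} ⟨ p ⟩
            i≡j , a≡a′ = distinct i j a b a′ b′ a≢b e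
        in i≡j , a≡a′ , second i≡j a≡a′ e
    ; k∣half         = k∣v
    ; distinct-mod-k = λ i {a} {b} p → position-injective
        (Cong-trans (Cong-∣ k∣v (Cong-sym (log i a))) (Cong-trans ⟨ p ⟩ (Cong-∣ k∣v (log i b))))
    ; zero-sum       = sum≈0
    }
    where
    eq : ∀ x y z → y ℤ.- z ≡ -1ℤ ℤ.* ((x ℤ.- y) ℤ.- (x ℤ.- z))
    eq = solve-∀
    second : ∀ {i j a b a′ b′} → i ≡ j → a ≡ a′ → Cong v (o i a ℤ.- o i b) (o j a′ ℤ.- o j b′) → b ≡ b′
    second {i} {a = a} {b} {b′ = b′} ≡.refl ≡.refl e =
      position-injective (Cong-∣ k∣v (combine₁ -1ℤ e (eq (o i a) (o i b) (o i b′))))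

  simple : ∀ i → HasSimpleOrdering F (block i)
  simple i = Permutation.id , partial i

theorem4p7 : ∀ {c ℓ} (k n : ℕ) → 3 ≤ k → ¬ (2 ∣ k) →
    (q : ℕ) → PrimePower q →
    + q ≡ + (2 * k + 1) [mod 4 * k ] →
    8 * k ^ 5 * n < q →
    (F : FiniteField c ℓ q) →
    (φ : AbelianGroup.Carrier (Squares F) → ℤ) → LogIsomorphism F φ →
    ∃ λ (B : Fin n → SquareSubset F k) →
    IsHeffterDifferencePacking F φ B × (∀ i → HasSimpleOrdering F (B i))
theorem4p7 k n 3≤k k-odd q _ q≡[mod] 8k⁵n<q F φ iso = main (cofactor {k} {q} 1≤k q≡[mod]) (not-even k k-odd)
  where
  1≤k : 1 ≤ k
  1≤k = ℕ.≤-trans (ℕ.s≤s ℕ.z≤n) 3≤k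
  instance
    k-nonZero : ℕ.NonZero k
    k-nonZero = ℕ.>-nonZero 1≤k
  Goal : Set _
  Goal = ∃ λ (B : Fin n → SquareSubset F k) → IsHeffterDifferencePacking F φ B × (∀ i → HasSimpleOrdering F (B i))
  main : (∃ λ t → q ≡ 1 + 2 * (k * (1 + 2 * t))) → (∃ λ g → k ≡ 1 + 2 * g) → Goal
  -- The construction indexes positions by 3 + m, so that the three free entries can be matched on;
  -- the finished family is transported to k.
  main (t , q≡) (g , k≡) = assemble (≡.subst (λ K → ∃ λ (o : Fin n → Fin K → ℤ) → Families.Family X k o) 3+m≡k
    (Families.family-exists X k {m} {w} (≡.sym 3+m≡k) v≡kw q≡ {h} v-odd n (cofactor-bound {k} {n} {q} {w} q≡ 8k⁵n<q)))
    where
    m w h : ℕ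
    m = k ℕ.∸ 3
    w = 1 + 2 * t
    h = proj₁ (odd*odd g t)
    3+m≡k : 3 + m ≡ k
    3+m≡k = ℕ.m+[n∸m]≡n 3≤k
    v≡kw : half q ≡ k * w
    v≡kw = half-odd q≡
    v-odd : half q ≡ 1 + 2 * h
    v-odd = ≡.trans v≡kw (≡.trans (≡.cong (_* w) k≡) (proj₂ (odd*odd g t)))
    q≡v : q ≡ 1 + 2 * half q
    q≡v = ≡.trans q≡ (≡.cong (λ x → 1 + 2 * x) (≡.sym v≡kw))
    instance
      v-nonZero : ℕ.NonZero (half q)
      v-nonZero = ≡.subst ℕ.NonZero (≡.sym v-odd) _
    X : Exponential F (half q)
    X = exponential F φ iso q≡v {h} v-odd
    assemble : (∃ λ (o : Fin n → Fin k → ℤ) → Families.Family X k o) → Goal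
    assemble (o , family) = block , packing , simple
      where open Assembly F φ iso q≡v {h} v-odd (Class.k∣v k w v≡kw) o family
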